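{- Let $\varepsilon\in(0,1)$, $d>0$, and let $\{A_g\}_{g\in\mathbb{F}_q^n}$ be a collection of subsets of $\mathbb{F}_q^n$ with $\sum_{g\in\mathbb{F}_q^n}|A_g|\ge 2^{ -d}|\mathbb{F}_q^n|^2$. Let $F=\sum_{g\in\mathbb{F}_q^n}1_{A_g}\circ 1_{A_g+g}$, $F'=\sum_{g\in\mathbb{F}_q^n}1_{A_g}\circ 1_{A_g}$, and let $D\colon\mathbb{F}_q^n\to\mathbb{R}_{\ge0}$ be given by $D(x)=|A_x|$. Then either (1) $|\langle \mu_F,\mu_D\rangle-1|\le\varepsilon$, or (2) there exists a subspace $V\subseteq\mathbb{F}_q^n$ of co-dimension $O_\varepsilon(d^8)$ such that $\|\mu_{F'}\ast\mu_V\|_\infty\ge 1+\frac{1}{32}\varepsilon$.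
   Context: $q$ is a prime power and $\mathbb{F}_q^n$ is viewed as a finite Abelian group $G$. For $f,g\colon G\to\mathbb{R}$: $\mathbb{E}_{x}f(x)=\frac1{|G|}\sum_{x\in G}f(x)$; $\langle f,g\rangle=\mathbb{E}_x f(x)g(x)$; $\|f\|_\infty=\max_x|f(x)|$; $(f\ast g)(x)=\mathbb{E}_y f(y)g(x-y)$; $(f\circ g)(x)=\mathbb{E}_y f(y)g(x+y)$. For $A\subseteq G$, $1_A$ is its indicator, $A+g=\{a+g:a\in A\}$, and $\mu_A=\frac{|G|}{|A|}1_A$. For a function $f$ with $\mathbb{E}f\ne0$, $\mu_f=f/\mathbb{E}f$. $O_\varepsilon(\cdot)$ hides a constant depending only on $\varepsilon$.
   Formalization: The parameter ε is restricted to rational numbers in (0,1); d is likewise taken to be a positive rational, which only affects the constant in the bound O_ε(d^8). -}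

module Defs where

open import Data.Nat as ℕ using (ℕ; zero; suc)
open import Data.Integer using (+_)
open import Data.Rational as ℚ using (ℚ; 0ℚ; 1ℚ; ∣_∣; _⊔_; _÷_; ≢-nonZero)
open import Data.Rational.Properties using (_≟_)
open import Data.Bool using (Bool; true; false; if_then_else_)
open import Data.List using (List; []; _∷_; [_]; map; concatMap; length; foldr; filter)
open import Data.List.Membership.Propositional using (_∈_)
open import Data.List.Relation.Unary.Unique.Propositional using (Unique)
open import Data.Vec using (Vec; []; _∷_; zipWith; replicate)
open import Data.Product using (Σ; _×_)
open import Relation.Binary.PropositionalEquality using (_≡_; _≢_)
open import Relation.Binary.Definitions using (DecidableEquality)
open import Relation.Nullary using (yes; no)
open import Algebra.Structures using (IsCommutativeRing)

record FiniteField : Set₁ where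
  field
    Carrier    : Set
    _+_ _*_    : Carrier → Carrier → Carrier
    -_         : Carrier → Carrier
    0# 1#      : Carrier
    isCommutativeRing : IsCommutativeRing _≡_ _+_ _*_ -_ 0# 1#
    0≢1        : 0# ≢ 1#
    inverse    : ∀ x → x ≢ 0# → Σ Carrier (λ y → x * y ≡ 1#)
    _≟F_       : DecidableEquality Carrier
    elements   : List Carrier
    complete   : ∀ x → x ∈ elements
    unique     : Unique elements

  q : ℕ
  q = length elements

-- Total division on ℚ (x / 0 := 0); only used where the denominator is nonzero.
_÷'_ : ℚ → ℚ → ℚ
x ÷' y with y ≟ 0ℚ
... | yes _ = 0ℚ
... | no y≢0 = _÷_ x y {{≢-nonZero y≢0}}

module FF (𝔽 : FiniteField) (n : ℕ) where
  open FiniteField 𝔽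

  G : Set
  G = Vec Carrier n

  _+G_ : G → G → G
  _+G_ = zipWith _+_

  _-G_ : G → G → G
  x -G y = zipWith (λ a b → a + (- b)) x y

  0G : G
  0G = replicate n 0#

  _·G_ : Carrier → G → G
  c ·G x = Data.Vec.map (c *_) x

  allVecs : (m : ℕ) → List (Vec Carrier m)
  allVecs zero = [ [] ]
  allVecs (suc m) = concatMap (λ x → map (x ∷_) (allVecs m)) elements

  elemsG : List G
  elemsG = allVecs n

  |G| : ℚ
  |G| = + length elemsG ℚ./ 1

  sumG : (G → ℚ) → ℚ
  sumG f = foldr (λ x s → f x ℚ.+ s) 0ℚ elemsG

  𝔼 : (G → ℚ) → ℚ
  𝔼 f = sumG f ÷' |G|

  ⟨_,_⟩ : (G → ℚ) → (G → ℚ) → ℚ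
  ⟨ f , g ⟩ = 𝔼 (λ x → f x ℚ.* g x)

  ‖_‖∞ : (G → ℚ) → ℚ
  ‖ f ‖∞ = foldr (λ x m → ∣ f x ∣ ⊔ m) 0ℚ elemsG

  _∗_ : (G → ℚ) → (G → ℚ) → G → ℚ
  (f ∗ g) x = 𝔼 (λ y → f y ℚ.* g (x -G y))

  _⊚_ : (G → ℚ) → (G → ℚ) → G → ℚ
  (f ⊚ g) x = 𝔼 (λ y → f y ℚ.* g (x +G y))

  Subset : Set
  Subset = G → Bool

  1[_] : Subset → G → ℚ
  1[ A ] x = if A x then 1ℚ else 0ℚ

  card : Subset → ℕ
  card A = length (filter (λ x → Data.Bool.T? (A x)) elemsG)

  _⊕_ : Subset → G → Subset
  (A ⊕ g) x = A (x -G g)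

  μSet : Subset → G → ℚ
  μSet A x = (|G| ÷' (+ card A ℚ./ 1)) ℚ.* 1[ A ] x

  μ : (G → ℚ) → G → ℚ
  μ f x = f x ÷' 𝔼 f

  record Subspace : Set where
    field
      mem      : Subset
      zero-mem : mem 0G ≡ true
      +-mem    : ∀ x y → mem x ≡ true → mem y ≡ true → mem (x +G y) ≡ true
      ·-mem    : ∀ c x → mem x ≡ true → mem (c ·G x) ≡ true

  -- V has codimension c, i.e. dim V = n - c, i.e. |V| · q^c = q^n
  HasCodim : Subspace → ℕ → Set
  HasCodim V c = card (Subspace.mem V) ℕ.* (q ℕ.^ c) ≡ q ℕ.^ n

  sumGℕ : (G → ℕ) → ℕ
  sumGℕ f = foldr (λ x s → f x ℕ.+ s) 0 elemsG

{-# OPTIONS --safe #-}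
module Submission where

-- A Kelley–Meka argument without Fourier analysis, so that every quantity is rational.
-- If (1) fails, Hölder makes the p-th moment of μ_F - 1 large for some p = O_ε(d). Powers of Gram
-- kernels are Gram kernels, so Cauchy–Schwarz bounds it by the p-th moment of μ_F′ - 1 and shows
-- that all moments of μ_F′ - 1 are nonnegative. Hence a high moment of μ_F′ is large, and expanding it
-- yields B of density 2^{-O(d²)} such that μ_F′ exceeds 1 + ε/24 at almost all differences of B.
-- Random sampling from B gives a set T of almost-periods of density 2^{-O(d⁸)}. Call ξ biased if
-- the law of ξ·t for t ∈ T is far from uniform in total variation. Independence of the coordinates
-- leaves room for only O(d⁸) independent biased directions; let V be their annihilator. By Parseval
-- over the fibres of all functionals, convolution by T contracts functions that vanish on average
-- on every coset of V. So smoothing B by V is harmless, and μ_F′ ∗ μ_V is large somewhere.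

open import Defs
open import Data.Nat as ℕ using (ℕ; zero; suc)
import Data.Nat.Properties as ℕₚ
import Data.Nat.Coprimality as Coprimality
open import Data.Nat.Tactic.RingSolver using (solve-∀)
import Data.Integer as ℤ
open ℤ using (-[1+_])
import Data.Integer.Properties as ℤₚ
open import Data.Rational as ℚ using (ℚ; mkℚ; 0ℚ; 1ℚ; ∣_∣; _≤_; _<_; *≤*)
import Data.Rational.Properties as ℚₚ
open ℚₚ using (<⇒≤; ≤-trans; ≤-reflexive; <-≤-trans; ≤-<-trans; <-irrefl; ≮⇒≥; ≰⇒>; ≤-refl; <-trans; ≤-total; nonNegative⁻¹; positive⁻¹; _≤?_; _<?_)
open import Data.Bool using (Bool; true; false; if_then_else_; _∧_; T?)
import Data.Bool.Properties as Boolₚ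
open import Data.List as List using (List; []; _∷_; _++_; foldr; length; filter; concatMap)
open import Data.List.Membership.Propositional using (_∈_; lose)
open import Data.List.Membership.Propositional.Properties using (∈-concatMap⁺; ∈-map⁺)
open import Data.List.Relation.Unary.Any using (here; there)
open import Data.List.Relation.Unary.All using (All; []; _∷_)
open import Data.List.Relation.Unary.AllPairs using (_∷_)
open import Data.List.Relation.Unary.Unique.Propositional using (Unique)
open import Data.Vec as Vec using (Vec; []; _∷_; zipWith; replicate)
import Data.Vec.Properties as Vecₚ
open import Data.Product using (Σ; ∃-syntax; _×_; _,_; proj₁; proj₂)
open import Data.Sum using (_⊎_; inj₁; inj₂)
open import Data.Empty using (⊥-elim)
open import Function using (_∘_)
open import Relation.Nullary using (¬_; Dec; yes; no; does)
open import Relation.Nullary.Decidable using (dec⇒maybe; toWitness; _×-dec_; ¬?)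
open import Relation.Binary.Definitions using (DecidableEquality)
open import Relation.Binary.PropositionalEquality hiding (J)
open import Algebra.Bundles using (CommutativeRing)
open import Algebra.Structures using (IsCommutativeRing)
open import Algebra.Solver.Ring.AlmostCommutativeRing using (fromCommutativeRing; _-Raw-AlmostCommutative⟶_)
import Algebra.Solver.Ring as RingSolver
import Algebra.Solver.Ring.NaturalCoefficients.Default as SemiringSolver
import Algebra.Properties.AbelianGroup as AbelianGroupProperties

-- The bound O_ε(d⁸) must also hold for d close to 0, where it leaves only codimension 0; there (2)
-- is impossible, because averaging μ_F′ over the whole group gives 1. So (1) is proved directly for
-- nearly full families; for all others d is bounded below in terms of ε and can be rounded up to a
-- power of two. The exponent 8 is 2 + 4 + 2. B has density 2^(-L) with L = O(d²). To beat this
-- density the smoothing needs O(d²) convolutions with T, so each may cost only about 1/d², which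
-- takes O(d⁴) samples per estimate. Finally O(d²) independent groups of samples make the failures
-- negligible against the density of B. Real exponents and exponential moments are avoided: Hölder
-- becomes iterated Cauchy-Schwarz, and large deviation bounds become products over groups of a
-- quantity controlled by its variance. The sets B and T of the overview are relaxed to weights with
-- values in [0, 1], so nothing has to be rounded to a set.

private variable
  𝕏 𝕐 : Set

-- Sealed rational arithmetic and its order

infixl 6 _+_ _-_
infixl 7 _*_
infix 8 -_

-- The field operations of ℚ unfold on arbitrary arguments, which defeats
-- unification; sealing them makes terms over ℚ rigid.
opaque
  _+_ : ℚ → ℚ → ℚ
  _+_ = ℚ._+_

  _*_ : ℚ → ℚ → ℚ
  _*_ = ℚ._*_

  -_ : ℚ → ℚ
  -_ = ℚ.-_

  ∥_∥ : ℚ → ℚ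
  ∥_∥ = ℚ.∣_∣

  inv : ℚ → ℚ
  inv x = 1ℚ ÷' x

_-_ : ℚ → ℚ → ℚ
x - y = x + - y

opaque
  unfolding _+_

  isCommutativeRing : IsCommutativeRing _≡_ _+_ _*_ -_ 0ℚ 1ℚ
  isCommutativeRing = ℚₚ.+-*-isCommutativeRing

  +-monoʳ-≤ : ∀ a {b c} → b ≤ c → a + b ≤ a + c
  +-monoʳ-≤ = ℚₚ.+-monoʳ-≤

  +-monoˡ-≤ : ∀ a {b c} → b ≤ c → b + a ≤ c + a
  +-monoˡ-≤ = ℚₚ.+-monoˡ-≤

  +-monoʳ-< : ∀ a {b c} → b < c → a + b < a + c
  +-monoʳ-< = ℚₚ.+-monoʳ-<

  +-monoˡ-< : ∀ a {b c} → b < c → b + a < c + a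
  +-monoˡ-< = ℚₚ.+-monoˡ-<

  *-monoˡ : ∀ {a b} c → 0ℚ ≤ c → a ≤ b → c * a ≤ c * b
  *-monoˡ c 0≤c = ℚₚ.*-monoˡ-≤-nonNeg c {{ℚ.nonNegative 0≤c}}

  *-mono-<ʳ : ∀ {a b} c → 0ℚ < c → a < b → a * c < b * c
  *-mono-<ʳ c 0<c = ℚₚ.*-monoˡ-<-pos c {{ℚ.positive 0<c}}

  *-cancelʳ : ∀ {a b} c → 0ℚ < c → a * c ≤ b * c → a ≤ b
  *-cancelʳ c 0<c = ℚₚ.*-cancelʳ-≤-pos c {{ℚ.positive 0<c}}

  neg-antimono-≤ : ∀ {a b} → a ≤ b → - b ≤ - a
  neg-antimono-≤ = ℚₚ.neg-antimono-≤

  neg-distrib-+ : ∀ a b → - (a + b) ≡ - a + - b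
  neg-distrib-+ = ℚₚ.neg-distrib-+

  -0≡0 : - 0ℚ ≡ 0ℚ
  -0≡0 = refl

  inv-* : ∀ {y} → 0ℚ < y → y * inv y ≡ 1ℚ
  inv-* {y} 0<y with y ℚₚ.≟ 0ℚ
  ... | yes refl = ⊥-elim (<-irrefl refl 0<y)
  ... | no y≢0 = trans (cong (y *_) (ℚₚ.*-identityˡ _)) (ℚₚ.*-inverseʳ y {{ℚ.≢-nonZero y≢0}})

  ÷'-inv : ∀ x y → x ÷' y ≡ x * inv y
  ÷'-inv x y with y ℚₚ.≟ 0ℚ
  ... | yes _ = sym (ℚₚ.*-zeroʳ x)
  ... | no y≢0 = cong (x *_) (sym (ℚₚ.*-identityˡ _))

  ∣0∣ : ∥ 0ℚ ∥ ≡ 0ℚ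
  ∣0∣ = refl

  0≤∣∣ : ∀ x → 0ℚ ≤ ∥ x ∥
  0≤∣∣ = ℚₚ.0≤∣p∣

  ∣+∣≤ : ∀ x y → ∥ x + y ∥ ≤ ∥ x ∥ + ∥ y ∥
  ∣+∣≤ = ℚₚ.∣p+q∣≤∣p∣+∣q∣

  ∣*∣ : ∀ x y → ∥ x * y ∥ ≡ ∥ x ∥ * ∥ y ∥
  ∣*∣ = ℚₚ.∣p*q∣≡∣p∣*∣q∣

  ∣-∣ : ∀ x → ∥ - x ∥ ≡ ∥ x ∥
  ∣-∣ = ℚₚ.∣-p∣≡∣p∣

  0≤⇒∣∣ : ∀ {x} → 0ℚ ≤ x → ∥ x ∥ ≡ x
  0≤⇒∣∣ = ℚₚ.0≤p⇒∣p∣≡p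

  -- Coefficients of the ring solver live in the unsealed copy of ℚ, where they compute.
  +-homo : ∀ x y → x ℚ.+ y ≡ x + y
  +-homo x y = refl

  *-homo : ∀ x y → x ℚ.* y ≡ x * y
  *-homo x y = refl

  neg-homo : ∀ x → ℚ.- x ≡ - x
  neg-homo x = refl

ℚ-commutativeRing : CommutativeRing _ _
ℚ-commutativeRing = record { isCommutativeRing = isCommutativeRing }

open IsCommutativeRing isCommutativeRing public
  using (+-assoc; +-comm; +-identityˡ; +-identityʳ; *-assoc; *-comm; *-identityˡ; *-identityʳ; zeroˡ; zeroʳ; distribˡ; distribʳ)
  renaming (-‿inverseʳ to +-inverseʳ)

coefficients : CommutativeRing.rawRing ℚₚ.+-*-commutativeRing -Raw-AlmostCommutative⟶ fromCommutativeRing ℚ-commutativeRing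
coefficients = record { ⟦_⟧ = λ x → x ; +-homo = +-homo ; *-homo = *-homo ; -‿homo = neg-homo ; 0-homo = refl ; 1-homo = refl }

open RingSolver (CommutativeRing.rawRing ℚₚ.+-*-commutativeRing) (fromCommutativeRing ℚ-commutativeRing) coefficients
  (λ x y → dec⇒maybe (x ℚₚ.≟ y)) public using (solve; con; _:+_; _:*_; _:-_; :-_; _:=_)

infixr 9 _^_
_^_ : ℚ → ℕ → ℚ
x ^ zero = 1ℚ
x ^ suc n = x * x ^ n

opaque
  ι : ℕ → ℚ
  ι n = ℤ.+ n ℚ./ 1

  ι-def : ∀ n → ℤ.+ n ℚ./ 1 ≡ ι n
  ι-def n = refl

≤-respˡ : ∀ {a b c : ℚ} → a ≡ b → a ≤ c → b ≤ c
≤-respˡ refl p = p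

≤-respʳ : ∀ {a b c : ℚ} → b ≡ c → a ≤ b → a ≤ c
≤-respʳ refl p = p

≤-by : ∀ {a b} e → 0ℚ ≤ e → a + e ≡ b → a ≤ b
≤-by {a} e 0≤e refl = subst (_≤ a + e) (+-identityʳ a) (+-monoʳ-≤ a 0≤e)

<-by : ∀ {a b} e → 0ℚ < e → a + e ≡ b → a < b
<-by {a} e 0<e refl = subst (_< a + e) (+-identityʳ a) (+-monoʳ-< a 0<e)

0≤b-a : ∀ {a b} → a ≤ b → 0ℚ ≤ b - a
0≤b-a {a} {b} a≤b = subst (_≤ b - a) (+-inverseʳ a) (+-monoˡ-≤ (- a) a≤b)

0<b-a : ∀ {a b} → a < b → 0ℚ < b - a
0<b-a {a} {b} a<b = subst (_< b - a) (+-inverseʳ a) (+-monoˡ-< (- a) a<b)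

0≤+ : ∀ {a b} → 0ℚ ≤ a → 0ℚ ≤ b → 0ℚ ≤ a + b
0≤+ {a} {b} 0≤a 0≤b = ≤-trans 0≤a (≤-by b 0≤b refl)

0<+ : ∀ {a b} → 0ℚ < a → 0ℚ ≤ b → 0ℚ < a + b
0<+ {a} {b} 0<a 0≤b = <-≤-trans 0<a (≤-by b 0≤b refl)

*-monoʳ : ∀ {a b} c → 0ℚ ≤ c → a ≤ b → a * c ≤ b * c
*-monoʳ {a} {b} c 0≤c a≤b = subst₂ _≤_ (*-comm c a) (*-comm c b) (*-monoˡ c 0≤c a≤b)

+-mono : ∀ {a b c d} → a ≤ b → c ≤ d → a + c ≤ b + d
+-mono {a} {b} {c} {d} a≤b c≤d = ≤-trans (+-monoʳ-≤ a c≤d) (+-monoˡ-≤ d a≤b)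

*-mono : ∀ {a b c d} → 0ℚ ≤ a → 0ℚ ≤ d → a ≤ b → c ≤ d → a * c ≤ b * d
*-mono {a} {b} {c} {d} 0≤a 0≤d a≤b c≤d = ≤-trans (*-monoˡ a 0≤a c≤d) (*-monoʳ d 0≤d a≤b)

0≤* : ∀ {a b} → 0ℚ ≤ a → 0ℚ ≤ b → 0ℚ ≤ a * b
0≤* {a} {b} 0≤a 0≤b = subst (_≤ a * b) (zeroʳ a) (*-monoˡ a 0≤a 0≤b)

0<* : ∀ {a b} → 0ℚ < a → 0ℚ < b → 0ℚ < a * b
0<* {a} {b} 0<a 0<b = subst (_< a * b) (zeroˡ b) (*-mono-<ʳ b 0<b 0<a)

0≤1 : 0ℚ ≤ 1ℚ
0≤1 = nonNegative⁻¹ 1ℚ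

0<1 : 0ℚ < 1ℚ
0<1 = positive⁻¹ 1ℚ

0≤neg : ∀ {a} → a ≤ 0ℚ → 0ℚ ≤ - a
0≤neg a≤0 = ≤-respˡ -0≡0 (neg-antimono-≤ a≤0)

0≤sq : ∀ a → 0ℚ ≤ a * a
0≤sq a with ≤-total 0ℚ a
... | inj₁ p = 0≤* p p
... | inj₂ p = subst (0ℚ ≤_) (solve 1 (λ a → (:- a) :* (:- a) := a :* a) refl a) (0≤* (0≤neg p) (0≤neg p))

0<inv : ∀ {y} → 0ℚ < y → 0ℚ < inv y
0<inv {y} 0<y with inv y ≤? 0ℚ
... | no ¬p = ≰⇒> ¬p
... | yes p = ⊥-elim (<-irrefl refl (<-≤-trans 0<1
  (subst₂ _≤_ (inv-* 0<y) (zeroʳ y) (*-monoˡ y (<⇒≤ 0<y) p))))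

0≤inv : ∀ {y} → 0ℚ < y → 0ℚ ≤ inv y
0≤inv 0<y = <⇒≤ (0<inv 0<y)

inv-cancelʳ : ∀ x {y} → 0ℚ < y → x * inv y * y ≡ x
inv-cancelʳ x {y} 0<y = trans (*-assoc x _ _) (trans (cong (x *_) (trans (*-comm _ y) (inv-* 0<y))) (*-identityʳ x))

opaque
  unfolding ι _+_ _*_

  ι-mk : ∀ n → ι n ≡ mkℚ (ℤ.+ n) 0 (Coprimality.sym (Coprimality.1-coprimeTo n))
  ι-mk n = ℚₚ.normalize-coprime (Coprimality.sym (Coprimality.1-coprimeTo n))

  ι-+ : ∀ m n → ι (m ℕ.+ n) ≡ ι m + ι n
  ι-+ m n rewrite ι-mk m | ι-mk n = cong (ℚ._/ 1) (sym (cong₂ ℤ._+_ (ℤₚ.*-identityʳ (ℤ.+ m)) (ℤₚ.*-identityʳ (ℤ.+ n))))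

  ι-* : ∀ m n → ι (m ℕ.* n) ≡ ι m * ι n
  ι-* m n rewrite ι-mk m | ι-mk n = cong (ℚ._/ 1) (ℤₚ.pos-* m n)

  ι0 : ι 0 ≡ 0ℚ
  ι0 = refl

  ι1 : ι 1 ≡ 1ℚ
  ι1 = refl

  0≤ι : ∀ n → 0ℚ ≤ ι n
  0≤ι n = nonNegative⁻¹ (ι n) {{ℚₚ.normalize-nonNeg n 1}}

ι-suc : ∀ n → ι (suc n) ≡ 1ℚ + ι n
ι-suc n = trans (ι-+ 1 n) (cong (_+ ι n) ι1)

ι-mono : ∀ {m n} → m ℕ.≤ n → ι m ≤ ι n
ι-mono {m} {n} m≤n = ≤-by (ι (n ℕ.∸ m)) (0≤ι (n ℕ.∸ m)) (trans (sym (ι-+ m (n ℕ.∸ m))) (cong ι (ℕₚ.m+[n∸m]≡n m≤n)))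

ι-mono-< : ∀ {m n} → m ℕ.< n → ι m < ι n
ι-mono-< {m} {n} m<n = <-≤-trans (<-by 1ℚ 0<1 (trans (+-comm (ι m) 1ℚ) (sym (ι-suc m)))) (ι-mono m<n)

ι-cancel-≤ : ∀ {m n} → ι m ≤ ι n → m ℕ.≤ n
ι-cancel-≤ {m} {n} p with m ℕ.≤? n
... | yes q = q
... | no q = ⊥-elim (<-irrefl refl (<-≤-trans (ι-mono-< (ℕₚ.≰⇒> q)) p))

ι-injective : ∀ {m n} → ι m ≡ ι n → m ≡ n
ι-injective p = ℕₚ.≤-antisym (ι-cancel-≤ (≤-reflexive p)) (ι-cancel-≤ (≤-reflexive (sym p)))

ι-^ : ∀ m n → ι (m ℕ.^ n) ≡ ι m ^ n
ι-^ m zero = ι1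
ι-^ m (suc n) = trans (ι-* m (m ℕ.^ n)) (cong (ι m *_) (ι-^ m n))

archimedean : ∀ x → ∃[ n ] x ≤ ι n
archimedean x@(mkℚ (ℤ.+ n) d c) = n , ≤-respʳ (sym (ι-mk n)) (*≤* (ℤₚ.*-monoˡ-≤-nonNeg (ℤ.+ n) (ℤ.+≤+ (ℕ.s≤s ℕ.z≤n))))
archimedean x@(mkℚ -[1+ n ] d c) = 0 , ≤-respʳ (sym ι0) (ℚₚ.nonPositive⁻¹ x)

-- Powers and Bernoulli's inequality

^-distrib : ∀ x y n → (x * y) ^ n ≡ x ^ n * y ^ n
^-distrib x y zero = sym (*-identityˡ 1ℚ)
^-distrib x y (suc n) rewrite ^-distrib x y n = solve 4 (λ a b c d → a :* b :* (c :* d) := a :* c :* (b :* d)) refl x y (x ^ n) (y ^ n)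

^-+ : ∀ x m n → x ^ (m ℕ.+ n) ≡ x ^ m * x ^ n
^-+ x zero n = sym (*-identityˡ _)
^-+ x (suc m) n = trans (cong (x *_) (^-+ x m n)) (sym (*-assoc x _ _))

1^ : ∀ n → 1ℚ ^ n ≡ 1ℚ
1^ zero = refl
1^ (suc n) = trans (*-identityˡ _) (1^ n)

^-* : ∀ x m n → x ^ (m ℕ.* n) ≡ (x ^ m) ^ n
^-* x zero n = sym (1^ n)
^-* x (suc m) n = trans (^-+ x n (m ℕ.* n)) (trans (cong (x ^ n *_) (^-* x m n)) (sym (^-distrib x (x ^ m) n)))

0≤^ : ∀ {x} n → 0ℚ ≤ x → 0ℚ ≤ x ^ n
0≤^ zero _ = 0≤1
0≤^ (suc n) 0≤x = 0≤* 0≤x (0≤^ n 0≤x)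

0<^ : ∀ {x} n → 0ℚ < x → 0ℚ < x ^ n
0<^ zero _ = 0<1
0<^ (suc n) 0<x = 0<* 0<x (0<^ n 0<x)

^-mono : ∀ {x y} n → 0ℚ ≤ x → x ≤ y → x ^ n ≤ y ^ n
^-mono zero _ _ = ≤-refl
^-mono (suc n) 0≤x x≤y = *-mono 0≤x (0≤^ n (≤-trans 0≤x x≤y)) x≤y (^-mono n 0≤x x≤y)

^-mono-< : ∀ {x y} n → 0ℚ ≤ x → x < y → x ^ suc n < y ^ suc n
^-mono-< {x} {y} n 0≤x x<y = ≤-<-trans (*-monoˡ x 0≤x (^-mono n 0≤x (<⇒≤ x<y)))
  (*-mono-<ʳ (y ^ n) (0<^ n (≤-<-trans 0≤x x<y)) x<y)

1≤^ : ∀ {x} n → 1ℚ ≤ x → 1ℚ ≤ x ^ n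
1≤^ n 1≤x = ≤-respˡ (1^ n) (^-mono n 0≤1 1≤x)

^-monoʳ : ∀ {x m n} → 1ℚ ≤ x → m ℕ.≤ n → x ^ m ≤ x ^ n
^-monoʳ {x} {m} {n} 1≤x m≤n = subst₂ _≤_ (*-identityʳ _) (trans (sym (^-+ x m _)) (cong (x ^_) (ℕₚ.m+[n∸m]≡n m≤n)))
  (*-monoˡ (x ^ m) (0≤^ m (≤-trans 0≤1 1≤x)) (1≤^ (n ℕ.∸ m) 1≤x))

-- Bernoulli's inequality for the exponent m - k of either sign, with the power (1 + a)^k cleared.
-- Negative exponents give the upper bound in `[1+x]^m≤2`; in `chain-bound` this is the tangent at k
-- to the convex function (1 + a)^t, which stands in for Jensen.
bernoulli : ∀ a → 0ℚ ≤ a → ∀ m k → (1ℚ + a) ^ k * (1ℚ + (ι m - ι k) * a) ≤ (1ℚ + a) ^ m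
bernoulli a 0≤a zero zero = ≤-reflexive (solve 2 (λ a x → con 1ℚ :* (con 1ℚ :+ (x :- x) :* a) := con 1ℚ) refl a (ι 0))
bernoulli a 0≤a (suc m) zero = ≤-trans
  (≤-by (ι m * a * a) (0≤* (0≤* (0≤ι m) 0≤a) 0≤a)
    (trans (cong₂ (λ z o → 1ℚ * (1ℚ + (z - o) * a) + ι m * a * a) (ι-suc m) ι0)
      (trans (solve 2 (λ a m → con 1ℚ :* (con 1ℚ :+ (con 1ℚ :+ m :- con 0ℚ) :* a) :+ m :* a :* a := (con 1ℚ :+ a) :* (con 1ℚ :* (con 1ℚ :+ (m :- con 0ℚ) :* a))) refl a (ι m))
        (cong (λ o → (1ℚ + a) * (1ℚ * (1ℚ + (ι m - o) * a))) (sym ι0)))))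
  (*-monoˡ (1ℚ + a) (0≤+ 0≤1 0≤a) (bernoulli a 0≤a m zero))
bernoulli a 0≤a zero (suc k) = ≤-trans
  (≤-by ((1ℚ + a) ^ k * (a * a) * ι (suc k)) (0≤* (0≤* (0≤^ k (0≤+ 0≤1 0≤a)) (0≤* 0≤a 0≤a)) (0≤ι (suc k)))
    (trans (cong₂ (λ z o → (1ℚ + a) * (1ℚ + a) ^ k * (1ℚ + (o - z) * a) + (1ℚ + a) ^ k * (a * a) * z) (ι-suc k) ι0)
      (trans (solve 3 (λ a k p → (con 1ℚ :+ a) :* p :* (con 1ℚ :+ (con 0ℚ :- (con 1ℚ :+ k)) :* a) :+ p :* (a :* a) :* (con 1ℚ :+ k) := p :* (con 1ℚ :+ (con 0ℚ :- k) :* a)) refl a (ι k) ((1ℚ + a) ^ k))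
        (cong (λ o → (1ℚ + a) ^ k * (1ℚ + (o - ι k) * a)) (sym ι0)))))
  (bernoulli a 0≤a zero k)
bernoulli a 0≤a (suc m) (suc k) = ≤-respˡ
  (trans (solve 4 (λ a m k p → (con 1ℚ :+ a) :* (p :* (con 1ℚ :+ (m :- k) :* a)) := (con 1ℚ :+ a) :* p :* (con 1ℚ :+ (con 1ℚ :+ m :- (con 1ℚ :+ k)) :* a)) refl a (ι m) (ι k) ((1ℚ + a) ^ k))
    (sym (cong₂ (λ y z → (1ℚ + a) * (1ℚ + a) ^ k * (1ℚ + (y - z) * a)) (ι-suc m) (ι-suc k))))
  (*-monoˡ (1ℚ + a) (0≤+ 0≤1 0≤a) (bernoulli a 0≤a m k))

1+na≤ : ∀ a → 0ℚ ≤ a → ∀ n → 1ℚ + ι n * a ≤ (1ℚ + a) ^ n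
1+na≤ a 0≤a n = ≤-respˡ (trans (cong (λ o → 1ℚ * (1ℚ + (ι n - o) * a)) ι0)
  (solve 2 (λ a n → con 1ℚ :* (con 1ℚ :+ (n :- con 0ℚ) :* a) := con 1ℚ :+ n :* a) refl a (ι n))) (bernoulli a 0≤a n 0)

2ℚ : ℚ
2ℚ = ℤ.+ 2 ℚ./ 1

0<2 : 0ℚ < 2ℚ
0<2 = positive⁻¹ 2ℚ

0≤2 : 0ℚ ≤ 2ℚ
0≤2 = <⇒≤ 0<2

4ℚ : ℚ
4ℚ = ℤ.+ 4 ℚ./ 1

0<4 : 0ℚ < 4ℚ
0<4 = positive⁻¹ 4ℚ

1≤2 : 1ℚ ≤ 2ℚ
1≤2 = ≤-by 1ℚ 0≤1 (solve 0 (con 1ℚ :+ con 1ℚ := con 2ℚ) refl)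

ι≤2^ : ∀ n → ι n ≤ 2ℚ ^ n
ι≤2^ n = subst (λ z → ι n ≤ z ^ n) (solve 0 (con 1ℚ :+ con 1ℚ := con 2ℚ) refl) (≤-trans (≤-by 1ℚ 0≤1 (solve 1 (λ n → n :+ con 1ℚ := con 1ℚ :+ n :* con 1ℚ) refl (ι n))) (1+na≤ 1ℚ 0≤1 n))

∃2^≥ : ∀ x → ∃[ n ] x ≤ 2ℚ ^ n
∃2^≥ x with archimedean x
... | n , p = n , ≤-trans p (ι≤2^ n)

-- Finite sums

Sum : List 𝕏 → (𝕏 → ℚ) → ℚ
Sum xs f = foldr (λ x s → f x + s) 0ℚ xs

Sum-cong : ∀ (xs : List 𝕏) {f g : 𝕏 → ℚ} → (∀ x → f x ≡ g x) → Sum xs f ≡ Sum xs g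
Sum-cong [] h = refl
Sum-cong (x ∷ xs) h = cong₂ _+_ (h x) (Sum-cong xs h)

Sum-+ : ∀ (xs : List 𝕏) (f g : 𝕏 → ℚ) → Sum xs (λ x → f x + g x) ≡ Sum xs f + Sum xs g
Sum-+ [] f g = sym (+-identityˡ 0ℚ)
Sum-+ (x ∷ xs) f g = trans (cong (f x + g x +_) (Sum-+ xs f g))
  (solve 4 (λ a b c d → a :+ b :+ (c :+ d) := a :+ c :+ (b :+ d)) refl (f x) (g x) (Sum xs f) (Sum xs g))

Sum-*ˡ : ∀ (xs : List 𝕏) c (f : 𝕏 → ℚ) → Sum xs (λ x → c * f x) ≡ c * Sum xs f
Sum-*ˡ [] c f = sym (zeroʳ c)
Sum-*ˡ (x ∷ xs) c f = trans (cong (c * f x +_) (Sum-*ˡ xs c f)) (sym (distribˡ c _ _))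

Sum-*ʳ : ∀ (xs : List 𝕏) c (f : 𝕏 → ℚ) → Sum xs (λ x → f x * c) ≡ Sum xs f * c
Sum-*ʳ xs c f = trans (Sum-cong xs (λ x → *-comm (f x) c)) (trans (Sum-*ˡ xs c f) (*-comm c _))

Sum-neg : ∀ (xs : List 𝕏) (f : 𝕏 → ℚ) → Sum xs (λ x → - f x) ≡ - Sum xs f
Sum-neg [] f = sym -0≡0
Sum-neg (x ∷ xs) f = trans (cong (- f x +_) (Sum-neg xs f)) (sym (neg-distrib-+ (f x) _))

Sum-- : ∀ (xs : List 𝕏) (f g : 𝕏 → ℚ) → Sum xs (λ x → f x - g x) ≡ Sum xs f - Sum xs g
Sum-- xs f g = trans (Sum-+ xs f (λ x → - g x)) (cong (Sum xs f +_) (Sum-neg xs g))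

Sum-0 : ∀ (xs : List 𝕏) → Sum xs (λ _ → 0ℚ) ≡ 0ℚ
Sum-0 [] = refl
Sum-0 (x ∷ xs) = trans (+-identityˡ _) (Sum-0 xs)

Sum-const : ∀ (xs : List 𝕏) c → Sum xs (λ _ → c) ≡ ι (length xs) * c
Sum-const [] c = trans (sym (zeroˡ c)) (cong (_* c) (sym ι0))
Sum-const (x ∷ xs) c = trans (cong (c +_) (Sum-const xs c))
  (trans (solve 2 (λ c l → c :+ l :* c := (con 1ℚ :+ l) :* c) refl c (ι (length xs))) (cong (_* c) (sym (ι-suc (length xs)))))

Sum-swap : ∀ (xs : List 𝕏) (ys : List 𝕐) (f : 𝕏 → 𝕐 → ℚ) →
  Sum xs (λ x → Sum ys (f x)) ≡ Sum ys (λ y → Sum xs (λ x → f x y))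
Sum-swap [] ys f = sym (Sum-0 ys)
Sum-swap (x ∷ xs) ys f = trans (cong (Sum ys (f x) +_) (Sum-swap xs ys f)) (sym (Sum-+ ys (f x) _))

Sum-mono : ∀ (xs : List 𝕏) {f g : 𝕏 → ℚ} → (∀ x → f x ≤ g x) → Sum xs f ≤ Sum xs g
Sum-mono [] h = ≤-refl
Sum-mono (x ∷ xs) h = +-mono (h x) (Sum-mono xs h)

0≤Sum : ∀ (xs : List 𝕏) {f : 𝕏 → ℚ} → (∀ x → 0ℚ ≤ f x) → 0ℚ ≤ Sum xs f
0≤Sum xs h = ≤-respˡ (Sum-0 xs) (Sum-mono xs h)

Sum-pos : ∀ (xs : List 𝕏) (f : 𝕏 → ℚ) → 0ℚ < Sum xs f → ∃[ x ] 0ℚ < f x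
Sum-pos [] f p = ⊥-elim (<-irrefl refl p)
Sum-pos (x ∷ xs) f p with 0ℚ <? f x
... | yes q = x , q
... | no q = Sum-pos xs f (<-≤-trans p (≤-respʳ (+-identityˡ _) (+-monoˡ-≤ (Sum xs f) (≮⇒≥ q))))

Sum-++ : ∀ (xs ys : List 𝕏) (f : 𝕏 → ℚ) → Sum (xs ++ ys) f ≡ Sum xs f + Sum ys f
Sum-++ [] ys f = sym (+-identityˡ _)
Sum-++ (x ∷ xs) ys f = trans (cong (f x +_) (Sum-++ xs ys f)) (sym (+-assoc (f x) _ _))

Sum-map : ∀ (h : 𝕏 → 𝕐) (xs : List 𝕏) (f : 𝕐 → ℚ) → Sum (List.map h xs) f ≡ Sum xs (f ∘ h)
Sum-map h [] f = refl
Sum-map h (x ∷ xs) f = cong (f (h x) +_) (Sum-map h xs f)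

Sum-concatMap : ∀ (h : 𝕏 → List 𝕐) (xs : List 𝕏) (f : 𝕐 → ℚ) → Sum (concatMap h xs) f ≡ Sum xs (λ x → Sum (h x) f)
Sum-concatMap h [] f = refl
Sum-concatMap h (x ∷ xs) f = trans (Sum-++ (h x) _ f) (cong (Sum (h x) f +_) (Sum-concatMap h xs f))

Sum-*-Sum : ∀ (xs : List 𝕏) (ys : List 𝕐) (f : 𝕏 → ℚ) (g : 𝕐 → ℚ) →
  Sum xs f * Sum ys g ≡ Sum xs (λ x → Sum ys (λ y → f x * g y))
Sum-*-Sum xs ys f g = trans (sym (Sum-*ʳ xs _ f)) (Sum-cong xs (λ x → sym (Sum-*ˡ ys (f x) g)))

∣Sum∣≤ : ∀ (xs : List 𝕏) (f : 𝕏 → ℚ) → ∥ Sum xs f ∥ ≤ Sum xs (λ x → ∥ f x ∥)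
∣Sum∣≤ [] f = ≤-reflexive ∣0∣
∣Sum∣≤ (x ∷ xs) f = ≤-trans (∣+∣≤ (f x) _) (+-monoʳ-≤ ∥ f x ∥ (∣Sum∣≤ xs f))

-- Lagrange's identity: twice the difference of the two sides is the weighted sum, over all pairs,
-- of the squares (u x v y - u y v x)².
cauchy-schwarz : ∀ (xs : List 𝕏) (w u v : 𝕏 → ℚ) → (∀ x → 0ℚ ≤ w x) →
  Sum xs (λ x → w x * (u x * v x)) * Sum xs (λ x → w x * (u x * v x)) ≤
  Sum xs (λ x → w x * (u x * u x)) * Sum xs (λ x → w x * (v x * v x))
cauchy-schwarz xs w u v 0≤w = *-cancelʳ 2ℚ 0<2 (≤-by E 0≤E eq)
  where
  S = Sum xs
  a = S (λ x → w x * (u x * v x))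
  b = S (λ x → w x * (u x * u x))
  c = S (λ x → w x * (v x * v x))
  E = S (λ x → S (λ y → w x * w y * ((u x * v y - u y * v x) * (u x * v y - u y * v x))))
  0≤E : 0ℚ ≤ E
  0≤E = 0≤Sum xs (λ x → 0≤Sum xs (λ y → 0≤* (0≤* (0≤w x) (0≤w y)) (0≤sq _)))
  step : ∀ x → S (λ y → w x * w y * ((u x * v y - u y * v x) * (u x * v y - u y * v x))) ≡
    w x * (u x * u x) * c + w x * (v x * v x) * b - w x * (u x * v x) * (2ℚ * a)
  step x = trans (Sum-cong xs (λ y → solve 6 (λ p q r s t z → p :* z :* ((q :* t :- s :* r) :* (q :* t :- s :* r)) :=
      p :* (q :* q) :* (z :* (t :* t)) :+ p :* (r :* r) :* (z :* (s :* s)) :- p :* (q :* r) :* (con 2ℚ :* (z :* (s :* t))))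
      refl (w x) (u x) (v x) (u y) (v y) (w y)))
    (trans (Sum-- xs _ _) (cong₂ _-_ (trans (Sum-+ xs _ _) (cong₂ _+_ (Sum-*ˡ xs _ _) (Sum-*ˡ xs _ _)))
      (trans (Sum-*ˡ xs _ _) (cong (w x * (u x * v x) *_) (Sum-*ˡ xs 2ℚ _)))))
  E≡ : E ≡ b * c + c * b - a * (2ℚ * a)
  E≡ = trans (Sum-cong xs step) (trans (Sum-- xs _ _) (cong₂ _-_
    (trans (Sum-+ xs _ _) (cong₂ _+_ (Sum-*ʳ xs c _) (Sum-*ʳ xs b _))) (Sum-*ʳ xs (2ℚ * a) _)))
  eq : a * a * 2ℚ + E ≡ b * c * 2ℚ
  eq = trans (cong (a * a * 2ℚ +_) E≡)
    (solve 3 (λ a b c → a :* a :* con 2ℚ :+ (b :* c :+ c :* b :- a :* (con 2ℚ :* a)) := b :* c :* con 2ℚ) refl a b c)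

cauchy-schwarz₁ : ∀ (xs : List 𝕏) (w u : 𝕏 → ℚ) → (∀ x → 0ℚ ≤ w x) →
  Sum xs (λ x → w x * u x) * Sum xs (λ x → w x * u x) ≤ Sum xs w * Sum xs (λ x → w x * (u x * u x))
cauchy-schwarz₁ xs w u 0≤w = subst₂ _≤_ (cong (λ z → z * z) (Sum-cong xs (λ x → cong (w x *_) (*-identityˡ _))))
  (cong (_* Sum xs (λ x → w x * (u x * u x))) (Sum-cong xs (λ x → trans (cong (w x *_) (*-identityˡ 1ℚ)) (*-identityʳ _))))
  (cauchy-schwarz xs w (λ _ → 1ℚ) u 0≤w)

cauchy-schwarz₂ : ∀ (xs : List 𝕏) (u v : 𝕏 → ℚ) →
  Sum xs (λ x → u x * v x) * Sum xs (λ x → u x * v x) ≤ Sum xs (λ x → u x * u x) * Sum xs (λ x → v x * v x)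
cauchy-schwarz₂ xs u v = subst₂ _≤_ (cong (λ z → z * z) (Sum-cong xs (λ x → *-identityˡ _)))
  (cong₂ _*_ (Sum-cong xs (λ x → *-identityˡ _)) (Sum-cong xs (λ x → *-identityˡ _)))
  (cauchy-schwarz xs (λ _ → 1ℚ) u v (λ _ → 0≤1))

-- Every squaring is one use of Cauchy-Schwarz, so only exponents that are powers of two are
-- reached. This is why the moment exponent p below is one.
jensen : ∀ (xs : List 𝕏) (w : 𝕏 → ℚ) → (∀ x → 0ℚ ≤ w x) → Sum xs w ≡ 1ℚ → ∀ s (u : 𝕏 → ℚ) →
  Sum xs (λ x → w x * u x) ^ (2 ℕ.^ s) ≤ Sum xs (λ x → w x * u x ^ (2 ℕ.^ s))
jensen xs w 0≤w Σw≡1 zero u = ≤-reflexive (trans (*-identityʳ _) (Sum-cong xs (λ x → cong (w x *_) (sym (*-identityʳ _)))))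
jensen xs w 0≤w Σw≡1 (suc s) u = ≤-respˡ (sym (^-* m 2 (2 ℕ.^ s)))
  (≤-respʳ (Sum-cong xs (λ x → cong (w x *_) (sym (^-* (u x) 2 (2 ℕ.^ s)))))
  (≤-trans (^-mono (2 ℕ.^ s) (≤-respʳ (cong (m *_) (sym (*-identityʳ m))) (0≤sq m)) sq)
    (jensen xs w 0≤w Σw≡1 s (λ x → u x ^ 2))))
  where
  m = Sum xs (λ x → w x * u x)
  sq : m ^ 2 ≤ Sum xs (λ x → w x * u x ^ 2)
  sq = subst₂ _≤_ (cong (m *_) (sym (*-identityʳ m)))
    (trans (cong (_* Sum xs (λ x → w x * (u x * u x))) Σw≡1) (trans (*-identityˡ _) (Sum-cong xs (λ x → cong (λ z → w x * (u x * z)) (sym (*-identityʳ (u x)))))))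
    (cauchy-schwarz₁ xs w u 0≤w)

-- Tuples

tuples : List 𝕏 → ∀ m → List (Vec 𝕏 m)
tuples xs zero = [] ∷ []
tuples xs (suc m) = concatMap (λ x → List.map (x ∷_) (tuples xs m)) xs

Sum-tuples : ∀ (xs : List 𝕏) m (f : Vec 𝕏 (suc m) → ℚ) →
  Sum (tuples xs (suc m)) f ≡ Sum xs (λ x → Sum (tuples xs m) (λ v → f (x ∷ v)))
Sum-tuples xs m f = trans (Sum-concatMap _ xs f) (Sum-cong xs (λ x → Sum-map (x ∷_) (tuples xs m) f))

pairs : List 𝕏 → List 𝕐 → List (𝕏 × 𝕐)
pairs xs ys = concatMap (λ x → List.map (x ,_) ys) xs

Sum-pairs : ∀ (xs : List 𝕏) (ys : List 𝕐) (f : 𝕏 × 𝕐 → ℚ) → Sum (pairs xs ys) f ≡ Sum xs (λ x → Sum ys (λ y → f (x , y)))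
Sum-pairs xs ys f = trans (Sum-concatMap _ xs f) (Sum-cong xs (λ x → Sum-map (x ,_) ys f))

prod : ∀ {m} → (𝕏 → ℚ) → Vec 𝕏 m → ℚ
prod h [] = 1ℚ
prod h (x ∷ v) = h x * prod h v

prod-* : ∀ {m} (f g : 𝕏 → ℚ) (v : Vec 𝕏 m) → prod (λ x → f x * g x) v ≡ prod f v * prod g v
prod-* f g [] = sym (*-identityˡ 1ℚ)
prod-* f g (x ∷ v) rewrite prod-* f g v = solve 4 (λ a b c d → a :* b :* (c :* d) := a :* c :* (b :* d)) refl (f x) (g x) (prod f v) (prod g v)

prod-1 : ∀ {m} (v : Vec 𝕏 m) → prod (λ _ → 1ℚ) v ≡ 1ℚ
prod-1 [] = refl
prod-1 (x ∷ v) = trans (*-identityˡ _) (prod-1 v)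

prod-cong : ∀ {m} {f g : 𝕏 → ℚ} → (∀ x → f x ≡ g x) → (v : Vec 𝕏 m) → prod f v ≡ prod g v
prod-cong p [] = refl
prod-cong p (x ∷ v) = cong₂ _*_ (p x) (prod-cong p v)

0≤prod : ∀ {m} {f : 𝕏 → ℚ} → (∀ x → 0ℚ ≤ f x) → (v : Vec 𝕏 m) → 0ℚ ≤ prod f v
0≤prod h [] = 0≤1
0≤prod h (x ∷ v) = 0≤* (h x) (0≤prod h v)

prod≤1 : ∀ {m} {f : 𝕏 → ℚ} → (∀ x → 0ℚ ≤ f x) → (∀ x → f x ≤ 1ℚ) → (v : Vec 𝕏 m) → prod f v ≤ 1ℚ
prod≤1 h k [] = ≤-refl
prod≤1 h k (x ∷ v) = ≤-respʳ (*-identityˡ 1ℚ) (*-mono (h x) 0≤1 (k x) (prod≤1 h k v))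

prod-mono : ∀ {m} {f g : 𝕏 → ℚ} → (∀ x → 0ℚ ≤ f x) → (∀ x → f x ≤ g x) → (v : Vec 𝕏 m) → prod f v ≤ prod g v
prod-mono h k [] = ≤-refl
prod-mono h k (x ∷ v) = *-mono (h x) (0≤prod (λ y → ≤-trans (h y) (k y)) v) (k x) (prod-mono h k v)

Sum-prod : ∀ (xs : List 𝕏) m (h : 𝕏 → ℚ) → Sum (tuples xs m) (prod h) ≡ Sum xs h ^ m
Sum-prod xs zero h = +-identityʳ 1ℚ
Sum-prod xs (suc m) h = trans (Sum-tuples xs m _) (trans (Sum-cong xs (λ x → Sum-*ˡ (tuples xs m) (h x) (prod h)))
  (trans (Sum-*ʳ xs _ h) (cong (Sum xs h *_) (Sum-prod xs m h))))

-- Indicators and enumerations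

ind : {P : Set} → Dec P → ℚ
ind (yes _) = 1ℚ
ind (no _) = 0ℚ

ind-cong : ∀ {P Q : Set} (d : Dec P) (e : Dec Q) → (P → Q) → (Q → P) → ind d ≡ ind e
ind-cong (yes _) (yes _) _ _ = refl
ind-cong (no _) (no _) _ _ = refl
ind-cong (yes p) (no q) f _ = ⊥-elim (q (f p))
ind-cong (no p) (yes q) _ g = ⊥-elim (p (g q))

0≤ind : ∀ {P : Set} (d : Dec P) → 0ℚ ≤ ind d
0≤ind (yes _) = 0≤1
0≤ind (no _) = ≤-refl

ind≤1 : ∀ {P : Set} (d : Dec P) → ind d ≤ 1ℚ
ind≤1 (yes _) = ≤-refl
ind≤1 (no _) = 0≤1

-- `Sum-δ` encodes that each element is listed exactly once, in a form that lets sums be reindexed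
-- without permuting lists.
record Enumeration (𝕏 : Set) : Set where
  field
    list : List 𝕏
    _≟_ : DecidableEquality 𝕏
    Sum-δ : ∀ f z → Sum list (λ y → ind (y ≟ z) * f y) ≡ f z

  Sum-δ₁ : ∀ z → Sum list (λ y → ind (y ≟ z)) ≡ 1ℚ
  Sum-δ₁ z = trans (Sum-cong list (λ y → sym (*-identityʳ _))) (Sum-δ (λ _ → 1ℚ) z)

  reindex : ∀ (σ σ⁻¹ : 𝕏 → 𝕏) → (∀ x → σ⁻¹ (σ x) ≡ x) → (∀ y → σ (σ⁻¹ y) ≡ y) →
    ∀ f → Sum list (λ x → f (σ x)) ≡ Sum list f
  reindex σ σ⁻¹ l r f = begin
    Sum list (λ x → f (σ x)) ≡⟨ Sum-cong list (λ x → sym (Sum-δ f (σ x))) ⟩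
    Sum list (λ x → Sum list (λ y → ind (y ≟ σ x) * f y)) ≡⟨ Sum-swap list list _ ⟩
    Sum list (λ y → Sum list (λ x → ind (y ≟ σ x) * f y)) ≡⟨ Sum-cong list (λ y → Sum-cong list (λ x → cong (_* f y)
      (ind-cong (y ≟ σ x) (x ≟ σ⁻¹ y) (λ { refl → sym (l x) }) (λ { refl → sym (r y) })))) ⟩
    Sum list (λ y → Sum list (λ x → ind (x ≟ σ⁻¹ y) * f y)) ≡⟨ Sum-cong list (λ y → Sum-δ (λ _ → f y) (σ⁻¹ y)) ⟩
    Sum list f ∎
    where open ≡-Reasoning

Sum-∉ : ∀ (_≟_ : DecidableEquality 𝕏) (xs : List 𝕏) (f : 𝕏 → ℚ) z → All (z ≢_) xs → Sum xs (λ y → ind (y ≟ z) * f y) ≡ 0ℚ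
Sum-∉ _≟_ [] f z _ = refl
Sum-∉ _≟_ (x ∷ xs) f z (p ∷ ps) with x ≟ z
... | yes q = ⊥-elim (p (sym q))
... | no _ = trans (cong₂ _+_ (zeroˡ (f x)) (Sum-∉ _≟_ xs f z ps)) (+-identityˡ 0ℚ)

Sum-∈ : ∀ (_≟_ : DecidableEquality 𝕏) (xs : List 𝕏) (f : 𝕏 → ℚ) z → Unique xs → z ∈ xs → Sum xs (λ y → ind (y ≟ z) * f y) ≡ f z
Sum-∈ _≟_ (x ∷ xs) f z (p ∷ u) z∈ with x ≟ z
... | yes refl = trans (cong₂ _+_ (*-identityˡ (f x)) (Sum-∉ _≟_ xs f x p)) (+-identityʳ _)
Sum-∈ _≟_ (x ∷ xs) f z (p ∷ u) (here z≡x) | no q = ⊥-elim (q (sym z≡x))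
Sum-∈ _≟_ (x ∷ xs) f z (p ∷ u) (there z∈) | no q =
  trans (cong₂ _+_ (zeroˡ (f x)) (Sum-∈ _≟_ xs f z u z∈)) (+-identityˡ _)

enumerate : ∀ (_≟_ : DecidableEquality 𝕏) (xs : List 𝕏) → Unique xs → (∀ x → x ∈ xs) → Enumeration 𝕏
enumerate _≟_ xs u c = record { list = xs ; _≟_ = _≟_ ; Sum-δ = λ f z → Sum-∈ _≟_ xs f z u (c z) }

tuplesEnum : Enumeration 𝕏 → ∀ m → Enumeration (Vec 𝕏 m)
tuplesEnum {𝕏} E m = record { list = tuples list m ; _≟_ = _≟V_ ; Sum-δ = δ m }
  where
  open Enumeration E
  _≟V_ : ∀ {m} → DecidableEquality (Vec 𝕏 m)
  _≟V_ = Vecₚ.≡-dec _≟_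
  ind-∷ : ∀ {m} x z (v w : Vec 𝕏 m) → ind ((x ∷ v) ≟V (z ∷ w)) ≡ ind (x ≟ z) * ind (v ≟V w)
  ind-∷ x z v w with x ≟ z | v ≟V w | (x ∷ v) ≟V (z ∷ w)
  ... | yes refl | yes refl | yes _ = sym (*-identityˡ 1ℚ)
  ... | yes refl | yes refl | no n = ⊥-elim (n refl)
  ... | yes _ | no n | yes refl = ⊥-elim (n refl)
  ... | yes _ | no _ | no _ = sym (*-identityˡ 0ℚ)
  ... | no n | _ | yes refl = ⊥-elim (n refl)
  ... | no _ | d | no _ = sym (zeroˡ (ind d))
  δ : ∀ m (f : Vec 𝕏 m → ℚ) z → Sum (tuples list m) (λ y → ind (y ≟V z) * f y) ≡ f z
  δ zero f [] = trans (+-identityʳ _) (*-identityˡ _)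
  δ (suc m) f (z ∷ w) = begin
    Sum (tuples list (suc m)) (λ y → ind (y ≟V (z ∷ w)) * f y)
      ≡⟨ Sum-tuples list m _ ⟩
    Sum list (λ x → Sum (tuples list m) (λ v → ind ((x ∷ v) ≟V (z ∷ w)) * f (x ∷ v)))
      ≡⟨ Sum-cong list (λ x → trans (Sum-cong (tuples list m) (λ v → trans (cong (_* f (x ∷ v)) (ind-∷ x z v w)) (*-assoc _ _ _)))
           (Sum-*ˡ (tuples list m) (ind (x ≟ z)) _)) ⟩
    Sum list (λ x → ind (x ≟ z) * Sum (tuples list m) (λ v → ind (v ≟V w) * f (x ∷ v)))
      ≡⟨ Sum-cong list (λ x → cong (ind (x ≟ z) *_) (δ m (λ v → f (x ∷ v)) w)) ⟩
    Sum list (λ x → ind (x ≟ z) * f (x ∷ w))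
      ≡⟨ Sum-δ (λ x → f (x ∷ w)) z ⟩
    f (z ∷ w) ∎
    where open ≡-Reasoning

ι-length-filter : ∀ {A : Set} (P : A → Bool) (xs : List A) →
  ι (length (filter (λ x → T? (P x)) xs)) ≡ Sum xs (λ x → if P x then 1ℚ else 0ℚ)
ι-length-filter P [] = ι0
ι-length-filter P (x ∷ xs) with P x
... | true = trans (ι-suc _) (cong (1ℚ +_) (ι-length-filter P xs))
... | false = trans (ι-length-filter P xs) (sym (+-identityˡ _))

-- Finite fields and coordinate vectors

module Field (𝔽 : FiniteField) where
  open FiniteField 𝔽 public
    renaming (Carrier to K; _+_ to infixl 6 _⊞_; _*_ to infixl 7 _⊠_; -_ to infix 8 ⊟_; isCommutativeRing to K-isCommutativeRing)

  ring : CommutativeRing _ _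
  ring = record { isCommutativeRing = K-isCommutativeRing }

  open SemiringSolver (CommutativeRing.commutativeSemiring ring) public using ()
    renaming (solve to solveK; con to conK; _:+_ to infixl 7 _:⊞_; _:*_ to infixl 8 _:⊠_; _:=_ to infix 4 _:≡_)
  open CommutativeRing ring using () renaming (+-identityʳ to ⊞-identityʳ; *-identityˡ to ⊠-identityˡ; zeroˡ to ⊠-zeroˡ; zeroʳ to ⊠-zeroʳ; *-comm to ⊠-comm) public
  open CommutativeRing ring using () renaming (+-assoc to ⊞-assoc)
  open AbelianGroupProperties (CommutativeRing.+-abelianGroup ring) using (\\-leftDividesˡ; \\-leftDividesʳ; //-rightDividesˡ; //-rightDividesʳ; ⁻¹-∙-comm; ⁻¹-anti-homo-//; xyx⁻¹≈y)

  EK : Enumeration K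
  EK = enumerate _≟F_ elements unique complete

  q̂ : ℚ
  q̂ = ι q

  Sum-K-1 : Sum elements (λ _ → 1ℚ) ≡ q̂
  Sum-K-1 = trans (Sum-const elements 1ℚ) (*-identityʳ _)

  -- The elements 0 and 1 are distinct, so their indicators add up to at most 1 everywhere.
  -- Strictness is what allows the factor q - 1 of `parseval` to be cancelled.
  1<q̂ : 1ℚ < q̂
  1<q̂ = <-≤-trans (<-by 1ℚ 0<1 refl) (subst₂ _≤_
    (trans (Sum-+ elements _ _) (cong₂ _+_ (Enumeration.Sum-δ₁ EK 0#) (Enumeration.Sum-δ₁ EK 1#))) Sum-K-1
    (Sum-mono elements bound))
    where
    bound : ∀ x → ind (x ≟F 0#) + ind (x ≟F 1#) ≤ 1ℚ
    bound x with x ≟F 0# | x ≟F 1#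
    ... | yes refl | yes p = ⊥-elim (0≢1 p)
    ... | yes _ | no _ = ≤-reflexive (+-identityʳ 1ℚ)
    ... | no _ | yes _ = ≤-reflexive (+-identityˡ 1ℚ)
    ... | no _ | no _ = ≤-respˡ (sym (+-identityˡ 0ℚ)) 0≤1

  0<q̂ : 0ℚ < q̂
  0<q̂ = <-trans 0<1 1<q̂

  Sum-K-shift : ∀ a (f : K → ℚ) → Sum elements (λ x → f (a ⊞ x)) ≡ Sum elements f
  Sum-K-shift a = Enumeration.reindex EK (a ⊞_) (⊟ a ⊞_)
    (\\-leftDividesʳ a)
    (\\-leftDividesˡ a)

  infixl 6 _⊞ᵥ_ _⊟ᵥ_
  _⊞ᵥ_ _⊟ᵥ_ : ∀ {m} → Vec K m → Vec K m → Vec K m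
  _⊞ᵥ_ = zipWith _⊞_
  _⊟ᵥ_ = zipWith (λ a b → a ⊞ (⊟ b))

  infixl 7 _·ᵥ_
  _·ᵥ_ : ∀ {m} → K → Vec K m → Vec K m
  c ·ᵥ x = Vec.map (c ⊠_) x

  0ᵥ : ∀ {m} → Vec K m
  0ᵥ = replicate _ 0#

  ⊞ᵥ-assoc : ∀ {m} (x y z : Vec K m) → x ⊞ᵥ y ⊞ᵥ z ≡ x ⊞ᵥ (y ⊞ᵥ z)
  ⊞ᵥ-assoc [] [] [] = refl
  ⊞ᵥ-assoc (x ∷ xs) (y ∷ ys) (z ∷ zs) = cong₂ _∷_ (solveK 3 (λ x y z → x :⊞ y :⊞ z :≡ x :⊞ (y :⊞ z)) refl x y z) (⊞ᵥ-assoc xs ys zs)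

  ⊞ᵥ-comm : ∀ {m} (x y : Vec K m) → x ⊞ᵥ y ≡ y ⊞ᵥ x
  ⊞ᵥ-comm [] [] = refl
  ⊞ᵥ-comm (x ∷ xs) (y ∷ ys) = cong₂ _∷_ (solveK 2 (λ x y → x :⊞ y :≡ y :⊞ x) refl x y) (⊞ᵥ-comm xs ys)

  ⊞ᵥ-identityˡ : ∀ {m} (x : Vec K m) → 0ᵥ ⊞ᵥ x ≡ x
  ⊞ᵥ-identityˡ [] = refl
  ⊞ᵥ-identityˡ (x ∷ xs) = cong₂ _∷_ (solveK 1 (λ x → conK 0 :⊞ x :≡ x) refl x) (⊞ᵥ-identityˡ xs)

  ⊞ᵥ-⊟ᵥ : ∀ {m} (x y : Vec K m) → x ⊞ᵥ y ⊟ᵥ y ≡ x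
  ⊞ᵥ-⊟ᵥ [] [] = refl
  ⊞ᵥ-⊟ᵥ (x ∷ xs) (y ∷ ys) = cong₂ _∷_ (//-rightDividesʳ y x) (⊞ᵥ-⊟ᵥ xs ys)

  ⊟ᵥ-⊞ᵥ : ∀ {m} (x y : Vec K m) → x ⊟ᵥ y ⊞ᵥ y ≡ x
  ⊟ᵥ-⊞ᵥ [] [] = refl
  ⊟ᵥ-⊞ᵥ (x ∷ xs) (y ∷ ys) = cong₂ _∷_ (//-rightDividesˡ y x) (⊟ᵥ-⊞ᵥ xs ys)

  ⊞ᵥ-⊟ᵥ-assoc : ∀ {m} (x y z : Vec K m) → x ⊞ᵥ y ⊟ᵥ z ≡ x ⊞ᵥ (y ⊟ᵥ z)
  ⊞ᵥ-⊟ᵥ-assoc [] [] [] = refl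
  ⊞ᵥ-⊟ᵥ-assoc (x ∷ xs) (y ∷ ys) (z ∷ zs) = cong₂ _∷_ (⊞-assoc x y (⊟ z)) (⊞ᵥ-⊟ᵥ-assoc xs ys zs)

  ⊟ᵥ-⊟ᵥ : ∀ {m} (x y z : Vec K m) → x ⊟ᵥ y ⊟ᵥ z ≡ x ⊟ᵥ (y ⊞ᵥ z)
  ⊟ᵥ-⊟ᵥ [] [] [] = refl
  ⊟ᵥ-⊟ᵥ (x ∷ xs) (y ∷ ys) (z ∷ zs) = cong₂ _∷_ (trans (⊞-assoc x _ _) (cong (x ⊞_) (⁻¹-∙-comm y z))) (⊟ᵥ-⊟ᵥ xs ys zs)

  ⊟ᵥ-involutive : ∀ {m} (a x : Vec K m) → a ⊟ᵥ (a ⊟ᵥ x) ≡ x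
  ⊟ᵥ-involutive [] [] = refl
  ⊟ᵥ-involutive (x ∷ xs) (y ∷ ys) = cong₂ _∷_ (trans (cong (x ⊞_) (⁻¹-anti-homo-// x y)) (trans (sym (⊞-assoc x y _)) (xyx⁻¹≈y x y))) (⊟ᵥ-involutive xs ys)

  dot : ∀ {m} → Vec K m → Vec K m → K
  dot [] [] = 0#
  dot (a ∷ ξ) (b ∷ x) = (a ⊠ b) ⊞ dot ξ x

  dot-⊞ : ∀ {m} (ξ x y : Vec K m) → dot ξ (x ⊞ᵥ y) ≡ dot ξ x ⊞ dot ξ y
  dot-⊞ [] [] [] = sym (⊞-identityʳ 0#)
  dot-⊞ (a ∷ ξ) (b ∷ x) (c ∷ y) rewrite dot-⊞ ξ x y =
    solveK 5 (λ a b c d e → a :⊠ (b :⊞ c) :⊞ (d :⊞ e) :≡ a :⊠ b :⊞ d :⊞ (a :⊠ c :⊞ e)) refl a b c (dot ξ x) (dot ξ y)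

  dot-· : ∀ {m} (ξ : Vec K m) c x → dot ξ (c ·ᵥ x) ≡ c ⊠ dot ξ x
  dot-· [] c [] = sym (⊠-zeroʳ c)
  dot-· (a ∷ ξ) c (b ∷ x) rewrite dot-· ξ c x =
    solveK 4 (λ a b c d → a :⊠ (c :⊠ b) :⊞ c :⊠ d :≡ c :⊠ (a :⊠ b :⊞ d)) refl a b c (dot ξ x)

  dot-comm : ∀ {m} (ξ x : Vec K m) → dot ξ x ≡ dot x ξ
  dot-comm [] [] = refl
  dot-comm (a ∷ ξ) (b ∷ x) = cong₂ _⊞_ (⊠-comm a b) (dot-comm ξ x)

  dot-0 : ∀ {m} (ξ : Vec K m) → dot ξ 0ᵥ ≡ 0#
  dot-0 [] = refl
  dot-0 (a ∷ ξ) rewrite dot-0 ξ = solveK 1 (λ a → a :⊠ conK 0 :⊞ conK 0 :≡ conK 0) refl a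

  ∃dot≡1 : ∀ {m} (x : Vec K m) → x ≢ 0ᵥ → ∃[ v ] dot x v ≡ 1#
  ∃dot≡1 [] x≢0 = ⊥-elim (x≢0 refl)
  ∃dot≡1 (b ∷ x) x≢0 with b ≟F 0#
  ... | no b≢0 = let c , bc≡1 = inverse b b≢0 in
    c ∷ 0ᵥ , trans (cong₂ _⊞_ bc≡1 (dot-0 x)) (⊞-identityʳ 1#)
  ... | yes refl = let v , xv≡1 = ∃dot≡1 x (λ x≡0 → x≢0 (cong (0# ∷_) x≡0)) in
    0# ∷ v , trans (cong ((0# ⊠ 0#) ⊞_) xv≡1) (solveK 0 (conK 0 :⊠ conK 0 :⊞ conK 1 :≡ conK 1) refl)

  normalise-dot : ∀ {m} (ξ v : Vec K m) → dot ξ v ≢ 0# → ∃[ c ] dot ξ (c ·ᵥ v) ≡ 1#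
  normalise-dot ξ v ξv≢0 = let c , eq = inverse (dot ξ v) ξv≢0 in c , trans (dot-· ξ c v) (trans (⊠-comm c _) eq)

  dot-shift : ∀ {m} (ξ v : Vec K m) → dot ξ v ≡ 1# → ∀ x c → dot ξ (x ⊞ᵥ c ·ᵥ v) ≡ dot ξ x ⊞ c
  dot-shift ξ v p x c = trans (dot-⊞ ξ x _) (cong (dot ξ x ⊞_) (trans (dot-· ξ c v) (trans (cong (c ⊠_) p) (trans (⊠-comm c 1#) (⊠-identityˡ c)))))

-- Sums over the vector space

module Space (𝔽 : FiniteField) (n : ℕ) where
  open Field 𝔽 public
  open FF 𝔽 n public using (G; elemsG; allVecs; Subset; card; Subspace; HasCodim; 1[_])

  allVecs≡tuples : ∀ m → allVecs m ≡ tuples elements m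
  allVecs≡tuples zero = refl
  allVecs≡tuples (suc m) = cong (λ l → List.concatMap (λ x → List.map (x ∷_) l) elements) (allVecs≡tuples m)

  EG : Enumeration G
  EG = record { list = elemsG ; _≟_ = Enumeration._≟_ E ; Sum-δ = λ f z →
      subst (λ l → Sum l (λ y → ind (Enumeration._≟_ E y z) * f y) ≡ f z) (sym (allVecs≡tuples n)) (Enumeration.Sum-δ E f z) }
    where E = tuplesEnum EK n

  open Enumeration EG public using () renaming (_≟_ to _≟G_; Sum-δ to ∑-δ; Sum-δ₁ to ∑-δ₁)

  ∑ : (G → ℚ) → ℚ
  ∑ = Sum elemsG

  ∑-cong : ∀ {f g : G → ℚ} → (∀ x → f x ≡ g x) → ∑ f ≡ ∑ g
  ∑-cong = Sum-cong elemsG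

  ∑-mono : ∀ {f g : G → ℚ} → (∀ x → f x ≤ g x) → ∑ f ≤ ∑ g
  ∑-mono = Sum-mono elemsG

  0≤∑ : ∀ {f : G → ℚ} → (∀ x → 0ℚ ≤ f x) → 0ℚ ≤ ∑ f
  0≤∑ = 0≤Sum elemsG

  ∑-+ : ∀ (f g : G → ℚ) → ∑ (λ x → f x + g x) ≡ ∑ f + ∑ g
  ∑-+ = Sum-+ elemsG

  ∑-- : ∀ (f g : G → ℚ) → ∑ (λ x → f x - g x) ≡ ∑ f - ∑ g
  ∑-- = Sum-- elemsG

  ∑-*ˡ : ∀ c (f : G → ℚ) → ∑ (λ x → c * f x) ≡ c * ∑ f
  ∑-*ˡ = Sum-*ˡ elemsG

  ∑-*ʳ : ∀ c (f : G → ℚ) → ∑ (λ x → f x * c) ≡ ∑ f * c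
  ∑-*ʳ = Sum-*ʳ elemsG

  ∑-swap : ∀ (f : G → G → ℚ) → ∑ (λ x → ∑ (f x)) ≡ ∑ (λ y → ∑ (λ x → f x y))
  ∑-swap = Sum-swap elemsG elemsG

  N : ℚ
  N = ι (length elemsG)

  ∑-1 : ∑ (λ _ → 1ℚ) ≡ N
  ∑-1 = trans (Sum-const elemsG 1ℚ) (*-identityʳ _)

  ∑-const : ∀ c → ∑ (λ _ → c) ≡ N * c
  ∑-const c = Sum-const elemsG c

  N≡q^n : N ≡ q̂ ^ n
  N≡q^n = trans (sym ∑-1) (trans (cong (λ l → Sum l (λ _ → 1ℚ)) (allVecs≡tuples n))
    (trans (Sum-cong (tuples elements n) (λ v → sym (prod-1 v))) (trans (Sum-prod elements n (λ _ → 1ℚ)) (cong (_^ n) Sum-K-1))))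

  0<N : 0ℚ < N
  0<N = subst (0ℚ <_) (sym N≡q^n) (0<^ n 0<q̂)

  0≤N : 0ℚ ≤ N
  0≤N = <⇒≤ 0<N

  ∑-shiftʳ : ∀ a (f : G → ℚ) → ∑ (λ x → f (x ⊞ᵥ a)) ≡ ∑ f
  ∑-shiftʳ a = Enumeration.reindex EG (_⊞ᵥ a) (_⊟ᵥ a) (λ x → ⊞ᵥ-⊟ᵥ x a) (λ x → ⊟ᵥ-⊞ᵥ x a)

  ∑-shiftˡ : ∀ a (f : G → ℚ) → ∑ (λ x → f (a ⊞ᵥ x)) ≡ ∑ f
  ∑-shiftˡ a f = trans (∑-cong (λ x → cong f (⊞ᵥ-comm a x))) (∑-shiftʳ a f)

  ∑-unshift : ∀ a (f : G → ℚ) → ∑ (λ x → f (x ⊟ᵥ a)) ≡ ∑ f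
  ∑-unshift a = Enumeration.reindex EG (_⊟ᵥ a) (_⊞ᵥ a) (λ x → ⊟ᵥ-⊞ᵥ x a) (λ x → ⊞ᵥ-⊟ᵥ x a)

  ∑-reflect : ∀ a (f : G → ℚ) → ∑ (λ x → f (a ⊟ᵥ x)) ≡ ∑ f
  ∑-reflect a = Enumeration.reindex EG (a ⊟ᵥ_) (a ⊟ᵥ_) (⊟ᵥ-involutive a) (⊟ᵥ-involutive a)

  ι-card : ∀ A → ι (card A) ≡ ∑ 1[ A ]
  ι-card A = ι-length-filter A elemsG

  -- Averaging over the line 𝔽v decouples ℓ from every v-invariant factor.
  decouple : ∀ (ℓ : G → K) v → (∀ x c → ℓ (x ⊞ᵥ c ·ᵥ v) ≡ ℓ x ⊞ c) →
    ∀ (Φ : G → ℚ) → (∀ x c → Φ (x ⊞ᵥ c ·ᵥ v) ≡ Φ x) → ∀ (φ : K → ℚ) →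
    q̂ * ∑ (λ x → Φ x * φ (ℓ x)) ≡ ∑ Φ * Sum elements φ
  decouple ℓ v ℓ-shift Φ Φ-inv φ = begin
    q̂ * ∑ (λ x → Φ x * φ (ℓ x)) ≡⟨ sym (Sum-const elements _) ⟩
    Sum elements (λ c → ∑ (λ x → Φ x * φ (ℓ x))) ≡⟨ Sum-cong elements (λ c → sym (∑-shiftʳ (c ·ᵥ v) _)) ⟩
    Sum elements (λ c → ∑ (λ x → Φ (x ⊞ᵥ c ·ᵥ v) * φ (ℓ (x ⊞ᵥ c ·ᵥ v)))) ≡⟨ Sum-swap elements elemsG _ ⟩
    ∑ (λ x → Sum elements (λ c → Φ (x ⊞ᵥ c ·ᵥ v) * φ (ℓ (x ⊞ᵥ c ·ᵥ v)))) ≡⟨ ∑-cong (λ x → trans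
      (Sum-cong elements (λ c → cong₂ (λ a b → a * φ b) (Φ-inv x c) (ℓ-shift x c))) (Sum-*ˡ elements (Φ x) _)) ⟩
    ∑ (λ x → Φ x * Sum elements (λ c → φ (ℓ x ⊞ c))) ≡⟨ ∑-cong (λ x → cong (Φ x *_) (Sum-K-shift (ℓ x) φ)) ⟩
    ∑ (λ x → Φ x * Sum elements φ) ≡⟨ ∑-*ʳ _ Φ ⟩
    ∑ Φ * Sum elements φ ∎
    where open ≡-Reasoning

-- Gram kernels and autocorrelations

module Gram (𝔽 : FiniteField) (n : ℕ) where
  open Space 𝔽 n

  ∑∑-difference : ∀ (h : G → ℚ) → ∑ (λ s → ∑ (λ t → h (t ⊟ᵥ s))) ≡ N * ∑ h
  ∑∑-difference h = trans (∑-cong (λ s → ∑-unshift s h)) (∑-const (∑ h))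

  tensor : ∀ {I : Set} {p} → (I → G → ℚ) → Vec I p → G → ℚ
  tensor α v s = prod (λ i → α i s) v

  -- Expanding the power over p-tuples makes each term a function of s times a function of t, so the
  -- double sum factorises. For γ = α it becomes a sum of squares.
  ∑∑-gram : ∀ {I : Set} (is : List I) (α γ : I → G → ℚ) p →
    ∑ (λ s → ∑ (λ t → Sum is (λ i → α i s * γ i t) ^ p)) ≡
    Sum (tuples is p) (λ v → ∑ (tensor α v) * ∑ (tensor γ v))
  ∑∑-gram is α γ p = begin
    ∑ (λ s → ∑ (λ t → Sum is (λ i → α i s * γ i t) ^ p))
      ≡⟨ ∑-cong (λ s → ∑-cong (λ t → trans (sym (Sum-prod is p _)) (Sum-cong (tuples is p) (prod-* _ _)))) ⟩
    ∑ (λ s → ∑ (λ t → Sum (tuples is p) (λ v → tensor α v s * tensor γ v t)))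
      ≡⟨ ∑-cong (λ s → Sum-swap elemsG (tuples is p) _) ⟩
    ∑ (λ s → Sum (tuples is p) (λ v → ∑ (λ t → tensor α v s * tensor γ v t)))
      ≡⟨ Sum-swap elemsG (tuples is p) _ ⟩
    Sum (tuples is p) (λ v → ∑ (λ s → ∑ (λ t → tensor α v s * tensor γ v t)))
      ≡⟨ Sum-cong (tuples is p) (λ v → sym (Sum-*-Sum elemsG elemsG (tensor α v) (tensor γ v))) ⟩
    Sum (tuples is p) (λ v → ∑ (tensor α v) * ∑ (tensor γ v)) ∎
    where open ≡-Reasoning

  0≤∑∑-gram : ∀ {I : Set} (is : List I) (α : I → G → ℚ) p →
    0ℚ ≤ ∑ (λ s → ∑ (λ t → Sum is (λ i → α i s * α i t) ^ p))
  0≤∑∑-gram is α p = ≤-respʳ (sym (∑∑-gram is α α p)) (0≤Sum (tuples is p) (λ v → 0≤sq _))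

  -- Termwise 2ab ≤ a² + b² over the tuples; the hypothesis turns the half that belongs to γ back
  -- into the half that belongs to α.
  ∑∑-gram-majorant : ∀ {I : Set} (is : List I) (α γ : I → G → ℚ) p →
    (∀ s t → Sum is (λ i → γ i s * γ i t) ≡ Sum is (λ i → α i s * α i t)) →
    ∑ (λ s → ∑ (λ t → Sum is (λ i → α i s * γ i t) ^ p)) ≤
    ∑ (λ s → ∑ (λ t → Sum is (λ i → α i s * α i t) ^ p))
  ∑∑-gram-majorant is α γ p γγ≡αα = *-cancelʳ 2ℚ 0<2 (≤-respʳ eq (≤-respˡ (trans (Sum-*ʳ V 2ℚ _) (cong (_* 2ℚ) (sym (∑∑-gram is α γ p))))
      (Sum-mono V (λ v → ab≤ (∑ (tensor α v)) (∑ (tensor γ v))))))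
    where
    V = tuples is p
    P = ∑ (λ s → ∑ (λ t → Sum is (λ i → α i s * α i t) ^ p))
    ab≤ : ∀ a b → a * b * 2ℚ ≤ a * a + b * b
    ab≤ a b = ≤-by ((a - b) * (a - b)) (0≤sq _) (solve 2 (λ a b → a :* b :* con 2ℚ :+ (a :- b) :* (a :- b) := a :* a :+ b :* b) refl a b)
    eq : Sum V (λ v → ∑ (tensor α v) * ∑ (tensor α v) + ∑ (tensor γ v) * ∑ (tensor γ v)) ≡ P * 2ℚ
    eq = trans (Sum-+ V _ _) (trans (cong₂ _+_ (sym (∑∑-gram is α α p))
        (trans (sym (∑∑-gram is γ γ p)) (∑-cong (λ s → ∑-cong (λ t → cong (_^ p) (γγ≡αα s t))))))
      (solve 1 (λ x → x :+ x := x :* con 2ℚ) refl P))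

  shift-cancel : ∀ (y s t : G) → y ⊞ᵥ s ⊞ᵥ (t ⊟ᵥ s) ≡ y ⊞ᵥ t
  shift-cancel y s t = trans (⊞ᵥ-assoc y s _) (cong (y ⊞ᵥ_) (trans (⊞ᵥ-comm s _) (⊟ᵥ-⊞ᵥ t s)))

  ⊟ᵥ-exchange : ∀ (t s g : G) → t ⊟ᵥ s ⊟ᵥ g ≡ t ⊟ᵥ g ⊟ᵥ s
  ⊟ᵥ-exchange t s g = trans (⊟ᵥ-⊟ᵥ t s g) (trans (cong (t ⊟ᵥ_) (⊞ᵥ-comm s g)) (sym (⊟ᵥ-⊟ᵥ t g s)))

  ⊟ᵥ-cancel : ∀ (t s g : G) → t ⊟ᵥ g ⊟ᵥ (s ⊟ᵥ g) ≡ t ⊟ᵥ s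
  ⊟ᵥ-cancel t s g = trans (⊟ᵥ-⊟ᵥ t g _) (cong (t ⊟ᵥ_) (trans (⊞ᵥ-comm g _) (⊟ᵥ-⊞ᵥ s g)))

  corr : (G → ℚ) → G → ℚ
  corr b z = ∑ (λ y → b y * b (y ⊞ᵥ z))

  corr-shift : ∀ b s t → ∑ (λ y → b (y ⊞ᵥ s) * b (y ⊞ᵥ t)) ≡ corr b (t ⊟ᵥ s)
  corr-shift b s t = trans (∑-cong (λ y → cong (λ z → b (y ⊞ᵥ s) * b z) (sym (shift-cancel y s t))))
    (∑-shiftʳ s (λ y → b y * b (y ⊞ᵥ (t ⊟ᵥ s))))

  module Family (b : G → G → ℚ) where
    -- These are F and F′ up to the factor N, for real functions `b g` in place of indicators.
    -- Translating the second factor by g translates its correlation by g, hence the argument x - g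
    -- in `twisted`.
    twisted straight : G → ℚ
    twisted x = ∑ (λ g → corr (b g) (x ⊟ᵥ g))
    straight x = ∑ (λ g → corr (b g) x)

    I : List (G × G)
    I = pairs elemsG elemsG

    -- Translating both arguments by g cancels in a difference, so both families have the Gram
    -- kernel of `straight`, while their mixed kernel is that of `twisted`. This is the situation of
    -- `∑∑-gram-majorant`.
    α γ : G × G → G → ℚ
    α (g , y) s = b g (y ⊞ᵥ s)
    γ (g , y) s = b g (y ⊞ᵥ (s ⊟ᵥ g))

    gram-αα : ∀ s t → Sum I (λ i → α i s * α i t) ≡ straight (t ⊟ᵥ s)
    gram-αα s t = trans (Sum-pairs elemsG elemsG _) (∑-cong (λ g → corr-shift (b g) s t))

    gram-αγ : ∀ s t → Sum I (λ i → α i s * γ i t) ≡ twisted (t ⊟ᵥ s)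
    gram-αγ s t = trans (Sum-pairs elemsG elemsG _) (∑-cong (λ g → trans (corr-shift (b g) s (t ⊟ᵥ g))
      (cong (corr (b g)) (⊟ᵥ-exchange t g s))))

    gram-γγ : ∀ s t → Sum I (λ i → γ i s * γ i t) ≡ straight (t ⊟ᵥ s)
    gram-γγ s t = trans (Sum-pairs elemsG elemsG _) (∑-cong (λ g → trans (corr-shift (b g) (s ⊟ᵥ g) (t ⊟ᵥ g))
      (cong (corr (b g)) (⊟ᵥ-cancel t s g))))

    ∑∑-straight : ∀ p → ∑ (λ s → ∑ (λ t → Sum I (λ i → α i s * α i t) ^ p)) ≡ N * ∑ (λ x → straight x ^ p)
    ∑∑-straight p = trans (∑-cong (λ s → ∑-cong (λ t → cong (_^ p) (gram-αα s t)))) (∑∑-difference _)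

    0≤∑-straight^ : ∀ p → 0ℚ ≤ ∑ (λ x → straight x ^ p)
    0≤∑-straight^ p = *-cancelʳ N 0<N (subst₂ _≤_ (sym (zeroˡ N)) (trans (∑∑-straight p) (*-comm N _)) (0≤∑∑-gram I α p))

    ∑-twisted^≤∑-straight^ : ∀ p → ∑ (λ x → twisted x ^ p) ≤ ∑ (λ x → straight x ^ p)
    ∑-twisted^≤∑-straight^ p = *-cancelʳ N 0<N (subst₂ _≤_
      (trans (∑-cong (λ s → ∑-cong (λ t → cong (_^ p) (gram-αγ s t)))) (trans (∑∑-difference _) (*-comm N _)))
      (trans (∑∑-straight p) (*-comm N _))
      (∑∑-gram-majorant I α γ p (λ s t → trans (gram-γγ s t) (sym (gram-αα s t)))))

    mass : G → ℚ
    mass g = ∑ (b g)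

    ∑-corr : ∀ g → ∑ (corr (b g)) ≡ mass g * mass g
    ∑-corr g = trans (∑-swap _) (trans (∑-cong (λ y → trans (∑-*ˡ (b g y) _) (cong (b g y *_) (∑-shiftˡ y (b g)))))
      (∑-*ʳ (mass g) (b g)))

    energy : ℚ
    energy = ∑ (λ g → mass g * mass g)

    ∑-straight : ∑ straight ≡ energy
    ∑-straight = trans (∑-swap _) (∑-cong ∑-corr)

    ∑-twisted : ∑ twisted ≡ energy
    ∑-twisted = trans (∑-swap _) (∑-cong (λ g → trans (∑-unshift g (corr (b g))) (∑-corr g)))

  module Centred (a : G → G → ℚ) where
    open Family a public

    -- Removing the mean of every `a g` lowers `straight` and `twisted` by the same constant energy
    -- / N, which is the mean of both. The centred functions therefore come from a family again, and
    -- the moment comparison applies to them.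
    b : G → G → ℚ
    b g y = a g y - mass g * inv N

    module B = Family b

    N*m : ∀ g → N * (mass g * inv N) ≡ mass g
    N*m g = trans (*-comm N _) (inv-cancelʳ (mass g) 0<N)

    corr-b : ∀ g z → corr (b g) z ≡ corr (a g) z - mass g * mass g * inv N
    corr-b g z = begin
      ∑ (λ y → (a g y - m) * (a g (y ⊞ᵥ z) - m))
        ≡⟨ ∑-cong (λ y → solve 3 (λ x x' m → (x :- m) :* (x' :- m) := x :* x' :- m :* x :- (m :* x' :- m :* m)) refl (a g y) (a g (y ⊞ᵥ z)) m) ⟩
      ∑ (λ y → a g y * a g (y ⊞ᵥ z) - m * a g y - (m * a g (y ⊞ᵥ z) - m * m))
        ≡⟨ trans (∑-- _ _) (cong₂ _-_ (trans (∑-- _ _) (cong (λ e → corr (a g) z - e) (∑-*ˡ m _)))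
             (trans (∑-- _ _) (cong₂ _-_ (trans (∑-*ˡ m _) (cong (m *_) (∑-shiftʳ z (a g)))) (∑-const (m * m))))) ⟩
      corr (a g) z - m * mass g - (m * mass g - N * (m * m))
        ≡⟨ cong (λ e → corr (a g) z - m * mass g - (m * mass g - e)) (trans (sym (*-assoc N m m)) (trans (cong (_* m) (N*m g)) (*-comm _ m))) ⟩
      corr (a g) z - m * mass g - (m * mass g - m * mass g)
        ≡⟨ solve 3 (λ c d i → c :- d :* i :* d :- (d :* i :* d :- d :* i :* d) := c :- d :* d :* i) refl (corr (a g) z) (mass g) (inv N) ⟩
      corr (a g) z - mass g * mass g * inv N ∎
      where
      open ≡-Reasoning
      m = mass g * inv N

    straight-b : ∀ x → B.straight x ≡ straight x - energy * inv N
    straight-b x = trans (∑-cong (λ g → corr-b g x)) (trans (∑-- _ _) (cong (λ e → straight x - e) (∑-*ʳ (inv N) _)))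

    twisted-b : ∀ x → B.twisted x ≡ twisted x - energy * inv N
    twisted-b x = trans (∑-cong (λ g → corr-b g (x ⊟ᵥ g))) (trans (∑-- _ _) (cong (λ e → twisted x - e) (∑-*ʳ (inv N) _)))

    0≤moment : ∀ p → 0ℚ ≤ ∑ (λ x → (straight x - energy * inv N) ^ p)
    0≤moment p = ≤-respʳ (∑-cong (λ x → cong (_^ p) (straight-b x))) (B.0≤∑-straight^ p)

    moment-majorant : ∀ p → ∑ (λ x → (twisted x - energy * inv N) ^ p) ≤ ∑ (λ x → (straight x - energy * inv N) ^ p)
    moment-majorant p = subst₂ _≤_ (∑-cong (λ x → cong (_^ p) (twisted-b x))) (∑-cong (λ x → cong (_^ p) (straight-b x)))
      (B.∑-twisted^≤∑-straight^ p)

8ℚ 9ℚ : ℚ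
8ℚ = ℤ.+ 8 ℚ./ 1
9ℚ = ℤ.+ 9 ℚ./ 1

1/24 : ℚ
1/24 = ℤ.+ 1 ℚ./ 24

0≤8 : 0ℚ ≤ 8ℚ
0≤8 = nonNegative⁻¹ 8ℚ

-- Sifting

-- With x = ε/24 the hypothesis gives m x ≤ 3/8, so 1 - m x ≥ 1/2, and `bernoulli` with exponent -m
-- yields (1 + x)^m (1 - m x) ≤ 1.
[1+x]^m≤2 : ∀ ε m → 0ℚ ≤ ε → ι m * ε ≤ 9ℚ → (1ℚ + ε * 1/24) ^ m ≤ 2ℚ
[1+x]^m≤2 ε m 0≤ε mε≤9 = *-cancelʳ (ℤ.+ 1 ℚ./ 2) (positive⁻¹ _) (≤-trans
  (*-monoˡ ((1ℚ + ε * 1/24) ^ m) (0≤^ m 0≤1+x)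
    (≤-by ((9ℚ - ι m * ε) * 1/24 + ℤ.+ 1 ℚ./ 8) (0≤+ (0≤* (0≤b-a mε≤9) 0≤1/24) (nonNegative⁻¹ _))
      (trans (solve 2 (λ m e → con (ℤ.+ 1 ℚ./ 2) :+ ((con 9ℚ :- m :* e) :* con 1/24 :+ con (ℤ.+ 1 ℚ./ 8)) := con 1ℚ :+ (con 0ℚ :- m) :* (e :* con 1/24)) refl (ι m) ε)
        (cong (λ o → 1ℚ + (o - ι m) * (ε * 1/24)) (sym ι0)))))
  (≤-respʳ (solve 0 (con 1ℚ := con 2ℚ :* con (ℤ.+ 1 ℚ./ 2)) refl) (bernoulli (ε * 1/24) (0≤* 0≤ε 0≤1/24) 0 m)))
  where
  0≤1/24 : 0ℚ ≤ 1/24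
  0≤1/24 = nonNegative⁻¹ 1/24
  0≤1+x : 0ℚ ≤ 1ℚ + ε * 1/24
  0≤1+x = 0≤+ 0≤1 (0≤* 0≤ε 0≤1/24)

module Sifting (𝔽 : FiniteField) (n : ℕ) where
  open Space 𝔽 n
  open Gram 𝔽 n

  -- When every moment of u is nonnegative, u behaves like a nonnegative function under averaging.
  module Moments (u : G → ℚ) (0≤moments : ∀ j → 0ℚ ≤ ∑ (λ x → u x ^ j)) where
    M : ℕ → ℕ → ℚ
    M j l = ∑ (λ x → u x ^ j * (1ℚ + u x) ^ l)

    M-suc : ∀ j l → M j (suc l) ≡ M j l + M (suc j) l
    M-suc j l = trans (∑-cong (λ x → solve 3 (λ u p q → p :* ((con 1ℚ :+ u) :* q) := p :* q :+ u :* p :* q) refl (u x) (u x ^ j) ((1ℚ + u x) ^ l)))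
      (∑-+ _ _)

    0≤M : ∀ j l → 0ℚ ≤ M j l
    0≤M j zero = ≤-respʳ (∑-cong (λ x → sym (*-identityʳ _))) (0≤moments j)
    0≤M j (suc l) = ≤-respʳ (sym (M-suc j l)) (0≤+ (0≤M j l) (0≤M (suc j) l))

    M-mono : ∀ j m l → M j l ≤ M j (m ℕ.+ l)
    M-mono j zero l = ≤-refl
    M-mono j (suc m) l = ≤-trans (M-mono j m l) (≤-by (M (suc j) (m ℕ.+ l)) (0≤M (suc j) (m ℕ.+ l)) (sym (M-suc j (m ℕ.+ l))))

    -- The counterpart of the pointwise bound m u ≤ (1 + u)^m: along `M-suc` each of the m added
    -- factors 1 + u contributes at least `M (suc j) l`.
    M-step : ∀ m j l → ι m * M (suc j) l ≤ M j (m ℕ.+ l)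
    M-step zero j l = ≤-respˡ (sym (trans (cong (_* M (suc j) l) ι0) (zeroˡ _))) (0≤M j l)
    M-step (suc m) j l = subst₂ _≤_
      (trans (solve 2 (λ m x → m :* x :+ x := (con 1ℚ :+ m) :* x) refl (ι m) (M (suc j) l)) (cong (_* M (suc j) l) (sym (ι-suc m))))
      (sym (M-suc j (m ℕ.+ l)))
      (+-mono (M-step m j l) (M-mono (suc j) m l))

    M-steps : ∀ m k j → ι m ^ k * M (k ℕ.+ j) 0 ≤ M j (k ℕ.* m)
    M-steps m zero j = ≤-reflexive (*-identityˡ _)
    M-steps m (suc k) j = ≤-trans (≤-respˡ (trans (cong (λ i → ι m * (ι m ^ k * M i 0)) (ℕₚ.+-suc k j)) (sym (*-assoc (ι m) _ _)))
      (*-monoˡ (ι m) (0≤ι m) (M-steps m k (suc j)))) (M-step m j (k ℕ.* m))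

    -- Turns a large central moment into a large moment of 1 + u. Applied with 1 + u = ψ, its terms
    -- are nonnegative, so that points with small ψ can be discarded.
    moment-boost : ∀ m p → ι m ^ p * ∑ (λ x → u x ^ p) ≤ ∑ (λ x → (1ℚ + u x) ^ (p ℕ.* m))
    moment-boost m p = subst₂ _≤_ (cong (ι m ^ p *_) (∑-cong (λ x → trans (*-identityʳ _) (cong (u x ^_) (ℕₚ.+-identityʳ p)))))
      (∑-cong (λ x → *-identityˡ _)) (M-steps m p 0)

  module Density (a : G → G → ℚ) (0≤a : ∀ g x → 0ℚ ≤ a g x) (a≤1 : ∀ g x → a g x ≤ 1ℚ)
    (d : ℕ) (0<total : 0ℚ < ∑ (λ g → ∑ (a g))) (dense : N * N ≤ 2ℚ ^ d * ∑ (λ g → ∑ (a g))) where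

    open Centred a

    σ : ℚ
    σ = ∑ mass

    0≤σ : 0ℚ ≤ σ
    0≤σ = <⇒≤ 0<total

    0≤mass : ∀ g → 0ℚ ≤ mass g
    0≤mass g = 0≤∑ (0≤a g)

    mass≤N : ∀ g → mass g ≤ N
    mass≤N g = ≤-respʳ ∑-1 (∑-mono (a≤1 g))

    σ²≤N*energy : σ * σ ≤ N * energy
    σ²≤N*energy = subst₂ _≤_ (cong (λ z → z * z) (∑-cong (λ g → *-identityˡ _)))
      (cong₂ _*_ ∑-1 (∑-cong (λ g → *-identityˡ _)))
      (cauchy-schwarz₁ elemsG (λ _ → 1ℚ) mass (λ _ → 0≤1))

    e : ℚ
    e = energy * inv N

    e*N : e * N ≡ energy
    e*N = inv-cancelʳ energy 0<N

    σ≤2^d*e : σ ≤ 2ℚ ^ d * e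
    σ≤2^d*e = *-cancelʳ (N * N) (0<* 0<N 0<N) (≤-trans (*-monoˡ σ 0≤σ dense)
      (≤-respˡ (solve 2 (λ s t → t :* (s :* s) := s :* (t :* s)) refl σ (2ℚ ^ d))
      (≤-respʳ (trans (cong (λ z → 2ℚ ^ d * (N * z)) (sym e*N)) (solve 3 (λ t n e → t :* (n :* (e :* n)) := t :* e :* (n :* n)) refl (2ℚ ^ d) N e))
        (*-monoˡ (2ℚ ^ d) (0≤^ d 0≤2) σ²≤N*energy))))

    0<e : 0ℚ < e
    0<e with 0ℚ <? e
    ... | yes p = p
    ... | no q = ⊥-elim (<-irrefl refl (<-≤-trans 0<total (≤-trans σ≤2^d*e
      (≤-respʳ (zeroʳ _) (*-monoˡ (2ℚ ^ d) (0≤^ d 0≤2) (≮⇒≥ q))))))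

    κ : ℚ
    κ = inv e

    κ*e : κ * e ≡ 1ℚ
    κ*e = trans (*-comm κ e) (inv-* 0<e)

    0≤κ : 0ℚ ≤ κ
    0≤κ = 0≤inv 0<e

    -- As e is the mean of both `straight` and `twisted`, `ψ` is μ_F′ and `ψ̃` is μ_F; `u` and `ũ`
    -- are their deviations from 1.
    ψ ψ̃ u ũ : G → ℚ
    ψ x = straight x * κ
    ψ̃ x = twisted x * κ
    u x = ψ x - 1ℚ
    ũ x = ψ̃ x - 1ℚ

    ∑-scaled : ∀ (f : G → ℚ) p → ∑ (λ x → (f x * κ - 1ℚ) ^ p) ≡ κ ^ p * ∑ (λ x → (f x - e) ^ p)
    ∑-scaled f p = trans (∑-cong (λ x → trans (cong (_^ p) (trans (cong (λ z → f x * κ - z) (sym κ*e))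
        (solve 3 (λ f k e → f :* k :- k :* e := k :* (f :- e)) refl (f x) κ e))) (^-distrib κ _ p))) (∑-*ˡ (κ ^ p) _)

    0≤∑u^ : ∀ p → 0ℚ ≤ ∑ (λ x → u x ^ p)
    0≤∑u^ p = ≤-respʳ (sym (∑-scaled straight p)) (0≤* (0≤^ p 0≤κ) (0≤moment p))

    ∑ũ^≤∑u^ : ∀ p → ∑ (λ x → ũ x ^ p) ≤ ∑ (λ x → u x ^ p)
    ∑ũ^≤∑u^ p = subst₂ _≤_ (sym (∑-scaled twisted p)) (sym (∑-scaled straight p)) (*-monoˡ (κ ^ p) (0≤^ p 0≤κ) (moment-majorant p))

    0≤ψ : ∀ x → 0ℚ ≤ ψ x
    0≤ψ x = 0≤* (0≤∑ (λ g → 0≤∑ (λ y → 0≤* (0≤a g y) (0≤a g _)))) 0≤κ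

    0≤^2^ : ∀ s x → 0ℚ ≤ x ^ (2 ℕ.^ suc s)
    0≤^2^ s x = ≤-respʳ (sym (^-* x 2 (2 ℕ.^ s))) (0≤^ (2 ℕ.^ s) (≤-respʳ (cong (x *_) (sym (*-identityʳ x))) (0≤sq x)))

    -- The numbers `mass x * inv σ` are probability weights, so Jensen bounds ε^p by a weighted p-th
    -- moment of `ũ`. No weight exceeds N/σ ≤ 2^d/N, so passing to the uniform mean costs 2^d, and
    -- `∑ũ^≤∑u^` goes over from F to F′.
    high-moment : ∀ ε → 0ℚ ≤ ε → ε < ∥ ∑ (λ x → mass x * inv σ * ũ x) ∥ → ∀ s → let p = 2 ℕ.^ suc s in
      ε ^ p * N ≤ 2ℚ ^ d * ∑ (λ x → u x ^ p)
    high-moment ε 0≤ε ε<X s = ≤-trans (*-monoʳ N 0≤N ε^p≤) (≤-trans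
        (≤-respˡ (solve 3 (λ n i u → n :* i :* n :* u := n :* i :* u :* n) refl N (inv σ) U)
          (*-monoʳ U (0≤∑ (λ x → 0≤^2^ s (ũ x))) N²/σ≤2^d))
        (*-monoˡ (2ℚ ^ d) (0≤^ d 0≤2) (∑ũ^≤∑u^ p)))
      where
      p = 2 ℕ.^ suc s
      w : G → ℚ
      w x = mass x * inv σ
      0≤invσ : 0ℚ ≤ inv σ
      0≤invσ = 0≤inv 0<total
      X = ∑ (λ x → w x * ũ x)
      U = ∑ (λ x → ũ x ^ p)
      ∑w : ∑ w ≡ 1ℚ
      ∑w = trans (∑-*ʳ (inv σ) mass) (inv-* 0<total)
      ε²≤ : ε ^ 2 ≤ X ^ 2
      ε²≤ = ≤-respʳ (trans (cong (∥ X ∥ *_) (*-identityʳ _)) (trans (sym (∣*∣ X X)) (trans (0≤⇒∣∣ (0≤sq X)) (cong (X *_) (sym (*-identityʳ X))))))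
        (^-mono 2 0≤ε (<⇒≤ ε<X))
      ε^p≤ : ε ^ p ≤ N * inv σ * U
      ε^p≤ = ≤-trans (subst₂ _≤_ (sym (^-* ε 2 (2 ℕ.^ s))) (sym (^-* X 2 (2 ℕ.^ s))) (^-mono (2 ℕ.^ s) (0≤^ 2 0≤ε) ε²≤))
        (≤-trans (jensen elemsG w (λ x → 0≤* (0≤mass x) 0≤invσ) ∑w (suc s) ũ)
          (≤-respʳ (∑-*ˡ (N * inv σ) _) (∑-mono (λ x → *-monoʳ (ũ x ^ p) (0≤^2^ s (ũ x)) (*-monoʳ (inv σ) 0≤invσ (mass≤N x))))))
      N²/σ≤2^d : N * inv σ * N ≤ 2ℚ ^ d
      N²/σ≤2^d = *-cancelʳ σ 0<total (≤-respˡ (trans (sym (inv-cancelʳ (N * N) 0<total)) (cong (_* σ) (solve 2 (λ n i → n :* n :* i := n :* i :* n) refl N (inv σ)))) dense)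

    module Threshold (ε : ℚ) (0<ε : 0ℚ < ε) (m : ℕ) (8≤mε : 8ℚ ≤ ι m * ε) (mε≤9 : ι m * ε ≤ 9ℚ)
      (η : ℚ) (0<η : 0ℚ < η)
      (s : ℕ) (d≤p : d ℕ.≤ 2 ℕ.^ suc s) (2≤2^pη : 2ℚ ≤ η * 2ℚ ^ (2 ℕ.^ suc s))
      (ε<X : ε < ∥ ∑ (λ x → mass x * inv σ * ũ x) ∥) where

      p r : ℕ
      p = 2 ℕ.^ suc s
      r = p ℕ.* m

      θ : ℚ
      θ = 1ℚ + ε * 1/24

      0≤ε : 0ℚ ≤ ε
      0≤ε = <⇒≤ 0<ε

      0≤η : 0ℚ ≤ η
      0≤η = <⇒≤ 0<η

      0≤θ : 0ℚ ≤ θ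
      0≤θ = 0≤+ 0≤1 (0≤* 0≤ε (nonNegative⁻¹ 1/24))

      1+u≡ψ : ∀ x → 1ℚ + u x ≡ ψ x
      1+u≡ψ x = solve 1 (λ y → con 1ℚ :+ (y :- con 1ℚ) := y) refl (ψ x)

      R : ℚ
      R = ∑ (λ x → ψ x ^ r)

      -- Here (m ε)^p ≥ 8^p pays for the loss 2^d ≤ 2^p and leaves 4^p. That is the reason for the
      -- lower bound 8 on m ε.
      4^p*N≤R : 4ℚ ^ p * N ≤ R
      4^p*N≤R = *-cancelʳ (2ℚ ^ p) (0<^ p 0<2) (begin
        4ℚ ^ p * N * 2ℚ ^ p ≡⟨ trans (solve 3 (λ a n b → a :* n :* b := a :* b :* n) refl (4ℚ ^ p) N (2ℚ ^ p))
                                            (cong (_* N) (trans (sym (^-distrib 4ℚ 2ℚ p)) (cong (_^ p) (solve 0 (con 4ℚ :* con 2ℚ := con 8ℚ) refl)))) ⟩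
        8ℚ ^ p * N ≤⟨ *-monoʳ N 0≤N (^-mono p 0≤8 8≤mε) ⟩
        (ι m * ε) ^ p * N ≡⟨ trans (cong (_* N) (^-distrib (ι m) ε p)) (*-assoc _ _ _) ⟩
        ι m ^ p * (ε ^ p * N) ≤⟨ *-monoˡ (ι m ^ p) (0≤^ p (0≤ι m)) (high-moment ε 0≤ε ε<X s) ⟩
        ι m ^ p * (2ℚ ^ d * ∑ (λ x → u x ^ p)) ≡⟨ solve 3 (λ a b c → a :* (b :* c) := a :* c :* b) refl (ι m ^ p) (2ℚ ^ d) _ ⟩
        ι m ^ p * ∑ (λ x → u x ^ p) * 2ℚ ^ d ≤⟨ *-mono (0≤* (0≤^ p (0≤ι m)) (0≤∑u^ p)) (0≤^ p 0≤2)
                                            (Moments.moment-boost u 0≤∑u^ m p) (^-monoʳ 1≤2 d≤p) ⟩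
        ∑ (λ x → (1ℚ + u x) ^ r) * 2ℚ ^ p ≡⟨ cong (_* 2ℚ ^ p) (∑-cong (λ x → cong (_^ r) (1+u≡ψ x))) ⟩
        R * 2ℚ ^ p ∎)
        where open ℚₚ.≤-Reasoning

      χ χ̄ : G → ℚ
      χ x = ind (θ ≤? ψ x)
      χ̄ x = 1ℚ - χ x

      low≤ : ∀ x → ψ x ^ r * χ̄ x ≤ 2ℚ ^ p
      low≤ x with θ ≤? ψ x
      ... | yes _ = ≤-respˡ (sym (trans (cong (ψ x ^ r *_) (+-inverseʳ 1ℚ)) (zeroʳ _))) (0≤^ p 0≤2)
      ... | no q = ≤-respˡ (solve 1 (λ y → y := y :* (con 1ℚ :- con 0ℚ)) refl (ψ x ^ r)) (≤-trans (^-mono r (0≤ψ x) (<⇒≤ (≰⇒> q)))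
        (≤-respˡ (trans (sym (^-* θ m p)) (cong (θ ^_) (ℕₚ.*-comm m p))) (^-mono p (0≤^ m 0≤θ) ([1+x]^m≤2 ε m 0≤ε mε≤9))))

      Rlow : ℚ
      Rlow = ∑ (λ x → ψ x ^ r * χ̄ x)

      -- A point below the threshold contributes at most (θ^m)^p ≤ 2^p, while the average
      -- contribution to R is at least 4^p. The ratio 2^p exceeds 2/η by hypothesis.
      2Rlow≤ηR : Rlow * 2ℚ ≤ η * R
      2Rlow≤ηR = *-cancelʳ (2ℚ ^ p) (0<^ p 0<2) (begin
        Rlow * 2ℚ * 2ℚ ^ p ≤⟨ *-monoʳ (2ℚ ^ p) (0≤^ p 0≤2) (*-monoʳ 2ℚ 0≤2 (≤-respʳ (∑-const _) (∑-mono low≤))) ⟩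
        N * 2ℚ ^ p * 2ℚ * 2ℚ ^ p ≡⟨ trans (solve 2 (λ n t → n :* t :* con 2ℚ :* t := con 2ℚ :* (t :* t :* n)) refl N (2ℚ ^ p))
                                  (cong (λ z → 2ℚ * (z * N)) (trans (sym (^-distrib 2ℚ 2ℚ p)) (cong (_^ p) (solve 0 (con 2ℚ :* con 2ℚ := con 4ℚ) refl)))) ⟩
        2ℚ * (4ℚ ^ p * N) ≤⟨ *-mono 0≤2 0≤R 2≤2^pη 4^p*N≤R ⟩
        η * 2ℚ ^ p * R ≡⟨ solve 3 (λ a b c → a :* b :* c := a :* c :* b) refl η (2ℚ ^ p) R ⟩
        η * R * 2ℚ ^ p ∎)
        where
        open ℚₚ.≤-Reasoning
        0≤R : 0ℚ ≤ R
        0≤R = 0≤∑ (λ x → 0≤^ r (0≤ψ x))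

      straight≡ψe : ∀ x → straight x ≡ e * ψ x
      straight≡ψe x = trans (sym (inv-cancelʳ (straight x) 0<e)) (*-comm _ e)

      V : List (Vec (G × G) r)
      V = tuples I r

      -- For indicators, `tensor α v` is the indicator of the intersection of the translates A_g - y
      -- over the entries (g, y) of v, and β v is its size. These intersections are the candidates
      -- for the set B.
      β : Vec (G × G) r → ℚ
      β v = ∑ (tensor α v)

      low-pairs : Vec (G × G) r → ℚ
      low-pairs v = ∑ (λ s → ∑ (λ t → tensor α v s * tensor α v t * χ̄ (t ⊟ᵥ s)))

      Sum-pairs-weighted : ∀ (h : G → ℚ) →
        Sum V (λ v → ∑ (λ s → ∑ (λ t → tensor α v s * tensor α v t * h (t ⊟ᵥ s)))) ≡ N * (e ^ r * ∑ (λ x → ψ x ^ r * h x))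
      Sum-pairs-weighted h = begin
        Sum V (λ v → ∑ (λ s → ∑ (λ t → tensor α v s * tensor α v t * h (t ⊟ᵥ s))))
          ≡⟨ trans (Sum-swap V elemsG _) (∑-cong (λ s → Sum-swap V elemsG _)) ⟩
        ∑ (λ s → ∑ (λ t → Sum V (λ v → tensor α v s * tensor α v t * h (t ⊟ᵥ s))))
          ≡⟨ ∑-cong (λ s → ∑-cong (λ t → trans (Sum-*ʳ V _ _) (cong (_* h (t ⊟ᵥ s))
               (trans (Sum-cong V (λ v → sym (prod-* _ _ v))) (trans (Sum-prod I r _) (trans (cong (_^ r) (trans (gram-αα s t) (straight≡ψe _))) (^-distrib e _ r))))))) ⟩
        ∑ (λ s → ∑ (λ t → e ^ r * ψ (t ⊟ᵥ s) ^ r * h (t ⊟ᵥ s)))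
          ≡⟨ ∑∑-difference (λ x → e ^ r * ψ x ^ r * h x) ⟩
        N * ∑ (λ x → e ^ r * ψ x ^ r * h x)
          ≡⟨ cong (N *_) (trans (∑-cong (λ x → *-assoc _ _ _)) (∑-*ˡ (e ^ r) _)) ⟩
        N * (e ^ r * ∑ (λ x → ψ x ^ r * h x)) ∎
        where open ≡-Reasoning

      Sum-β² : Sum V (λ v → β v * β v) ≡ N * (e ^ r * R)
      Sum-β² = trans (Sum-cong V (λ v → trans (Sum-*-Sum elemsG elemsG _ _) (∑-cong (λ s → ∑-cong (λ t → sym (*-identityʳ _))))))
        (trans (Sum-pairs-weighted (λ _ → 1ℚ)) (cong (λ z → N * (e ^ r * z)) (∑-cong (λ x → *-identityʳ _))))

      Sum-β : Sum V β ≡ N * σ ^ r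
      Sum-β = trans (Sum-swap V elemsG _) (trans (∑-cong (λ s → trans (Sum-prod I r _) (cong (_^ r)
        (trans (Sum-pairs elemsG elemsG _) (∑-cong (λ g → ∑-shiftʳ s (a g))))))) (∑-const _))

      τ : ℚ
      τ = inv (2ℚ ^ (d ℕ.* r))

      0<2^dr : 0ℚ < 2ℚ ^ (d ℕ.* r)
      0<2^dr = 0<^ (d ℕ.* r) 0<2

      0<τ : 0ℚ < τ
      0<τ = 0<inv 0<2^dr

      -- One positive value serves both demands on a candidate: η β² exceeds `low-pairs`, so few
      -- differences are low, and it exceeds η τ N β, so β > τ N and the candidate is large.
      gain : Vec (G × G) r → ℚ
      gain v = η * (β v * β v) - low-pairs v - η * τ * N * β v

      -- e ≥ 2^{-d} σ turns the r-th moment into 4^p times the trivial bound.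
      4Nτσ^r≤e^rR : 4ℚ * (N * (τ * σ ^ r)) ≤ e ^ r * R
      4Nτσ^r≤e^rR = begin
        4ℚ * (N * (τ * σ ^ r)) ≡⟨ solve 4 (λ f n t s → f :* (n :* (t :* s)) := s :* t :* (f :* n)) refl 4ℚ N τ (σ ^ r) ⟩
        σ ^ r * τ * (4ℚ * N) ≤⟨ *-mono (0≤* (0≤^ r 0≤σ) (<⇒≤ 0<τ)) (0≤∑ (λ x → 0≤^ r (0≤ψ x)))
                                       σ^rτ≤e^r (≤-trans (*-monoʳ N 0≤N 4≤4^p) 4^p*N≤R) ⟩
        e ^ r * R ∎
        where
        open ℚₚ.≤-Reasoning
        σ^rτ≤e^r : σ ^ r * τ ≤ e ^ r
        σ^rτ≤e^r = *-cancelʳ (2ℚ ^ (d ℕ.* r)) 0<2^dr (≤-respˡ (sym (inv-cancelʳ (σ ^ r) 0<2^dr))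
          (≤-respʳ (trans (^-distrib (2ℚ ^ d) e r) (trans (*-comm _ _) (cong (e ^ r *_) (sym (^-* 2ℚ d r))))) (^-mono r 0≤σ σ≤2^d*e)))
        4≤4^p : 4ℚ ≤ 4ℚ ^ p
        4≤4^p = ≤-respˡ (*-identityʳ 4ℚ) (^-monoʳ {m = 1} (≤-by (ℤ.+ 3 ℚ./ 1) (nonNegative⁻¹ _) (solve 0 (con 1ℚ :+ con (ℤ.+ 3 ℚ./ 1) := con 4ℚ) refl)) (ℕₚ.m^n>0 2 (suc s)))

      -- Half of the main term η N e^r R pays for the low pairs. The other half is at least twice
      -- the size penalty, by the factor 4 in `4Nτσ^r≤e^rR`, so a strictly positive remainder is
      -- left.
      0<Sum-gain : 0ℚ < Sum V gain
      0<Sum-gain = <-by-eq (trans (trans (Sum-- V _ _) (cong₂ _-_ (trans (Sum-- V _ _) (cong₂ _-_ (trans (Sum-*ˡ V η _) (cong (η *_) Sum-β²)) (Sum-pairs-weighted χ̄)))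
          (trans (Sum-*ˡ V (η * τ * N) β) (cong (η * τ * N *_) Sum-β))))
          (solve 6 (λ n x y h t z → h :* (n :* x) :- n :* y :- h :* t :* n :* (n :* z) :=
             con ½ :* (n :* (h :* x :- y :* con 2ℚ)) :+ con ½ :* (h :* n :* (x :- con 4ℚ :* (n :* (t :* z)))) :+ h :* n :* n :* (t :* z))
            refl N X Y η τ (σ ^ r)))
        (≤-<-trans (0≤+ {a = A₁} {b = A₂} (0≤* 0≤½ (0≤* 0≤N (0≤b-a 2Y≤ηX))) (0≤* 0≤½ (0≤* (0≤* 0≤η 0≤N) (0≤b-a 4Nτσ^r≤e^rR))))
          (<-by {a = A₁ + A₂} (η * N * N * (τ * σ ^ r)) (0<* (0<* (0<* 0<η 0<N) 0<N) (0<* 0<τ (0<^ r 0<total))) refl))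
        where
        ½ = ℤ.+ 1 ℚ./ 2
        X = e ^ r * R
        Y = e ^ r * Rlow
        A₁ = ½ * (N * (η * X - Y * 2ℚ))
        A₂ = ½ * (η * N * (X - 4ℚ * (N * (τ * σ ^ r))))
        0≤½ : 0ℚ ≤ ½
        0≤½ = nonNegative⁻¹ _
        2Y≤ηX : Y * 2ℚ ≤ η * X
        2Y≤ηX = subst₂ _≤_ (sym (*-assoc _ _ _)) (solve 3 (λ w h y → w :* (h :* y) := h :* (w :* y)) refl (e ^ r) η R)
          (*-monoˡ (e ^ r) (0≤^ r (<⇒≤ 0<e)) 2Rlow≤ηR)
        <-by-eq : ∀ {x y} → x ≡ y → 0ℚ < y → 0ℚ < x
        <-by-eq refl q = q

      sifted : ∃[ f ] ((∀ x → 0ℚ ≤ f x) × (∀ x → f x ≤ 1ℚ) × N ≤ 2ℚ ^ (d ℕ.* r) * ∑ f ×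
        (1ℚ - η) * (∑ f * ∑ f) ≤ ∑ (λ s → ∑ (λ t → f s * f t * χ (t ⊟ᵥ s))))
      sifted = f , 0≤f , (λ x → prod≤1 (λ i → 0≤a _ _) (λ i → a≤1 _ _) v) , large , correlated
        where
        v = proj₁ (Sum-pos V gain 0<Sum-gain)
        0<gain : 0ℚ < gain v
        0<gain = proj₂ (Sum-pos V gain 0<Sum-gain)
        f = tensor α v
        0≤f : ∀ x → 0ℚ ≤ f x
        0≤f x = 0≤prod (λ i → 0≤a _ _) v
        0≤β : 0ℚ ≤ β v
        0≤β = 0≤∑ 0≤f
        0≤χ̄ : ∀ x → 0ℚ ≤ χ̄ x
        0≤χ̄ x = 0≤b-a (ind≤1 (θ ≤? ψ x))
        0≤low : 0ℚ ≤ low-pairs v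
        0≤low = 0≤∑ (λ s → 0≤∑ (λ t → 0≤* (0≤* (0≤f s) (0≤f t)) (0≤χ̄ _)))
        large : N ≤ 2ℚ ^ (d ℕ.* r) * β v
        large = ≮⇒≥ (λ q → <-irrefl refl (<-≤-trans 0<gain (≤-by (low-pairs v + η * β v * (τ * N - β v))
            (0≤+ 0≤low (0≤* (0≤* 0≤η 0≤β) (0≤b-a (β≤τN (<⇒≤ q)))))
            (solve 5 (λ h b l t n → h :* (b :* b) :- l :- h :* t :* n :* b :+ (l :+ h :* b :* (t :* n :- b)) := con 0ℚ) refl η (β v) (low-pairs v) τ N))))
          where
          β≤τN : 2ℚ ^ (d ℕ.* r) * β v ≤ N → β v ≤ τ * N
          β≤τN q = *-cancelʳ (2ℚ ^ (d ℕ.* r)) 0<2^dr (subst₂ _≤_ (*-comm _ _)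
            (trans (sym (inv-cancelʳ N 0<2^dr)) (cong (_* 2ℚ ^ (d ℕ.* r)) (*-comm N τ))) q)
        correlated : (1ℚ - η) * (β v * β v) ≤ ∑ (λ s → ∑ (λ t → f s * f t * χ (t ⊟ᵥ s)))
        correlated = ≤-by (gain v + η * τ * N * β v) (0≤+ (<⇒≤ 0<gain) (0≤* (0≤* (0≤* 0≤η (<⇒≤ 0<τ)) 0≤N) 0≤β))
          (trans (solve 4 (λ h B l y → (con 1ℚ :- h) :* B :+ (h :* B :- l :- y :+ y) := B :- l) refl η (β v * β v) (low-pairs v) (η * τ * N * β v))
            (trans (cong (_- low-pairs v) (Sum-*-Sum elemsG elemsG f f)) (trans (sym (∑-- _ _)) (∑-cong (λ s → trans (sym (∑-- _ _))
              (∑-cong (λ t → solve 2 (λ x y → x :- x :* (con 1ℚ :- y) := x :* y) refl (f s * f t) (χ (t ⊟ᵥ s)))))))))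

16ℚ : ℚ
16ℚ = ℤ.+ 16 ℚ./ 1

0<16 : 0ℚ < 16ℚ
0<16 = positive⁻¹ 16ℚ

total : ∀ {m} → (𝕏 → ℚ) → Vec 𝕏 m → ℚ
total h [] = 0ℚ
total h (x ∷ v) = h x + total h v

-- Croot–Sisask sampling

-- Variances of independent samples add: in the square of X x + total X v the cross term carries the
-- mean of X, which is 0.
second-moment : ∀ (xs : List 𝕏) (w X : 𝕏 → ℚ) → (∀ x → 0ℚ ≤ w x) →
  Sum xs (λ x → w x * X x) ≡ 0ℚ → Sum xs (λ x → w x * (X x * X x)) ≤ Sum xs w →
  ∀ m → Sum (tuples xs m) (λ v → prod w v * (total X v * total X v)) ≤ ι m * Sum xs w ^ m
second-moment xs w X 0≤w mean variance zero = ≤-reflexive (trans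
  (solve 0 (con 1ℚ :* (con 0ℚ :* con 0ℚ) :+ con 0ℚ := con 0ℚ) refl) (sym (trans (cong (_* 1ℚ) ι0) (*-identityʳ 0ℚ))))
second-moment xs w X 0≤w mean variance (suc m) = begin
  Sum (tuples xs (suc m)) (λ v → prod w v * (total X v * total X v))
    ≡⟨ Sum-tuples xs m _ ⟩
  Sum xs (λ x → Sum V (λ v → w x * prod w v * ((X x + total X v) * (X x + total X v))))
    ≡⟨ Sum-cong xs (λ x → trans (Sum-cong V (λ v → solve 4 (λ w p x s → w :* p :* ((x :+ s) :* (x :+ s)) :=
         w :* (x :* x) :* p :+ w :* x :* (con 2ℚ :* (p :* s)) :+ w :* (p :* (s :* s))) refl (w x) (prod w v) (X x) (total X v)))
         (trans (Sum-+ V _ _) (cong₂ _+_ (trans (Sum-+ V _ _) (cong₂ _+_ (Sum-*ˡ V _ _) (Sum-*ˡ V _ _))) (Sum-*ˡ V _ _)))) ⟩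
  Sum xs (λ x → w x * (X x * X x) * Sum V (prod w) + w x * X x * Sum V (λ v → 2ℚ * (prod w v * total X v)) + w x * Q)
    ≡⟨ trans (Sum-+ xs _ _) (cong₂ _+_ (trans (Sum-+ xs _ _) (cong₂ _+_ (Sum-*ʳ xs _ _) (trans (Sum-*ʳ xs _ _) (cong (_* L) mean)))) (Sum-*ʳ xs Q w)) ⟩
  Sum xs (λ x → w x * (X x * X x)) * Sum V (prod w) + 0ℚ * L + b * Q
    ≤⟨ +-mono (+-monoˡ-≤ (0ℚ * L) (subst₂ _≤_ (cong (Sum xs (λ x → w x * (X x * X x)) *_) (sym (Sum-prod xs m w))) refl (*-monoʳ (b ^ m) (0≤^ m 0≤b) variance)))
         (*-monoˡ b 0≤b (second-moment xs w X 0≤w mean variance m)) ⟩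
  b * b ^ m + 0ℚ * L + b * (ι m * b ^ m)
    ≡⟨ trans (solve 4 (λ b p l m → b :* p :+ con 0ℚ :* l :+ b :* (m :* p) := (con 1ℚ :+ m) :* (b :* p)) refl b (b ^ m) L (ι m)) (cong (_* (b * b ^ m)) (sym (ι-suc m))) ⟩
  ι (suc m) * b ^ suc m ∎
  where
  open ℚₚ.≤-Reasoning
  V = tuples xs m
  b = Sum xs w
  0≤b : 0ℚ ≤ b
  0≤b = 0≤Sum xs 0≤w
  Q = Sum V (λ v → prod w v * (total X v * total X v))
  L = Sum V (λ v → 2ℚ * (prod w v * total X v))

sq-cancel : ∀ {a c} → 0ℚ ≤ c → a * a ≤ c * c → a ≤ c
sq-cancel {a} {c} 0≤c a²≤c² = ≮⇒≥ (λ c<a → <-irrefl refl (<-≤-trans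
  (≤-<-trans (*-monoˡ c 0≤c (<⇒≤ c<a)) (*-mono-<ʳ a (≤-<-trans 0≤c c<a) c<a)) a²≤c²))

total-map : ∀ {B : Set} {m} (h : B → ℚ) (f : 𝕏 → B) (v : Vec 𝕏 m) → total h (Vec.map f v) ≡ total (λ x → h (f x)) v
total-map h f [] = refl
total-map h f (x ∷ v) = cong (h (f x) +_) (total-map h f v)

total-cong : ∀ {m} {h k : 𝕏 → ℚ} → (∀ x → h x ≡ k x) → (v : Vec 𝕏 m) → total h v ≡ total k v
total-cong p [] = refl
total-cong p (x ∷ v) = cong₂ _+_ (p x) (total-cong p v)

total-minus : ∀ {m} (h : 𝕏 → ℚ) c (v : Vec 𝕏 m) → total (λ x → h x - c) v ≡ total h v - ι m * c
total-minus h c [] = trans (solve 1 (λ c → con 0ℚ := con 0ℚ :- con 0ℚ :* c) refl c) (cong (λ z → 0ℚ - z * c) (sym ι0))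
total-minus {m = suc m} h c (x ∷ v) = trans (cong (h x - c +_) (total-minus h c v))
  (trans (solve 4 (λ h c t m → h :- c :+ (t :- m :* c) := h :+ t :- (con 1ℚ :+ m) :* c) refl (h x) c (total h v) (ι m))
    (cong (λ z → h x + total h v - z * c) (sym (ι-suc m))))

prod-map : ∀ {B : Set} {m} (h : B → ℚ) (f : 𝕏 → B) (v : Vec 𝕏 m) → prod h (Vec.map f v) ≡ prod (λ x → h (f x)) v
prod-map h f [] = refl
prod-map h f (x ∷ v) = cong (h (f x) *_) (prod-map h f v)

map-enum-shift : ∀ (E : Enumeration 𝕏) (σ σ⁻¹ : 𝕏 → 𝕏) → (∀ x → σ⁻¹ (σ x) ≡ x) → (∀ x → σ (σ⁻¹ x) ≡ x) →
  ∀ m (f : Vec 𝕏 m → ℚ) → Sum (tuples (Enumeration.list E) m) (λ v → f (Vec.map σ v)) ≡ Sum (tuples (Enumeration.list E) m) f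
map-enum-shift E σ σ⁻¹ l r m = Enumeration.reindex (tuplesEnum E m) (Vec.map σ) (Vec.map σ⁻¹) (inverse l) (inverse r)
  where
  inverse : ∀ {σ σ⁻¹} → (∀ x → σ⁻¹ (σ x) ≡ x) → ∀ {m} (v : Vec _ m) → Vec.map σ⁻¹ (Vec.map σ v) ≡ v
  inverse l [] = refl
  inverse l (x ∷ v) = cong₂ _∷_ (l x) (inverse l v)

module Sampling (𝔽 : FiniteField) (n : ℕ) where
  open Space 𝔽 n

  module Estimates (w χ : G → ℚ) (0≤w : ∀ x → 0ℚ ≤ w x) (w≤1 : ∀ x → w x ≤ 1ℚ)
    (0≤χ : ∀ x → 0ℚ ≤ χ x) (χ≤1 : ∀ x → χ x ≤ 1ℚ) (0<b : 0ℚ < ∑ w)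
    (ζ : ℚ) (0<ζ : 0ℚ < ζ) (m : ℕ) (16≤mζ² : 16ℚ ≤ ι m * (ζ * ζ)) where

    b : ℚ
    b = ∑ w

    -- The probability that t - x lies in χ when t is drawn from w. A single tuple of samples from w
    -- estimates it at all x simultaneously.
    g : G → ℚ
    g x = inv b * ∑ (λ t → w t * χ (t ⊟ᵥ x))

    b*g : ∀ x → b * g x ≡ ∑ (λ t → w t * χ (t ⊟ᵥ x))
    b*g x = trans (sym (*-assoc b _ _)) (trans (cong (_* S) (inv-* 0<b)) (*-identityˡ S))
      where S = ∑ (λ t → w t * χ (t ⊟ᵥ x))

    0≤g : ∀ x → 0ℚ ≤ g x
    0≤g x = 0≤* (0≤inv 0<b) (0≤∑ (λ t → 0≤* (0≤w t) (0≤χ _)))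

    g≤1 : ∀ x → g x ≤ 1ℚ
    g≤1 x = *-cancelʳ b 0<b (subst₂ _≤_ (sym (trans (*-comm (g x) b) (b*g x))) (sym (*-identityˡ b))
      (∑-mono (λ t → ≤-respʳ (*-identityʳ (w t)) (*-monoˡ (w t) (0≤w t) (χ≤1 _)))))

    X : G → G → ℚ
    X x t = χ (t ⊟ᵥ x) - g x

    X-mean : ∀ x → ∑ (λ t → w t * X x t) ≡ 0ℚ
    X-mean x = trans (∑-cong (λ t → solve 3 (λ w c g → w :* (c :- g) := w :* c :- w :* g) refl (w t) (χ (t ⊟ᵥ x)) (g x)))
      (trans (∑-- _ _) (trans (cong₂ _-_ (sym (b*g x)) (∑-*ʳ (g x) w)) (+-inverseʳ (b * g x))))

    X²≤1 : ∀ x t → X x t * X x t ≤ 1ℚ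
    X²≤1 x t = ≤-by ((1ℚ - χ (t ⊟ᵥ x) + g x) * (1ℚ - g x + χ (t ⊟ᵥ x)))
      (0≤* (0≤+ (0≤b-a (χ≤1 _)) (0≤g x)) (0≤+ (0≤b-a (g≤1 x)) (0≤χ _)))
      (solve 2 (λ c g → (c :- g) :* (c :- g) :+ (con 1ℚ :- c :+ g) :* (con 1ℚ :- g :+ c) := con 1ℚ) refl (χ (t ⊟ᵥ x)) (g x))

    S : ∀ {k} → G → Vec G k → ℚ
    S x = total (X x)

    0<ι-m : 0ℚ < ι m
    0<ι-m = ≰⇒> (λ m≤0 → <-irrefl refl (<-≤-trans 0<16 (≤-trans 16≤mζ² (≤-respʳ (zeroˡ _) (*-monoʳ (ζ * ζ) (0≤sq ζ) m≤0)))))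

    μ : ℚ
    μ = ι m * ζ

    0<μ : 0ℚ < μ
    0<μ = 0<* 0<ι-m 0<ζ

    0<μ² : 0ℚ < μ * μ
    0<μ² = 0<* 0<μ 0<μ

    C : ℚ
    C = 16ℚ * inv (μ * μ)

    Cμ² : C * (μ * μ) ≡ 16ℚ
    Cμ² = inv-cancelʳ 16ℚ 0<μ²

    0≤C : 0ℚ ≤ C
    0≤C = 0≤* (<⇒≤ 0<16) (0≤inv 0<μ²)

    Cm≤1 : C * ι m ≤ 1ℚ
    Cm≤1 = *-cancelʳ (μ * μ) 0<μ² (≤-respˡ (trans (cong (_* ι m) (sym Cμ²)) (solve 3 (λ c u m → c :* u :* m := c :* m :* u) refl C (μ * μ) (ι m)))
      (≤-respʳ (solve 2 (λ m z → m :* (z :* z) :* m := con 1ℚ :* (m :* z :* (m :* z))) refl (ι m) ζ) (*-monoʳ (ι m) (0≤ι m) 16≤mζ²)))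

    -- Z x has mean at most 2, but is at least 16 on groups of samples that misjudge g x by ζ or more;
    -- so the product of Z over r groups, divided by 4^r, replaces a median of the groups.
    Z : G → Vec G m → ℚ
    Z x γ = 1ℚ + C * (S x γ * S x γ)

    1≤Z : ∀ x γ → 1ℚ ≤ Z x γ
    1≤Z x γ = ≤-by (C * (S x γ * S x γ)) (0≤* 0≤C (0≤sq _)) refl

    0≤Z : ∀ x γ → 0ℚ ≤ Z x γ
    0≤Z x γ = ≤-trans 0≤1 (1≤Z x γ)

    Sum-Z : ∀ x → Sum (tuples elemsG m) (λ γ → prod w γ * Z x γ) ≤ 2ℚ * b ^ m
    Sum-Z x = begin
      Sum V (λ γ → prod w γ * Z x γ)
        ≡⟨ trans (Sum-cong V (λ γ → solve 3 (λ p c s → p :* (con 1ℚ :+ c :* s) := p :+ c :* (p :* s)) refl (prod w γ) C (S x γ * S x γ)))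
             (trans (Sum-+ V _ _) (cong₂ _+_ (Sum-prod elemsG m w) (Sum-*ˡ V C _))) ⟩
      b ^ m + C * Sum V (λ γ → prod w γ * (S x γ * S x γ))
        ≤⟨ +-monoʳ-≤ (b ^ m) (*-monoˡ C 0≤C (second-moment elemsG w (X x) 0≤w (X-mean x)
             (∑-mono (λ t → ≤-respʳ (*-identityʳ (w t)) (*-monoˡ (w t) (0≤w t) (X²≤1 x t)))) m)) ⟩
      b ^ m + C * (ι m * b ^ m)
        ≤⟨ ≤-by ((1ℚ - C * ι m) * b ^ m) (0≤* (0≤b-a Cm≤1) (0≤^ m (<⇒≤ 0<b)))
             (solve 3 (λ p c m → p :+ c :* (m :* p) :+ (con 1ℚ :- c :* m) :* p := con 2ℚ :* p) refl (b ^ m) C (ι m)) ⟩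
      2ℚ * b ^ m ∎
      where
      open ℚₚ.≤-Reasoning
      V = tuples elemsG m

    module Groups (r : ℕ) where
      B : Set
      B = Vec (Vec G m) r

      Bs : List B
      Bs = tuples (tuples elemsG m) r

      shift : G → B → B
      shift t = Vec.map (Vec.map (_⊞ᵥ t))

      Sum-shift : ∀ t (f : B → ℚ) → Sum Bs (λ β → f (shift t β)) ≡ Sum Bs f
      Sum-shift t = map-enum-shift (tuplesEnum EG m) (Vec.map (_⊞ᵥ t)) (Vec.map (_⊟ᵥ t)) (inv₁ ) (inv₂) r
        where
        inv₁ : ∀ {k} (v : Vec G k) → Vec.map (_⊟ᵥ t) (Vec.map (_⊞ᵥ t) v) ≡ v
        inv₁ [] = refl
        inv₁ (x ∷ v) = cong₂ _∷_ (⊞ᵥ-⊟ᵥ x t) (inv₁ v)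
        inv₂ : ∀ {k} (v : Vec G k) → Vec.map (_⊞ᵥ t) (Vec.map (_⊟ᵥ t) v) ≡ v
        inv₂ [] = refl
        inv₂ (x ∷ v) = cong₂ _∷_ (⊟ᵥ-⊞ᵥ x t) (inv₂ v)

      shift-shift : ∀ s t β → shift t (shift s β) ≡ shift (s ⊞ᵥ t) β
      shift-shift s t β = trans (sym (Vecₚ.map-∘ _ _ β)) (Vecₚ.map-cong (λ γ → trans (sym (Vecₚ.map-∘ _ _ γ)) (Vecₚ.map-cong (λ x → ⊞ᵥ-assoc x s t) γ)) β)

      Y : G → B → ℚ
      Y x β = prod (Z x) β * inv (4ℚ ^ r)

      0<4^r : 0ℚ < 4ℚ ^ r
      0<4^r = 0<^ r 0<4

      0≤Y : ∀ x β → 0ℚ ≤ Y x β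
      0≤Y x β = 0≤* (0≤prod (0≤Z x) β) (0≤inv 0<4^r)

      Ω : B → ℚ
      Ω = prod (prod w)

      0≤Ω : ∀ β → 0ℚ ≤ Ω β
      0≤Ω = 0≤prod (0≤prod 0≤w)

      Ω≤1 : ∀ β → Ω β ≤ 1ℚ
      Ω≤1 = prod≤1 (0≤prod 0≤w) (prod≤1 0≤w w≤1)

      bK NK : ℚ
      bK = (b ^ m) ^ r
      NK = (N ^ m) ^ r

      0<bK : 0ℚ < bK
      0<bK = 0<^ r (0<^ m 0<b)

      Sum-Ω : Sum Bs Ω ≡ bK
      Sum-Ω = trans (Sum-prod _ r (prod w)) (cong (_^ r) (Sum-prod elemsG m w))

      -- The groups are independent, so the mean of the product of the Z is at most 2^r, and
      -- dividing by 4^r leaves 2^(-r). Second moments alone thus give an exponentially small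
      -- failure term.
      Sum-ΩY : ∀ x → 2ℚ ^ r * Sum Bs (λ β → Ω β * Y x β) ≤ bK
      Sum-ΩY x = *-cancelʳ (2ℚ ^ r) (0<^ r 0<2) (≤-respˡ eq (≤-respʳ eq' (^-mono r (0≤Sum V (λ γ → 0≤* (0≤prod 0≤w γ) (0≤Z x γ))) (Sum-Z x))))
        where
        V = tuples elemsG m
        eq' : (2ℚ * b ^ m) ^ r ≡ bK * 2ℚ ^ r
        eq' = trans (^-distrib 2ℚ (b ^ m) r) (*-comm _ _)
        P = Sum V (λ γ → prod w γ * Z x γ) ^ r
        eq : P ≡ 2ℚ ^ r * Sum Bs (λ β → Ω β * Y x β) * 2ℚ ^ r
        eq = sym (trans (cong (λ z → 2ℚ ^ r * z * 2ℚ ^ r) (trans (Sum-cong Bs (λ β → trans (sym (*-assoc (Ω β) _ _)) (cong (_* inv (4ℚ ^ r)) (sym (prod-* (prod w) (Z x) β)))))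
          (trans (Sum-*ʳ Bs _ _) (cong (_* inv (4ℚ ^ r)) (Sum-prod V r _)))))
          (trans (solve 3 (λ t p i → t :* (p :* i) :* t := p :* i :* (t :* t)) refl (2ℚ ^ r) P (inv (4ℚ ^ r)))
            (trans (cong (P * inv (4ℚ ^ r) *_) (trans (sym (^-distrib 2ℚ 2ℚ r)) (cong (_^ r) (solve 0 (con 2ℚ :* con 2ℚ := con 4ℚ) refl)))) (inv-cancelʳ P 0<4^r))))

      Y₊ : B → ℚ
      Y₊ β = ∑ (λ x → Y x β)

      Sum-ΩY₊ : 2ℚ ^ r * Sum Bs (λ β → Ω β * Y₊ β) ≤ N * bK
      Sum-ΩY₊ = subst₂ _≤_ (trans (∑-*ˡ (2ℚ ^ r) _) (cong (2ℚ ^ r *_) (trans (Sum-swap elemsG Bs _) (Sum-cong Bs (λ β → ∑-*ˡ (Ω β) _)))))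
        (∑-const bK) (∑-mono Sum-ΩY)

      -- Seen from x + t, the samples moved by t look as the original samples do from x. The χ parts
      -- cancel, and only the difference of the true values of g survives.
      S-shift : ∀ {k} t x (γ : Vec G k) → S (x ⊞ᵥ t) (Vec.map (_⊞ᵥ t) γ) - S x γ ≡ ι k * (g x - g (x ⊞ᵥ t))
      S-shift {k} t x γ = trans (cong₂ _-_ (trans (total-map (X (x ⊞ᵥ t)) (_⊞ᵥ t) γ) (trans (total-cong (λ s → cong (λ z → χ z - g (x ⊞ᵥ t)) (diff s)) γ) (total-minus _ _ γ)))
          (total-minus _ _ γ))
        (solve 4 (λ a k g h → a :- k :* h :- (a :- k :* g) := k :* (g :- h)) refl (total (λ s → χ (s ⊟ᵥ x)) γ) (ι k) (g x) (g (x ⊞ᵥ t)))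
        where
        diff : ∀ s → s ⊞ᵥ t ⊟ᵥ (x ⊞ᵥ t) ≡ s ⊟ᵥ x
        diff s = trans (cong (s ⊞ᵥ t ⊟ᵥ_) (⊞ᵥ-comm x t)) (trans (sym (⊟ᵥ-⊟ᵥ (s ⊞ᵥ t) t x)) (cong (_⊟ᵥ x) (⊞ᵥ-⊟ᵥ s t)))

      large-Z : ∀ x γ → μ * μ ≤ S x γ * S x γ → 16ℚ ≤ Z x γ
      large-Z x γ p = ≤-trans (≤-respˡ Cμ² (*-monoˡ C 0≤C p)) (≤-by 1ℚ 0≤1 (+-comm _ 1ℚ))

      -- Either some group of samples is accurate at both points, or every group is bad at one of them.
      close-or-large : ∀ t x {k} (β : Vec (Vec G m) k) → (g x - g (x ⊞ᵥ t) ≤ 2ℚ * ζ) ⊎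
        (16ℚ ^ k ≤ prod (Z x) β * prod (Z (x ⊞ᵥ t)) (Vec.map (Vec.map (_⊞ᵥ t)) β))
      close-or-large t x [] = inj₂ (≤-reflexive (sym (*-identityˡ 1ℚ)))
      close-or-large t x {suc k} (γ ∷ β) = choose (close-or-large t x β) (≤-total (S x γ * S x γ) (μ * μ)) (≤-total (S y γ' * S y γ') (μ * μ))
        where
        y = x ⊞ᵥ t
        γ' = Vec.map (_⊞ᵥ t) γ
        β' = Vec.map (Vec.map (_⊞ᵥ t)) β
        rearrange : ∀ a b c d → a * b * (c * d) ≡ a * c * (b * d)
        rearrange = solve 4 (λ a b c d → a :* b :* (c :* d) := a :* c :* (b :* d)) refl
        combine : 16ℚ ^ k ≤ prod (Z x) β * prod (Z y) β' → 16ℚ ≤ Z x γ * Z y γ' → 16ℚ ^ suc k ≤ prod (Z x) (γ ∷ β) * prod (Z y) (γ' ∷ β')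
        combine p q = ≤-respʳ (rearrange (Z x γ) (Z y γ') (prod (Z x) β) (prod (Z y) β'))
          (*-mono (<⇒≤ 0<16) (0≤* (0≤prod (0≤Z x) β) (0≤prod (0≤Z y) β')) q p)
        choose : (g x - g y ≤ 2ℚ * ζ) ⊎ (16ℚ ^ k ≤ prod (Z x) β * prod (Z y) β') →
          (S x γ * S x γ ≤ μ * μ) ⊎ (μ * μ ≤ S x γ * S x γ) → (S y γ' * S y γ' ≤ μ * μ) ⊎ (μ * μ ≤ S y γ' * S y γ') →
          (g x - g y ≤ 2ℚ * ζ) ⊎ (16ℚ ^ suc k ≤ prod (Z x) (γ ∷ β) * prod (Z y) (γ' ∷ β'))
        choose (inj₁ p) _ _ = inj₁ p
        choose (inj₂ p) (inj₂ q) _ = inj₂ (combine p (≤-respˡ (*-identityʳ 16ℚ) (*-mono (<⇒≤ 0<16) (0≤Z y γ') (large-Z x γ q) (1≤Z y γ'))))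
        choose (inj₂ p) (inj₁ _) (inj₂ q) = inj₂ (combine p (≤-respˡ (*-identityˡ 16ℚ) (*-mono 0≤1 (0≤Z y γ') (1≤Z x γ) (large-Z y γ' q))))
        choose (inj₂ _) (inj₁ p) (inj₁ q) = inj₁ (*-cancelʳ (ι m) 0<ι-m (≤-respˡ (trans (S-shift t x γ) (*-comm _ _))
          (≤-respʳ (solve 2 (λ m z → m :* z :+ m :* z := con 2ℚ :* z :* m) refl (ι m) ζ)
            (+-mono (sq-cancel (<⇒≤ 0<μ) q) (sq-cancel (<⇒≤ 0<μ)
              (≤-respˡ (solve 1 (λ s → s :* s := (:- s) :* (:- s)) refl (S x γ)) p))))))

      -- If no group is accurate at both points, then Y₁ Y₂ ≥ 16^r / (4^r)² = 1, hence Y₁ + Y₂ ≥ 1,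
      -- which covers the trivial bound 1 on the left. So Y acts as an additive error term, and no
      -- case distinction is carried further.
      g-almost-periodic : ∀ t x β → g x - g (x ⊞ᵥ t) ≤ 2ℚ * ζ + (Y x β + Y (x ⊞ᵥ t) (shift t β))
      g-almost-periodic t x β = choose (close-or-large t x β)
        where
        Y₁ = Y x β
        Y₂ = Y (x ⊞ᵥ t) (shift t β)
        0≤Y₁ : 0ℚ ≤ Y₁
        0≤Y₁ = 0≤Y x β
        0≤Y₂ : 0ℚ ≤ Y₂
        0≤Y₂ = 0≤Y (x ⊞ᵥ t) (shift t β)
        choose : (g x - g (x ⊞ᵥ t) ≤ 2ℚ * ζ) ⊎ (16ℚ ^ r ≤ prod (Z x) β * prod (Z (x ⊞ᵥ t)) (shift t β)) → g x - g (x ⊞ᵥ t) ≤ 2ℚ * ζ + (Y₁ + Y₂)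
        choose (inj₁ p) = ≤-trans p (≤-by (Y₁ + Y₂) (0≤+ 0≤Y₁ 0≤Y₂) refl)
        choose (inj₂ p) = ≤-trans (≤-trans (≤-by (g (x ⊞ᵥ t)) (0≤g _) (solve 2 (λ a b → a :- b :+ b := a) refl (g x) (g (x ⊞ᵥ t)))) (g≤1 x))
          (≤-trans 1≤Y₁+Y₂ (≤-by (2ℚ * ζ) (0≤* 0≤2 (<⇒≤ 0<ζ)) (+-comm _ _)))
          where
          1≤Y₁Y₂ : 1ℚ ≤ Y₁ * Y₂
          1≤Y₁Y₂ = *-cancelʳ (16ℚ ^ r) (0<^ r 0<16) (≤-respˡ (sym (*-identityˡ _)) (≤-respʳ (sym (trans
            (cong (Y₁ * Y₂ *_) (trans (cong (_^ r) (solve 0 (con 16ℚ := con 4ℚ :* con 4ℚ) refl)) (^-distrib 4ℚ 4ℚ r)))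
            (trans (solve 4 (λ a b i f → a :* i :* (b :* i) :* (f :* f) := a :* i :* f :* (b :* i :* f)) refl (prod (Z x) β) (prod (Z (x ⊞ᵥ t)) (shift t β)) (inv (4ℚ ^ r)) (4ℚ ^ r))
              (cong₂ _*_ (inv-cancelʳ _ 0<4^r) (inv-cancelʳ _ 0<4^r))))) p))
          1≤Y₁+Y₂ : 1ℚ ≤ Y₁ + Y₂
          1≤Y₁+Y₂ = ≮⇒≥ (λ lt → <-irrefl refl (<-≤-trans lt (≤-trans 1≤Y₁Y₂
            (≤-trans (*-monoˡ Y₁ 0≤Y₁ (≤-trans (≤-by Y₁ 0≤Y₁ (+-comm _ _)) (<⇒≤ lt)))
              (≤-by Y₂ 0≤Y₂ (cong (_+ Y₂) (*-identityʳ Y₁)))))))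

      module Periods (δ : ℚ) (0<δ : 0ℚ < δ) (2≤δ2^r : 2ℚ ≤ δ * 2ℚ ^ r) where
        good? : ∀ β → Dec (Y₊ β ≤ δ * N)
        good? β = Y₊ β ≤? δ * N

        𝒢 : B → ℚ
        𝒢 β = Ω β * ind (good? β)

        0≤𝒢 : ∀ β → 0ℚ ≤ 𝒢 β
        0≤𝒢 β = 0≤* (0≤Ω β) (0≤ind (good? β))

        𝒢≤1 : ∀ β → 𝒢 β ≤ 1ℚ
        𝒢≤1 β = ≤-respʳ (*-identityˡ 1ℚ) (*-mono (0≤Ω β) 0≤1 (Ω≤1 β) (ind≤1 (good? β)))

        𝒢-good : ∀ β → 𝒢 β * Y₊ β ≤ 𝒢 β * (δ * N)
        𝒢-good β = go (good? β)
          where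
          go : (d : Dec (Y₊ β ≤ δ * N)) → Ω β * ind d * Y₊ β ≤ Ω β * ind d * (δ * N)
          go (yes p) = *-monoˡ (Ω β * 1ℚ) (0≤* (0≤Ω β) 0≤1) p
          go (no _) = ≤-reflexive (solve 3 (λ o y d → o :* con 0ℚ :* y := o :* con 0ℚ :* d) refl (Ω β) (Y₊ β) (δ * N))

        markov : ∀ β → (Ω β - 𝒢 β) * (δ * N) ≤ Ω β * Y₊ β
        markov β = go (good? β)
          where
          0≤ΩY : 0ℚ ≤ Ω β * Y₊ β
          0≤ΩY = 0≤* (0≤Ω β) (0≤∑ (λ x → 0≤Y x β))
          go : (d : Dec (Y₊ β ≤ δ * N)) → (Ω β - Ω β * ind d) * (δ * N) ≤ Ω β * Y₊ β
          go (yes p) = ≤-respˡ (solve 2 (λ o d → con 0ℚ := (o :- o :* con 1ℚ) :* d) refl (Ω β) (δ * N)) 0≤ΩY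
          go (no p) = ≤-respˡ (solve 2 (λ o d → o :* d := (o :- o :* con 0ℚ) :* d) refl (Ω β) (δ * N)) (*-monoˡ (Ω β) (0≤Ω β) (<⇒≤ (≰⇒> p)))

        -- Markov's inequality: the mean of `Y₊` is at most N 2^(-r) ≤ δ N / 2, so at least half of
        -- the weight Ω lies on good families of samples.
        bK≤2Sum-𝒢 : bK ≤ 2ℚ * Sum Bs 𝒢
        bK≤2Sum-𝒢 = ≤-by (2ℚ * Sum Bs 𝒢 - bK) 0≤rest (solve 2 (λ a b → a :+ (b :- a) := b) refl bK (2ℚ * Sum Bs 𝒢))
          where
          E = bK - Sum Bs 𝒢
          2E≤bK : 2ℚ * E ≤ bK
          2E≤bK = *-cancelʳ N 0<N (begin
            2ℚ * E * N ≤⟨ *-monoʳ N 0≤N (*-monoʳ E 0≤E 2≤δ2^r) ⟩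
            δ * 2ℚ ^ r * E * N ≡⟨ solve 4 (λ d t e n → d :* t :* e :* n := t :* (e :* (d :* n))) refl δ (2ℚ ^ r) E N ⟩
            2ℚ ^ r * (E * (δ * N)) ≡⟨ cong (2ℚ ^ r *_) (trans (cong (_* (δ * N)) (trans (cong (_- Sum Bs 𝒢) (sym Sum-Ω)) (sym (Sum-- Bs Ω 𝒢)))) (sym (Sum-*ʳ Bs _ _))) ⟩
            2ℚ ^ r * Sum Bs (λ β → (Ω β - 𝒢 β) * (δ * N)) ≤⟨ *-monoˡ (2ℚ ^ r) (0≤^ r 0≤2) (Sum-mono Bs markov) ⟩
            2ℚ ^ r * Sum Bs (λ β → Ω β * Y₊ β) ≤⟨ Sum-ΩY₊ ⟩
            N * bK ≡⟨ *-comm N bK ⟩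
            bK * N ∎)
            where
            open ℚₚ.≤-Reasoning
            0≤E : 0ℚ ≤ E
            0≤E = 0≤b-a (≤-respʳ Sum-Ω (Sum-mono Bs (λ β → ≤-respʳ (*-identityʳ _) (*-monoˡ (Ω β) (0≤Ω β) (ind≤1 (good? β))))))
          0≤rest : 0ℚ ≤ 2ℚ * Sum Bs 𝒢 - bK
          0≤rest = ≤-respʳ (solve 2 (λ a b → b :- con 2ℚ :* (b :- a) := con 2ℚ :* a :- b) refl (Sum Bs 𝒢) bK) (0≤b-a 2E≤bK)

        -- The pigeonhole of the method. Over all NK families the mean of `hits` is N Sum 𝒢 / NK ≥ N
        -- bK / (2 NK), so some family has that many good translates. `excess` asks for half of this
        -- to make the inequality strict.
        hits : B → ℚ
        hits β = ∑ (λ t → 𝒢 (shift t β))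

        Sum-hits : Sum Bs hits ≡ N * Sum Bs 𝒢
        Sum-hits = trans (Sum-swap Bs elemsG _) (trans (∑-cong (λ t → Sum-shift t 𝒢)) (∑-const _))

        Sum-Bs-1 : Sum Bs (λ _ → 1ℚ) ≡ NK
        Sum-Bs-1 = trans (Sum-cong Bs (λ β → sym (trans (prod-cong prod-1 β) (prod-1 β)))) (trans (Sum-prod _ r (prod (λ _ → 1ℚ))) (cong (_^ r) (trans (Sum-prod elemsG m (λ _ → 1ℚ)) (cong (_^ m) ∑-1))))

        0<NK : 0ℚ < NK
        0<NK = 0<^ r (0<^ m 0<N)

        excess : B → ℚ
        excess β = hits β * (4ℚ * NK) - N * bK

        0<Sum-excess : 0ℚ < Sum Bs excess
        0<Sum-excess = subst (0ℚ <_) (sym (trans (Sum-- Bs _ _) (trans (cong₂ _-_ (trans (Sum-*ʳ Bs _ _) (cong (_* (4ℚ * NK)) Sum-hits))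
            (trans (Sum-cong Bs (λ _ → sym (*-identityʳ _))) (trans (Sum-*ˡ Bs (N * bK) _) (cong (N * bK *_) Sum-Bs-1))))
            (solve 4 (λ n s k b → n :* s :* (con 4ℚ :* k) :- n :* b :* k := n :* k :* b :+ con 2ℚ :* (n :* k :* (con 2ℚ :* s :- b))) refl N (Sum Bs 𝒢) NK bK))))
          (0<+ (0<* (0<* 0<N 0<NK) 0<bK) (0≤* 0≤2 (0≤* (0≤* 0≤N (<⇒≤ 0<NK)) (0≤b-a bK≤2Sum-𝒢))))

        β₀ : B
        β₀ = proj₁ (Sum-pos Bs excess 0<Sum-excess)

        many-hits : N * bK < hits β₀ * (4ℚ * NK)
        many-hits = <-by (excess β₀) (proj₂ (Sum-pos Bs excess 0<Sum-excess)) (solve 2 (λ a b → a :+ (b :- a) := b) refl (N * bK) (hits β₀ * (4ℚ * NK)))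

        0<hits : 0ℚ < hits β₀
        0<hits = ≰⇒> (λ p → <-irrefl refl (<-trans (0<* 0<N 0<bK) (<-≤-trans many-hits
          (≤-respʳ (zeroˡ _) (*-monoʳ (4ℚ * NK) (<⇒≤ (0<* 0<4 0<NK)) p)))))

        -- The family β₀ may itself be bad. Its good translate β₁ has the same number of hits, and
        -- comparing β₁ with a good translate of β₁ involves two small errors.
        t₀ : G
        t₀ = proj₁ (Sum-pos elemsG (λ t → 𝒢 (shift t β₀)) 0<hits)

        β₁ : B
        β₁ = shift t₀ β₀

        Y₊β₁≤ : Y₊ β₁ ≤ δ * N
        Y₊β₁≤ = *-cancelʳ (𝒢 β₁) (proj₂ (Sum-pos elemsG (λ t → 𝒢 (shift t β₀)) 0<hits)) (subst₂ _≤_ (*-comm _ _) (*-comm _ _) (𝒢-good β₁))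

        period : G → ℚ
        period t = 𝒢 (shift t β₁)

        ∑-period : ∑ period ≡ hits β₀
        ∑-period = trans (∑-cong (λ t → cong 𝒢 (shift-shift t₀ t β₀))) (∑-shiftˡ t₀ (λ t → 𝒢 (shift t β₀)))

        -- Multiplying by `period t`, which vanishes unless `shift t β₁` is good, replaces
        -- conditioning on t. Either error sum is then at most δ N.
        invariance : ∀ (v : G → ℚ) → (∀ x → 0ℚ ≤ v x) → (∀ x → v x ≤ 1ℚ) → ∀ t →
          period t * (∑ (λ x → v x * g x) - ∑ (λ x → v x * g (x ⊞ᵥ t))) ≤ period t * (2ℚ * ζ * ∑ v + 2ℚ * (δ * N))
        invariance v 0≤v v≤1 t = begin
          period t * (∑ (λ x → v x * g x) - ∑ (λ x → v x * g (x ⊞ᵥ t)))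
            ≤⟨ *-monoˡ (period t) (0≤𝒢 (shift t β₁)) (≤-respˡ (∑-- _ _) (∑-mono pointwise)) ⟩
          period t * ∑ (λ x → 2ℚ * ζ * v x + (Y x β₁ + Y (x ⊞ᵥ t) (shift t β₁)))
            ≡⟨ cong (period t *_) (trans (∑-+ _ _) (cong₂ _+_ (∑-*ˡ (2ℚ * ζ) v) (trans (∑-+ _ _) (cong (Y₊ β₁ +_) (∑-shiftʳ t (λ x → Y x (shift t β₁))))))) ⟩
          period t * (2ℚ * ζ * ∑ v + (Y₊ β₁ + Y₊ (shift t β₁)))
            ≡⟨ solve 4 (λ p z a c → p :* (z :+ (a :+ c)) := p :* z :+ (p :* a :+ p :* c)) refl (period t) (2ℚ * ζ * ∑ v) (Y₊ β₁) (Y₊ (shift t β₁)) ⟩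
          period t * (2ℚ * ζ * ∑ v) + (period t * Y₊ β₁ + period t * Y₊ (shift t β₁))
            ≤⟨ +-monoʳ-≤ (period t * (2ℚ * ζ * ∑ v)) (+-mono (*-monoˡ (period t) (0≤𝒢 (shift t β₁)) Y₊β₁≤) (𝒢-good (shift t β₁))) ⟩
          period t * (2ℚ * ζ * ∑ v) + (period t * (δ * N) + period t * (δ * N))
            ≡⟨ solve 3 (λ p z d → p :* z :+ (p :* d :+ p :* d) := p :* (z :+ con 2ℚ :* d)) refl (period t) (2ℚ * ζ * ∑ v) (δ * N) ⟩
          period t * (2ℚ * ζ * ∑ v + 2ℚ * (δ * N)) ∎
          where
          open ℚₚ.≤-Reasoning
          pointwise : ∀ x → v x * g x - v x * g (x ⊞ᵥ t) ≤ 2ℚ * ζ * v x + (Y x β₁ + Y (x ⊞ᵥ t) (shift t β₁))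
          pointwise x = ≤-respˡ (solve 3 (λ v a b → v :* (a :- b) := v :* a :- v :* b) refl (v x) (g x) (g (x ⊞ᵥ t)))
            (≤-trans (*-monoˡ (v x) (0≤v x) (g-almost-periodic t x β₁))
              (≤-by ((1ℚ - v x) * Ys) (0≤* (0≤b-a (v≤1 x)) (0≤+ (0≤Y x β₁) (0≤Y (x ⊞ᵥ t) (shift t β₁))))
                (solve 3 (λ v z y → v :* (z :+ y) :+ (con 1ℚ :- v) :* y := z :* v :+ y) refl (v x) (2ℚ * ζ) Ys)))
            where Ys = Y x β₁ + Y (x ⊞ᵥ t) (shift t β₁)

      almost-periods : ∀ δ → 0ℚ < δ → 2ℚ ≤ δ * 2ℚ ^ r → ∃[ T ] ((∀ t → 0ℚ ≤ T t) × (∀ t → T t ≤ 1ℚ) × N * bK < ∑ T * (4ℚ * NK) ×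
        (∀ (v : G → ℚ) → (∀ x → 0ℚ ≤ v x) → (∀ x → v x ≤ 1ℚ) → ∀ t →
          T t * (∑ (λ x → v x * g x) - ∑ (λ x → v x * g (x ⊞ᵥ t))) ≤ T t * (2ℚ * ζ * ∑ v + 2ℚ * (δ * N))))
      almost-periods δ 0<δ h = period , (λ t → 0≤𝒢 (shift t β₁)) , (λ t → 𝒢≤1 (shift t β₁)) , subst (λ z → N * bK < z * (4ℚ * NK)) (sym ∑-period) many-hits , invariance
        where open Periods δ 0<δ h

ind-pos : ∀ {P : Set} (d : Dec P) → 0ℚ < ind d → P
ind-pos (yes p) _ = p
ind-pos (no _) q = ⊥-elim (<-irrefl refl q)

ind-true : ∀ {P : Set} (d : Dec P) → P → ind d ≡ 1ℚ
ind-true (yes _) _ = refl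
ind-true (no n) p = ⊥-elim (n p)

does⇒ : ∀ {P : Set} (d : Dec P) → does d ≡ true → P
does⇒ (yes p) _ = p

⇒does : ∀ {P : Set} (d : Dec P) → P → does d ≡ true
⇒does (yes _) _ = refl
⇒does (no n) p = ⊥-elim (n p)

true-iff : ∀ {a b} → (a ≡ true → b ≡ true) → (b ≡ true → a ≡ true) → a ≡ b
true-iff {true} f g = sym (f refl)
true-iff {false} {true} f g = g refl
true-iff {false} {false} f g = refl

if-∧-does : ∀ {P : Set} b (d : Dec P) → (if b ∧ does d then 1ℚ else 0ℚ) ≡ (if b then 1ℚ else 0ℚ) * ind d
if-∧-does true (yes _) = sym (*-identityˡ 1ℚ)
if-∧-does true (no _) = sym (*-identityˡ 0ℚ)
if-∧-does false d = sym (zeroˡ (ind d))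

-- Biased directions

-- The sign of the sum of the indicators decides whether a witness exists.
search : (E : Enumeration 𝕏) {P : 𝕏 → Set} → (∀ x → Dec (P x)) → (∃[ x ] P x) ⊎ (∀ x → ¬ P x)
search E {P} P? = go (0ℚ <? Sum list (λ x → ind (P? x)))
  where
  open Enumeration E
  go : Dec (0ℚ < Sum list (λ x → ind (P? x))) → _
  go (yes p) = let x , q = Sum-pos list _ p in inj₁ (x , ind-pos (P? x) q)
  go (no ¬p) = inj₂ (λ z Pz → ¬p (<-≤-trans 0<1 (subst₂ _≤_
    (trans (Sum-δ (λ y → ind (P? y)) z) (ind-true (P? z) Pz))
    refl
    (Sum-mono list (λ y → ≤-respʳ (*-identityˡ _) (*-monoʳ (ind (P? y)) (0≤ind (P? y)) (ind≤1 (y ≟ z))))))))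

∣∣² : ∀ x → ∥ x ∥ * ∥ x ∥ ≡ x * x
∣∣² x = trans (sym (∣*∣ x x)) (0≤⇒∣∣ (0≤sq x))

positive-part : ∀ y → ∥ y ∥ ≡ 2ℚ * (ind (0ℚ <? y) * y) - y
positive-part y with 0ℚ <? y
... | yes p = trans (0≤⇒∣∣ (<⇒≤ p)) (solve 1 (λ y → y := con 2ℚ :* (con 1ℚ :* y) :- y) refl y)
... | no ¬p = trans (sym (∣-∣ y)) (trans (0≤⇒∣∣ (0≤neg (≮⇒≥ ¬p))) (solve 1 (λ y → :- y := con 2ℚ :* (con 0ℚ :* y) :- y) refl y))

round-up : ∀ J x q → 0ℚ ≤ x → 0ℚ ≤ q → x ≤ ι J * q → ∃[ j ] (j ℕ.≤ J × x ≤ ι j * q × ι j * q ≤ x + q)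
round-up zero x q 0≤x 0≤q p = 0 , ℕ.z≤n , p , ≤-respˡ (sym (trans (cong (_* q) ι0) (zeroˡ q))) (0≤+ 0≤x 0≤q)
round-up (suc J) x q 0≤x 0≤q p with ≤-total x (ι J * q)
... | inj₁ r = let j , j≤J , s , t = round-up J x q 0≤x 0≤q r in j , ℕₚ.m≤n⇒m≤1+n j≤J , s , t
... | inj₂ r = suc J , ℕₚ.≤-refl , p , ≤-respˡ (trans (solve 2 (λ j q → j :* q :+ q := (con 1ℚ :+ j) :* q) refl (ι J) q) (cong (_* q) (sym (ι-suc J)))) (+-monoˡ-≤ q r)

-- ρ and κ are tuned so that κ < ρ⁹ while a set of density ≤ j/8, weighted ρ¹⁶⁻ʲ inside and
-- ρ⁸⁻ʲ outside, has average at most κ.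
a₀ ρ κ₀ ω : ℚ
a₀ = ℤ.+ 1 ℚ./ 128
ρ = 1ℚ + a₀
κ₀ = ρ ^ 8 * (ℤ.+ 257 ℚ./ 256)
ω = ℤ.+ 258 ℚ./ 257

0≤a₀ : 0ℚ ≤ a₀
0≤a₀ = nonNegative⁻¹ a₀

0<ρ : 0ℚ < ρ
0<ρ = 0<+ 0<1 0≤a₀

0≤ρ : 0ℚ ≤ ρ
0≤ρ = <⇒≤ 0<ρ

0<κ₀ : 0ℚ < κ₀
0<κ₀ = 0<* (0<^ 8 0<ρ) (positive⁻¹ _)

1≤ρ^8 : 1ℚ ≤ ρ ^ 8
1≤ρ^8 = 1≤^ 8 (≤-by a₀ 0≤a₀ refl)

ρ^9≡κ₀ω : ρ ^ 9 ≡ κ₀ * ω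
ρ^9≡κ₀ω = trans (cong (_* ρ ^ 8) (solve 0 (con 1ℚ :+ con a₀ := con (ℤ.+ 129 ℚ./ 128)) refl))
  (solve 1 (λ p → con (ℤ.+ 129 ℚ./ 128) :* p := p :* con (ℤ.+ 257 ℚ./ 256) :* con ω) refl (ρ ^ 8))

-- Bernoulli at 1 + 257/257 = 2. This is the origin of the 257 in the codimension bound: every
-- halving of the density of T admits at most 257 further directions.
2≤ω^257 : 2ℚ ≤ ω ^ 257
2≤ω^257 = ≤-respʳ (cong (_^ 257) (solve 0 (con 1ℚ :+ con (ℤ.+ 1 ℚ./ 257) := con ω) refl))
  (≤-respˡ (trans (cong (λ z → 1ℚ + z * (ℤ.+ 1 ℚ./ 257)) ι257) (solve 0 (con 1ℚ :+ con (ℤ.+ 257 ℚ./ 1) :* con (ℤ.+ 1 ℚ./ 257) := con 2ℚ) refl))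
    (1+na≤ (ℤ.+ 1 ℚ./ 257) (nonNegative⁻¹ _) 257))
  where
  ι257 : ι 257 ≡ ℤ.+ 257 ℚ./ 1
  ι257 = sym (ι-def 257)

1≤ω : 1ℚ ≤ ω
1≤ω = ≤-by (ℤ.+ 1 ℚ./ 257) (nonNegative⁻¹ _) (solve 0 (con 1ℚ :+ con (ℤ.+ 1 ℚ./ 257) := con ω) refl)

opaque
  unfolding _+_ _*_ ι

  -- To first order in a₀ the left side is 1 + 8 a₀ for every j, like ρ^8. The factor 257/256 in κ₀
  -- only has to absorb terms of second order, and the nine cases are settled by evaluation.
  weight-bound : ∀ j → j ℕ.≤ 8 → ρ ^ (8 ℕ.∸ j) * (1ℚ + ι j * (ℤ.+ 1 ℚ./ 8) * (ρ ^ 8 - 1ℚ)) ≤ κ₀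
  weight-bound 0 _ = toWitness {a? = ρ ^ 8 * (1ℚ + ι 0 * (ℤ.+ 1 ℚ./ 8) * (ρ ^ 8 - 1ℚ)) ≤? κ₀} _
  weight-bound 1 _ = toWitness {a? = ρ ^ 7 * (1ℚ + ι 1 * (ℤ.+ 1 ℚ./ 8) * (ρ ^ 8 - 1ℚ)) ≤? κ₀} _
  weight-bound 2 _ = toWitness {a? = ρ ^ 6 * (1ℚ + ι 2 * (ℤ.+ 1 ℚ./ 8) * (ρ ^ 8 - 1ℚ)) ≤? κ₀} _
  weight-bound 3 _ = toWitness {a? = ρ ^ 5 * (1ℚ + ι 3 * (ℤ.+ 1 ℚ./ 8) * (ρ ^ 8 - 1ℚ)) ≤? κ₀} _
  weight-bound 4 _ = toWitness {a? = ρ ^ 4 * (1ℚ + ι 4 * (ℤ.+ 1 ℚ./ 8) * (ρ ^ 8 - 1ℚ)) ≤? κ₀} _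
  weight-bound 5 _ = toWitness {a? = ρ ^ 3 * (1ℚ + ι 5 * (ℤ.+ 1 ℚ./ 8) * (ρ ^ 8 - 1ℚ)) ≤? κ₀} _
  weight-bound 6 _ = toWitness {a? = ρ ^ 2 * (1ℚ + ι 6 * (ℤ.+ 1 ℚ./ 8) * (ρ ^ 8 - 1ℚ)) ≤? κ₀} _
  weight-bound 7 _ = toWitness {a? = ρ ^ 1 * (1ℚ + ι 7 * (ℤ.+ 1 ℚ./ 8) * (ρ ^ 8 - 1ℚ)) ≤? κ₀} _
  weight-bound 8 _ = toWitness {a? = ρ ^ 0 * (1ℚ + ι 8 * (ℤ.+ 1 ℚ./ 8) * (ρ ^ 8 - 1ℚ)) ≤? κ₀} _
  weight-bound (suc (suc (suc (suc (suc (suc (suc (suc (suc _))))))))) (ℕ.s≤s (ℕ.s≤s (ℕ.s≤s (ℕ.s≤s (ℕ.s≤s (ℕ.s≤s (ℕ.s≤s (ℕ.s≤s ()))))))))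

module Chang (𝔽 : FiniteField) (n : ℕ) where
  open Space 𝔽 n
  open Subspace

  ⊟1·-cancel : ∀ {m} (x v : Vec K m) → x ⊞ᵥ v ⊞ᵥ (⊟ 1#) ·ᵥ v ≡ x
  ⊟1·-cancel [] [] = refl
  ⊟1·-cancel (x ∷ xs) (v ∷ vs) = cong₂ _∷_ (trans (cong (x ⊞ v ⊞_) (-1*x≈-x v)) (//-rightDividesʳ v x)) (⊟1·-cancel xs vs)
    where
    open import Algebra.Properties.Ring (CommutativeRing.ring ring) using (-1*x≈-x)
    open import Algebra.Properties.Group (CommutativeRing.+-group ring) using (//-rightDividesʳ)

  mem-shift : ∀ V x v → mem V v ≡ true → mem V (x ⊞ᵥ v) ≡ mem V x
  mem-shift V x v v∈V = true-iff (λ p → subst (λ z → mem V z ≡ true) (⊟1·-cancel x v) (+-mem V _ _ p (·-mem V (⊟ 1#) v v∈V)))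
    (λ p → +-mem V x v p v∈V)

  1V : Subspace → G → ℚ
  1V V = 1[ mem V ]

  1V-true : ∀ V v → mem V v ≡ true → 1V V v ≡ 1ℚ
  1V-true V v p = cong (λ b → if b then 1ℚ else 0ℚ) p

  0≤1V : ∀ V v → 0ℚ ≤ 1V V v
  0≤1V V v with mem V v
  ... | true = 0≤1
  ... | false = ≤-refl

  1V-cong : ∀ V v {a b : ℚ} → (mem V v ≡ true → a ≡ b) → 1V V v * a ≡ 1V V v * b
  1V-cong V v {a} {b} h with mem V v
  ... | true = cong (1ℚ *_) (h refl)
  ... | false = trans (zeroˡ a) (sym (zeroˡ b))

  0<∑1V : ∀ V → 0ℚ < ∑ (1V V)
  0<∑1V V = <-≤-trans 0<1 (subst₂ _≤_ (trans (∑-δ (1V V) 0ᵥ) (1V-true V 0ᵥ (zero-mem V))) refl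
    (∑-mono (λ y → ≤-respʳ (*-identityˡ _) (*-monoʳ (1V V y) (0≤1V V y) (ind≤1 (y ≟G 0ᵥ))))))

  whole : Subspace
  whole = record { mem = λ _ → true ; zero-mem = refl ; +-mem = λ _ _ _ _ → refl ; ·-mem = λ _ _ _ → refl }

  whole-codim : HasCodim whole 0
  whole-codim = ι-injective (trans (cong ι (ℕₚ.*-identityʳ (card (mem whole)))) (trans (ι-card (mem whole)) (trans ∑-1 (trans N≡q^n (sym (ι-^ q n))))))

  _∩_⊥ : Subspace → G → Subspace
  V ∩ ξ ⊥ = record
    { mem = λ x → mem V x ∧ does (dot ξ x ≟F 0#)
    ; zero-mem = both (zero-mem V) (dot-0 ξ)
    ; +-mem = λ x y p q → both (+-mem V x y (left p) (left q)) (trans (dot-⊞ ξ x y) (trans (cong₂ _⊞_ (right x p) (right y q)) (⊞-identityʳ 0#)))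
    ; ·-mem = λ c x p → both (·-mem V c x (left p)) (trans (dot-· ξ c x) (trans (cong (c ⊠_) (right x p)) (⊠-zeroʳ c)))
    }
    where
    left : ∀ {b c} → b ∧ c ≡ true → b ≡ true
    left {b} {c} = Boolₚ.∧-conicalˡ b c
    right : ∀ x {b} → b ∧ does (dot ξ x ≟F 0#) ≡ true → dot ξ x ≡ 0#
    right x {b} p = does⇒ (dot ξ x ≟F 0#) (Boolₚ.∧-conicalʳ b _ p)
    both : ∀ {b x} → b ≡ true → dot ξ x ≡ 0# → b ∧ does (dot ξ x ≟F 0#) ≡ true
    both {x = x} refl q = ⇒does (dot ξ x ≟F 0#) q

  1V-line : ∀ V x c v → mem V v ≡ true → 1V V (x ⊞ᵥ c ·ᵥ v) ≡ 1V V x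
  1V-line V x c v p = cong (λ b → if b then 1ℚ else 0ℚ) (mem-shift V x (c ·ᵥ v) (·-mem V c v p))

  -- Since v lies in V, `decouple` along v shows that ξ takes each of its q values equally often on
  -- V, so its kernel in V has a q-th of the elements.
  ∩⊥-codim : ∀ V ξ v j → mem V v ≡ true → dot ξ v ≡ 1# → HasCodim V j → HasCodim (V ∩ ξ ⊥) (suc j)
  ∩⊥-codim V ξ v j v∈V ξv≡1 codim = trans (sym (ℕₚ.*-assoc (card W) q _)) (trans (cong (ℕ._* q ℕ.^ j) (trans (ℕₚ.*-comm (card W) q) card≡)) codim)
    where
    W = mem (V ∩ ξ ⊥)
    card≡ : q ℕ.* card W ≡ card (mem V)
    card≡ = ι-injective (trans (ι-* q (card W)) (trans (cong (q̂ *_) (trans (ι-card W) (∑-cong (λ x → if-∧-does (mem V x) (dot ξ x ≟F 0#)))))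
      (trans (decouple (dot ξ) v (dot-shift ξ v ξv≡1) (1V V) (λ x c → 1V-line V x c v v∈V) (λ y → ind (y ≟F 0#)))
        (trans (cong (∑ (1V V) *_) (Enumeration.Sum-δ₁ EK 0#)) (trans (*-identityʳ _) (sym (ι-card (mem V))))))))

  module Spectrum (T : G → ℚ) (0≤T : ∀ t → 0ℚ ≤ T t) (T≤1 : ∀ t → T t ≤ 1ℚ) (0<|T| : 0ℚ < ∑ T) where
    |T| : ℚ
    |T| = ∑ T

    SumK : (K → ℚ) → ℚ
    SumK = Sum elements

    law : G → K → ℚ
    law ξ y = ∑ (λ t → T t * ind (y ≟F dot ξ t))

    Sum-law : ∀ ξ (h : K → ℚ) → SumK (λ y → law ξ y * h y) ≡ ∑ (λ t → T t * h (dot ξ t))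
    Sum-law ξ h = begin
      SumK (λ y → law ξ y * h y)
        ≡⟨ Sum-cong elements (λ y → sym (∑-*ʳ (h y) _)) ⟩
      SumK (λ y → ∑ (λ t → T t * ind (y ≟F dot ξ t) * h y))
        ≡⟨ Sum-swap elements elemsG _ ⟩
      ∑ (λ t → SumK (λ y → T t * ind (y ≟F dot ξ t) * h y))
        ≡⟨ ∑-cong (λ t → trans (Sum-cong elements (λ y → *-assoc (T t) _ _)) (trans (Sum-*ˡ elements (T t) _) (cong (T t *_) (Enumeration.Sum-δ EK h (dot ξ t))))) ⟩
      ∑ (λ t → T t * h (dot ξ t)) ∎
      where open ≡-Reasoning

    -- q times the deviation of ξ·t (t drawn from T) from the uniform law, scaled by |T|.
    deviation : G → K → ℚ
    deviation ξ y = q̂ * law ξ y - |T|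

    variation : G → ℚ
    variation ξ = SumK (λ y → ∥ deviation ξ y ∥)

    Sum-deviation : ∀ ξ → SumK (deviation ξ) ≡ 0ℚ
    Sum-deviation ξ = trans (Sum-- elements _ _) (trans (cong₂ _-_ (trans (Sum-*ˡ elements q̂ (law ξ)) (cong (q̂ *_)
        (trans (Sum-cong elements (λ y → sym (*-identityʳ _))) (trans (Sum-law ξ (λ _ → 1ℚ)) (∑-cong (λ t → *-identityʳ _))))))
        (Sum-const elements |T|)) (+-inverseʳ (q̂ * |T|)))

    -- After normalisation: the law of ξ·t has total variation distance more than 1/4 from uniform.
    -- The threshold is such that an unbiased ξ gives a contraction by 1/2 in L² in
    -- `fibre-contraction`.
    Biased : G → Set
    Biased ξ = q̂ * |T| < 2ℚ * variation ξ

    module Bias (ξ : G) (biased : Biased ξ) where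
      over? : ∀ y → Dec (0ℚ < deviation ξ y)
      over? y = 0ℚ <? deviation ξ y

      P : K → ℚ
      P y = ind (over? y)

      k α : ℚ
      k = SumK P
      α = ∑ (λ t → T t * P (dot ξ t))

      0≤k : 0ℚ ≤ k
      0≤k = 0≤Sum elements (λ y → 0≤ind (over? y))

      k≤q : k ≤ q̂
      k≤q = ≤-respʳ Sum-K-1 (Sum-mono elements (λ y → ind≤1 (over? y)))

      -- Total variation is attained on the set of overrepresented values: its probability α/|T|
      -- exceeds its density k/q by more than 1/4.
      excess : |T| * (q̂ + 4ℚ * k) < 4ℚ * (q̂ * α)
      excess = <-by (2ℚ * variation ξ - q̂ * |T|) (0<b-a biased) (trans (cong (λ z → |T| * (q̂ + 4ℚ * k) + (2ℚ * z - q̂ * |T|)) variation≡)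
          (solve 4 (λ t q k a → t :* (q :+ con 4ℚ :* k) :+ (con 2ℚ :* (con 2ℚ :* (q :* a :- t :* k) :- con 0ℚ) :- q :* t) := con 4ℚ :* (q :* a)) refl |T| q̂ k α))
        where
        variation≡ : variation ξ ≡ 2ℚ * (q̂ * α - |T| * k) - 0ℚ
        variation≡ = trans (Sum-cong elements (λ y → positive-part (deviation ξ y))) (trans (Sum-- elements _ _) (cong₂ _-_
          (trans (Sum-*ˡ elements 2ℚ _) (cong (2ℚ *_) (trans (Sum-cong elements (λ y → solve 4 (λ p q l t → p :* (q :* l :- t) := q :* (l :* p) :- t :* p) refl (P y) q̂ (law ξ y) |T|))
            (trans (Sum-- elements _ _) (cong₂ _-_ (trans (Sum-*ˡ elements q̂ _) (cong (q̂ *_) (Sum-law ξ P))) (Sum-*ˡ elements |T| P))))))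
          (Sum-deviation ξ)))

      -- Rounding the density k/q up to a multiple of 1/8 leaves nine kinds of weights to check, and
      -- costs at most half of the excess 1/4.
      rounded : ∃[ j ] (j ℕ.≤ 8 × 8ℚ * k ≤ ι j * q̂ × ι j * q̂ ≤ 8ℚ * k + q̂)
      rounded = round-up 8 (8ℚ * k) q̂ (0≤* (nonNegative⁻¹ 8ℚ) 0≤k) (<⇒≤ 0<q̂) (subst (λ z → 8ℚ * k ≤ z * q̂) (ι-def 8) (*-monoˡ 8ℚ (nonNegative⁻¹ 8ℚ) k≤q))

      j : ℕ
      j = proj₁ rounded

      j≤8 : j ℕ.≤ 8
      j≤8 = proj₁ (proj₂ rounded)

      8k≤jq : 8ℚ * k ≤ ι j * q̂
      8k≤jq = proj₁ (proj₂ (proj₂ rounded))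

      jq≤8k+q : ι j * q̂ ≤ 8ℚ * k + q̂
      jq≤8k+q = proj₂ (proj₂ (proj₂ rounded))

      exponent : K → ℕ
      exponent y = 8 ℕ.∸ j ℕ.+ (if does (over? y) then 8 else 0)

      ι-8∸j : ι (8 ℕ.∸ j) ≡ 8ℚ - ι j
      ι-8∸j = trans (solve 2 (λ a b → a := b :+ a :- b) refl (ι (8 ℕ.∸ j)) (ι j)) (cong (_- ι j) (trans (sym (ι-+ j (8 ℕ.∸ j))) (trans (cong ι (ℕₚ.m+[n∸m]≡n j≤8)) (sym (ι-def 8)))))

      ι-if : ∀ {Q : Set} (d : Dec Q) → ι (if does d then 8 else 0) ≡ 8ℚ * ind d
      ι-if (yes _) = trans (sym (ι-def 8)) (sym (*-identityʳ 8ℚ))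
      ι-if (no _) = trans ι0 (sym (zeroʳ 8ℚ))

      ρ^-if : ∀ {Q : Set} (d : Dec Q) → ρ ^ (if does d then 8 else 0) ≡ 1ℚ + ind d * (ρ ^ 8 - 1ℚ)
      ρ^-if (yes _) = solve 1 (λ p → p := con 1ℚ :+ con 1ℚ :* (p :- con 1ℚ)) refl (ρ ^ 8)
      ρ^-if (no _) = solve 1 (λ p → con 1ℚ := con 1ℚ :+ con 0ℚ :* (p :- con 1ℚ)) refl (ρ ^ 8)

      Sum-ρ^exponent : SumK (λ y → ρ ^ exponent y) ≤ q̂ * κ₀
      Sum-ρ^exponent = begin
        SumK (λ y → ρ ^ exponent y)
          ≡⟨ Sum-cong elements (λ y → trans (^-+ ρ (8 ℕ.∸ j) _) (cong (ρ ^ (8 ℕ.∸ j) *_) (ρ^-if (over? y)))) ⟩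
        SumK (λ y → ρ ^ (8 ℕ.∸ j) * (1ℚ + P y * (ρ ^ 8 - 1ℚ)))
          ≡⟨ trans (Sum-*ˡ elements _ _) (cong (ρ ^ (8 ℕ.∸ j) *_) (trans (Sum-+ elements _ _) (cong₂ _+_ Sum-K-1 (Sum-*ʳ elements _ P)))) ⟩
        ρ ^ (8 ℕ.∸ j) * (q̂ + k * (ρ ^ 8 - 1ℚ))
          ≤⟨ *-monoˡ _ (0≤^ (8 ℕ.∸ j) 0≤ρ) (+-monoʳ-≤ q̂ (*-monoʳ _ (0≤b-a 1≤ρ^8) k≤)) ⟩
        ρ ^ (8 ℕ.∸ j) * (q̂ + ι j * q̂ * (ℤ.+ 1 ℚ./ 8) * (ρ ^ 8 - 1ℚ))
          ≡⟨ solve 4 (λ p q j r → p :* (q :+ j :* q :* con (ℤ.+ 1 ℚ./ 8) :* r) := q :* (p :* (con 1ℚ :+ j :* con (ℤ.+ 1 ℚ./ 8) :* r))) refl (ρ ^ (8 ℕ.∸ j)) q̂ (ι j) (ρ ^ 8 - 1ℚ) ⟩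
        q̂ * (ρ ^ (8 ℕ.∸ j) * (1ℚ + ι j * (ℤ.+ 1 ℚ./ 8) * (ρ ^ 8 - 1ℚ)))
          ≤⟨ *-monoˡ q̂ (<⇒≤ 0<q̂) (weight-bound j j≤8) ⟩
        q̂ * κ₀ ∎
        where
        open ℚₚ.≤-Reasoning
        k≤ : k ≤ ι j * q̂ * (ℤ.+ 1 ℚ./ 8)
        k≤ = ≤-respˡ (solve 1 (λ k → con 8ℚ :* k :* con (ℤ.+ 1 ℚ./ 8) := k) refl k) (*-monoʳ (ℤ.+ 1 ℚ./ 8) (nonNegative⁻¹ _) 8k≤jq)

      -- Under T the mean exponent is 8 - j + 8 α/|T|, which exceeds 8 - j + 8 k/q + 2. As j ≤ 8 k/q
      -- + 1, at least 9 remains, against the power of about 8 in κ₀ under the uniform law.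
      ∑-T-exponent : ℤ.+ 9 ℚ./ 1 * |T| ≤ ∑ (λ t → T t * ι (exponent (dot ξ t)))
      ∑-T-exponent = *-cancelʳ q̂ 0<q̂ (≤-respʳ (cong (_* q̂) (sym ∑≡)) (≤-by (2ℚ * (4ℚ * (q̂ * α) - |T| * (q̂ + 4ℚ * k)) + |T| * (8ℚ * k + q̂ - ι j * q̂))
        (0≤+ (0≤* 0≤2 (0≤b-a (<⇒≤ excess))) (0≤* (<⇒≤ 0<|T|) (0≤b-a jq≤8k+q)))
        (solve 5 (λ t q a k j → con (ℤ.+ 9 ℚ./ 1) :* t :* q :+ (con 2ℚ :* (con 4ℚ :* (q :* a) :- t :* (q :+ con 4ℚ :* k)) :+ t :* (con 8ℚ :* k :+ q :- j :* q)) :=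
            ((con 8ℚ :- j) :* t :+ con 8ℚ :* a) :* q) refl |T| q̂ α k (ι j))))
        where
        ∑≡ : ∑ (λ t → T t * ι (exponent (dot ξ t))) ≡ (8ℚ - ι j) * |T| + 8ℚ * α
        ∑≡ = trans (∑-cong (λ t → trans (cong (T t *_) (trans (ι-+ (8 ℕ.∸ j) _) (cong₂ _+_ ι-8∸j (ι-if (over? (dot ξ t))))))
            (solve 3 (λ t c p → t :* (c :+ con 8ℚ :* p) := c :* t :+ con 8ℚ :* (t :* p)) refl (T t) (8ℚ - ι j) (P (dot ξ t)))))
          (trans (∑-+ _ _) (cong₂ _+_ (∑-*ˡ _ T) (∑-*ˡ 8ℚ _)))

    -- E accumulates the exponents of the biased directions cut out so far.
    record Chain (j : ℕ) : Set where
      field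
        V : Subspace
        codim : HasCodim V j
        E : G → ℕ
        E-invariant : ∀ x v → mem V v ≡ true → E (x ⊞ᵥ v) ≡ E x
        E-upper : ∑ (λ x → ρ ^ E x) ≤ N * κ₀ ^ j
        E-lower : ι (9 ℕ.* j) * |T| ≤ ∑ (λ t → T t * ι (E t))

    start : Chain 0
    start = record { V = whole ; codim = whole-codim ; E = λ _ → 0 ; E-invariant = λ _ _ _ → refl
      ; E-upper = ≤-reflexive (∑-const 1ℚ)
      ; E-lower = ≤-reflexive (trans (cong (_* |T|) ι0) (trans (zeroˡ |T|) (sym (trans (∑-cong (λ t → trans (cong (T t *_) ι0) (zeroʳ (T t)))) (Sum-0 elemsG))))) }

    -- The accumulated E is constant along the line of v in V, while ξ runs through all values
    -- there. Under the uniform law the new factor is therefore independent of the old ones and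
    -- multiplies the mean by at most κ₀; under T the exponents add without any independence.
    extend : ∀ {j} (c : Chain j) ξ v → mem (Chain.V c) v ≡ true → dot ξ v ≡ 1# → Biased ξ → Chain (suc j)
    extend {j} c ξ v v∈V ξv≡1 biased = record
      { V = V ∩ ξ ⊥
      ; codim = ∩⊥-codim V ξ v j v∈V ξv≡1 codim
      ; E = λ x → E x ℕ.+ exponent (dot ξ x)
      ; E-invariant = λ x w p → cong₂ (λ a b → a ℕ.+ exponent b) (E-invariant x w (Boolₚ.∧-conicalˡ _ _ p))
          (trans (dot-⊞ ξ x w) (trans (cong (dot ξ x ⊞_) (does⇒ (dot ξ w ≟F 0#) (Boolₚ.∧-conicalʳ (mem V w) _ p))) (⊞-identityʳ _)))
      ; E-upper = upper
      ; E-lower = lower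
      }
      where
      open Chain c
      open Bias ξ biased using (exponent; Sum-ρ^exponent; ∑-T-exponent)
      upper : ∑ (λ x → ρ ^ (E x ℕ.+ exponent (dot ξ x))) ≤ N * κ₀ ^ suc j
      upper = *-cancelʳ q̂ 0<q̂ (begin
        ∑ (λ x → ρ ^ (E x ℕ.+ exponent (dot ξ x))) * q̂
          ≡⟨ trans (*-comm _ q̂) (cong (q̂ *_) (∑-cong (λ x → ^-+ ρ (E x) _))) ⟩
        q̂ * ∑ (λ x → ρ ^ E x * ρ ^ exponent (dot ξ x))
          ≡⟨ decouple (dot ξ) v (dot-shift ξ v ξv≡1) (λ x → ρ ^ E x) (λ x a → cong (ρ ^_) (E-invariant x (a ·ᵥ v) (·-mem V a v v∈V))) (λ y → ρ ^ exponent y) ⟩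
        ∑ (λ x → ρ ^ E x) * SumK (λ y → ρ ^ exponent y)
          ≤⟨ *-mono (0≤∑ (λ x → 0≤^ (E x) 0≤ρ)) (0≤* (<⇒≤ 0<q̂) (<⇒≤ 0<κ₀)) E-upper Sum-ρ^exponent ⟩
        N * κ₀ ^ j * (q̂ * κ₀)
          ≡⟨ solve 4 (λ n p q k → n :* p :* (q :* k) := n :* (k :* p) :* q) refl N (κ₀ ^ j) q̂ κ₀ ⟩
        N * κ₀ ^ suc j * q̂ ∎)
        where open ℚₚ.≤-Reasoning
      lower : ι (9 ℕ.* suc j) * |T| ≤ ∑ (λ t → T t * ι (E t ℕ.+ exponent (dot ξ t)))
      lower = subst₂ _≤_
        (trans (solve 3 (λ a b t → a :* t :+ b :* t := (b :+ a) :* t) refl (ι (9 ℕ.* j)) (ℤ.+ 9 ℚ./ 1) |T|)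
          (cong (_* |T|) (trans (cong (_+ ι (9 ℕ.* j)) (ι-def 9)) (trans (sym (ι-+ 9 (9 ℕ.* j))) (cong ι (sym (ℕₚ.*-suc 9 j)))))))
        (trans (sym (∑-+ _ _)) (∑-cong (λ t → trans (sym (distribˡ (T t) _ _)) (cong (T t *_) (sym (ι-+ (E t) _))))))
        (+-mono E-lower ∑-T-exponent)

    -- Two estimates for the mean of ρ^E: under T the tangent in `bernoulli` at the exponent 9j
    -- makes it at least ρ^(9j), and since T ≤ 1 the sum under T is at most the full sum, hence at
    -- most N κ₀^j.
    chain-bound : ∀ {j} → Chain j → ω ^ j * |T| ≤ N
    chain-bound {j} c = *-cancelʳ (κ₀ ^ j) (0<^ j 0<κ₀) (begin
      ω ^ j * |T| * κ₀ ^ j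
        ≡⟨ trans (solve 3 (λ w t k → w :* t :* k := k :* w :* t) refl (ω ^ j) |T| (κ₀ ^ j)) (cong (_* |T|) (trans (sym (^-distrib κ₀ ω j)) (trans (cong (_^ j) (sym ρ^9≡κ₀ω)) (sym (^-* ρ 9 j))))) ⟩
      p * |T|
        ≤⟨ ≤-by (p * a₀ * (∑ (λ t → T t * ι (E t)) - ι limit * |T|)) (0≤* (0≤* (0≤^ limit 0≤ρ) 0≤a₀) (0≤b-a E-lower))
             (trans (solve 5 (λ p a s j t → p :* t :+ p :* a :* (s :- j :* t) := p :* (con 1ℚ :- j :* a) :* t :+ p :* a :* s) refl p a₀ (∑ (λ t → T t * ι (E t))) (ι limit) |T|)
               (sym (trans (∑-cong (λ t → solve 5 (λ p a e j t → t :* (p :* (con 1ℚ :+ (e :- j) :* a)) := p :* (con 1ℚ :- j :* a) :* t :+ p :* a :* (t :* e)) refl p a₀ (ι (E t)) (ι limit) (T t)))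
                 (trans (∑-+ _ _) (cong₂ _+_ (∑-*ˡ _ T) (∑-*ˡ _ _)))))) ⟩
      ∑ (λ t → T t * (p * (1ℚ + (ι (E t) - ι limit) * a₀)))
        ≤⟨ ∑-mono (λ t → *-monoˡ (T t) (0≤T t) (bernoulli a₀ 0≤a₀ (E t) limit)) ⟩
      ∑ (λ t → T t * ρ ^ E t)
        ≤⟨ ∑-mono (λ t → ≤-respʳ (*-identityˡ _) (*-monoʳ (ρ ^ E t) (0≤^ (E t) 0≤ρ) (T≤1 t))) ⟩
      ∑ (λ t → ρ ^ E t)
        ≤⟨ E-upper ⟩
      N * κ₀ ^ j ∎)
      where
      open Chain c
      open ℚₚ.≤-Reasoning
      limit = 9 ℕ.* j
      p = ρ ^ limit

    Complete : Subspace → Set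
    Complete V = ∀ ξ → (¬ Biased ξ) ⊎ (∀ v → mem V v ≡ true → dot ξ v ≡ 0#)

    grow : ∀ {j} (c : Chain j) → Complete (Chain.V c) ⊎ Chain (suc j)
    grow c = outer (search EG witness?)
      where
      open Chain c
      Witness : G → Set
      Witness ξ = Biased ξ × ∃[ v ] (mem V v ≡ true × dot ξ v ≢ 0#)
      inner? : ∀ ξ → (∃[ v ] (mem V v ≡ true × dot ξ v ≢ 0#)) ⊎ (∀ v → ¬ (mem V v ≡ true × dot ξ v ≢ 0#))
      inner? ξ = search EG (λ v → (mem V v Boolₚ.≟ true) ×-dec ¬? (dot ξ v ≟F 0#))
      biased? : ∀ ξ → Dec (Biased ξ)
      biased? ξ = q̂ * |T| <? 2ℚ * variation ξ
      witness? : ∀ ξ → Dec (Witness ξ)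
      witness? ξ = biased? ξ ×-dec toDec (inner? ξ)
        where
        toDec : ∀ {P : G → Set} → (∃[ v ] P v) ⊎ (∀ v → ¬ P v) → Dec (∃[ v ] P v)
        toDec (inj₁ p) = yes p
        toDec (inj₂ n) = no (λ { (v , p) → n v p })
      outer : (∃[ ξ ] Witness ξ) ⊎ (∀ ξ → ¬ Witness ξ) → Complete V ⊎ Chain (suc _)
      outer (inj₁ (ξ , biased , v , v∈V , ξv≢0)) = let a , eq = normalise-dot ξ v ξv≢0 in
        inj₂ (extend c ξ (a ·ᵥ v) (·-mem V a v v∈V) eq biased)
      outer (inj₂ none) = inj₁ (λ ξ → decide ξ (biased? ξ))
        where
        decide : ∀ ξ → Dec (Biased ξ) → (¬ Biased ξ) ⊎ (∀ v → mem V v ≡ true → dot ξ v ≡ 0#)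
        decide ξ (no ¬b) = inj₁ ¬b
        decide ξ (yes b) = inj₂ (λ v v∈V → vanish v v∈V (dot ξ v ≟F 0#))
          where
          vanish : ∀ v → mem V v ≡ true → Dec (dot ξ v ≡ 0#) → dot ξ v ≡ 0#
          vanish v v∈V (yes p) = p
          vanish v v∈V (no ¬p) = ⊥-elim (none ξ (b , v , v∈V , ¬p))

    -- A chain of length 257 (Λ + 1) would give 2^(Λ+1) |T| ≤ N by `chain-bound`, contradicting the
    -- density of T. So growing stops with every biased direction vanishing on V before the fuel
    -- runs out.
    chang : ∀ Λ → N ≤ 2ℚ ^ Λ * |T| → ∃[ V ] ∃[ c ] (HasCodim V c × c ℕ.≤ 257 ℕ.* suc Λ × Complete V)
    chang Λ dense = go limit 0 start (ℕₚ.≤-reflexive (sym (ℕₚ.+-identityʳ limit)))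
      where
      limit = 257 ℕ.* suc Λ
      short : ∀ {j} → Chain j → j ℕ.< limit
      short {j} c = ℕₚ.≰⇒> (λ limit≤j → <-irrefl refl (<-≤-trans too-long
        (≤-trans (≤-trans (*-monoʳ |T| (<⇒≤ 0<|T|) (≤-trans 2^≤ (^-monoʳ 1≤ω limit≤j))) (chain-bound c)) dense)))
        where
        2^≤ : 2ℚ ^ suc Λ ≤ ω ^ limit
        2^≤ = ≤-respʳ (sym (^-* ω 257 (suc Λ))) (^-mono (suc Λ) 0≤2 2≤ω^257)
        too-long : 2ℚ ^ Λ * |T| < 2ℚ ^ suc Λ * |T|
        too-long = <-by (2ℚ ^ Λ * |T|) (0<* (0<^ Λ 0<2) 0<|T|) (solve 2 (λ p t → p :* t :+ p :* t := con 2ℚ :* p :* t) refl (2ℚ ^ Λ) |T|)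
      go : ∀ fuel j → Chain j → limit ℕ.≤ fuel ℕ.+ j → ∃[ V ] ∃[ c ] (HasCodim V c × c ℕ.≤ limit × Complete V)
      go zero j c limit≤j = ⊥-elim (ℕₚ.<⇒≱ (short c) limit≤j)
      go (suc fuel) j c limit≤ = continue (grow c)
        where
        continue : Complete (Chain.V c) ⊎ Chain (suc j) → ∃[ V ] ∃[ c ] (HasCodim V c × c ℕ.≤ limit × Complete V)
        continue (inj₁ done) = Chain.V c , j , Chain.codim c , ℕₚ.<⇒≤ (short c) , done
        continue (inj₂ c') = go fuel (suc j) c' (ℕₚ.≤-trans limit≤ (ℕₚ.≤-reflexive (sym (ℕₚ.+-suc fuel j))))

-- Parseval and smoothing

*-≡0 : ∀ {a b} → 0ℚ < a → a * b ≡ 0ℚ → b ≡ 0ℚ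
*-≡0 {a} {b} 0<a p = ℚₚ.≤-antisym
  (*-cancelʳ a 0<a (≤-reflexive (trans (*-comm b a) (trans p (sym (zeroˡ a))))))
  (*-cancelʳ a 0<a (≤-reflexive (trans (zeroˡ a) (trans (sym p) (*-comm a b)))))

module Smoothing (𝔽 : FiniteField) (n : ℕ) where
  open Space 𝔽 n
  open Chang 𝔽 n
  open Subspace

  private
    ⊟-cancel-iff : ∀ a b c → (a ≡ b ⊞ c → a ⊞ ⊟ c ≡ b) × (a ⊞ ⊟ c ≡ b → a ≡ b ⊞ c)
    ⊟-cancel-iff a b c = (λ { refl → //-rightDividesʳ c b }) , (λ { refl → sym (//-rightDividesˡ c a) })
      where open import Algebra.Properties.Group (CommutativeRing.+-group ring) using (//-rightDividesʳ; //-rightDividesˡ)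

    SumK-reflect : ∀ a (f : K → ℚ) → Sum elements (λ x → f (a ⊞ ⊟ x)) ≡ Sum elements f
    SumK-reflect a = Enumeration.reindex EK (λ x → a ⊞ ⊟ x) (λ x → a ⊞ ⊟ x) involutive involutive
      where
      open import Algebra.Properties.AbelianGroup (CommutativeRing.+-abelianGroup ring) using (⁻¹-anti-homo-//; xyx⁻¹≈y)
      involutive : ∀ x → a ⊞ ⊟ (a ⊞ ⊟ x) ≡ x
      involutive x = trans (cong (a ⊞_) (⁻¹-anti-homo-// a x)) (trans (sym (CommutativeRing.+-assoc ring a x _)) (xyx⁻¹≈y a x))

    SumK-unshift : ∀ a (f : K → ℚ) → Sum elements (λ x → f (x ⊞ ⊟ a)) ≡ Sum elements f
    SumK-unshift a f = trans (Sum-cong elements (λ x → cong f (CommutativeRing.+-comm ring x (⊟ a)))) (Sum-K-shift (⊟ a) f)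

  SumK : (K → ℚ) → ℚ
  SumK = Sum elements

  -- The push-forward of f under ξ. It carries the information of the Fourier coefficients at the
  -- multiples of ξ, but stays rational.
  fibre : (G → ℚ) → G → K → ℚ
  fibre f ξ y = ∑ (λ x → ind (y ≟F dot ξ x) * f x)

  Sum-fibre : ∀ f ξ → SumK (fibre f ξ) ≡ ∑ f
  Sum-fibre f ξ = trans (Sum-swap elements elemsG _) (∑-cong (λ x → Enumeration.Sum-δ EK (λ _ → f x) (dot ξ x)))

  -- For x different from z the map sending ξ to ξ·(x - z) is equidistributed, so a q-th of all ξ
  -- agree on the two points; for x = z all of them do.
  collisions : ∀ x z → q̂ * ∑ (λ ξ → ind (dot ξ x ≟F dot ξ z)) ≡ N + (q̂ - 1ℚ) * N * ind (z ≟G x)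
  collisions x z = go (z ≟G x)
    where
    go : (d : Dec (z ≡ x)) → q̂ * ∑ (λ ξ → ind (dot ξ x ≟F dot ξ z)) ≡ N + (q̂ - 1ℚ) * N * ind d
    go (yes refl) = trans (cong (q̂ *_) (trans (∑-cong (λ ξ → ind-true (dot ξ x ≟F dot ξ x) refl)) ∑-1))
      (solve 2 (λ q n → q :* n := n :+ (q :- con 1ℚ) :* n :* con 1ℚ) refl q̂ N)
    go (no z≢x) = begin
      q̂ * ∑ (λ ξ → ind (dot ξ x ≟F dot ξ z))
        ≡⟨ cong (q̂ *_) (∑-cong (λ ξ → trans (ind-cong (dot ξ x ≟F dot ξ z) (dot w ξ ≟F 0#) (to ξ) (from ξ)) (sym (*-identityˡ _)))) ⟩
      q̂ * ∑ (λ ξ → 1ℚ * ind (dot w ξ ≟F 0#))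
        ≡⟨ decouple (dot w) (proj₁ v) (dot-shift w (proj₁ v) (proj₂ v)) (λ _ → 1ℚ) (λ _ _ → refl) (λ y → ind (y ≟F 0#)) ⟩
      ∑ (λ _ → 1ℚ) * SumK (λ y → ind (y ≟F 0#))
        ≡⟨ cong₂ _*_ ∑-1 (Enumeration.Sum-δ₁ EK 0#) ⟩
      N * 1ℚ
        ≡⟨ solve 2 (λ q n → n :* con 1ℚ := n :+ (q :- con 1ℚ) :* n :* con 0ℚ) refl q̂ N ⟩
      N + (q̂ - 1ℚ) * N * 0ℚ ∎
      where
      open ≡-Reasoning
      w = x ⊟ᵥ z
      w+z : w ⊞ᵥ z ≡ x
      w+z = ⊟ᵥ-⊞ᵥ x z
      v = ∃dot≡1 w (λ w≡0 → z≢x (trans (sym (⊞ᵥ-identityˡ z)) (trans (cong (_⊞ᵥ z) (sym w≡0)) w+z)))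
      split : ∀ ξ → dot ξ x ≡ dot w ξ ⊞ dot ξ z
      split ξ = trans (cong (dot ξ) (sym w+z)) (trans (dot-⊞ ξ w z) (cong (_⊞ dot ξ z) (dot-comm ξ w)))
      to : ∀ ξ → dot ξ x ≡ dot ξ z → dot w ξ ≡ 0#
      to ξ p = trans (sym (proj₁ (⊟-cancel-iff _ _ _) (split ξ))) (trans (cong (λ y → y ⊞ ⊟ dot ξ z) p) (CommutativeRing.-‿inverseʳ ring (dot ξ z)))
      from : ∀ ξ → dot w ξ ≡ 0# → dot ξ x ≡ dot ξ z
      from ξ p = trans (split ξ) (trans (cong (_⊞ dot ξ z) p) (CommutativeRing.+-identityˡ ring (dot ξ z)))

  -- Expanding the squares counts the ξ on which x and z collide. The constant part of `collisions`
  -- is annihilated by ∑ f = 0, and the diagonal part leaves ∑ f².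
  parseval : ∀ f → ∑ f ≡ 0ℚ → q̂ * ∑ (λ ξ → SumK (λ y → fibre f ξ y * fibre f ξ y)) ≡ (q̂ - 1ℚ) * N * ∑ (λ x → f x * f x)
  parseval f ∑f≡0 = begin
    q̂ * ∑ (λ ξ → SumK (λ y → fibre f ξ y * fibre f ξ y))
      ≡⟨ cong (q̂ *_) (∑-cong (λ ξ → trans (Sum-cong elements (λ y → Sum-*-Sum elemsG elemsG _ _)) (trans (Sum-swap elements elemsG _)
           (∑-cong (λ x → trans (Sum-swap elements elemsG _) (∑-cong (λ z → trans
             (Sum-cong elements (λ y → solve 4 (λ i a j b → i :* a :* (j :* b) := i :* (j :* (a :* b))) refl (ind (y ≟F dot ξ x)) (f x) (ind (y ≟F dot ξ z)) (f z)))
             (Enumeration.Sum-δ EK (λ y → ind (y ≟F dot ξ z) * (f x * f z)) (dot ξ x))))))))) ⟩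
    q̂ * ∑ (λ ξ → ∑ (λ x → ∑ (λ z → ind (dot ξ x ≟F dot ξ z) * (f x * f z))))
      ≡⟨ cong (q̂ *_) (trans (∑-swap _) (∑-cong (λ x → trans (∑-swap _) (∑-cong (λ z → ∑-*ʳ (f x * f z) _))))) ⟩
    q̂ * ∑ (λ x → ∑ (λ z → ∑ (λ ξ → ind (dot ξ x ≟F dot ξ z)) * (f x * f z)))
      ≡⟨ trans (sym (∑-*ˡ q̂ _)) (∑-cong (λ x → trans (sym (∑-*ˡ q̂ _)) (∑-cong (λ z → trans (sym (*-assoc q̂ _ _))
           (trans (cong (_* (f x * f z)) (collisions x z))
             (solve 5 (λ n c i a b → (n :+ c :* i) :* (a :* b) := n :* a :* b :+ c :* a :* (i :* b)) refl N ((q̂ - 1ℚ) * N) (ind (z ≟G x)) (f x) (f z))))))) ⟩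
    ∑ (λ x → ∑ (λ z → N * f x * f z + (q̂ - 1ℚ) * N * f x * (ind (z ≟G x) * f z)))
      ≡⟨ ∑-cong (λ x → trans (∑-+ _ _) (cong₂ _+_ (trans (∑-*ˡ _ f) (trans (cong (N * f x *_) ∑f≡0) (zeroʳ _)))
           (trans (∑-*ˡ _ _) (cong ((q̂ - 1ℚ) * N * f x *_) (∑-δ f x))))) ⟩
    ∑ (λ x → 0ℚ + (q̂ - 1ℚ) * N * f x * f x)
      ≡⟨ trans (∑-cong (λ x → trans (+-identityˡ _) (*-assoc _ (f x) (f x)))) (∑-*ˡ _ _) ⟩
    (q̂ - 1ℚ) * N * ∑ (λ x → f x * f x) ∎
    where open ≡-Reasoning

  module Convolution (T : G → ℚ) (0≤T : ∀ t → 0ℚ ≤ T t) (T≤1 : ∀ t → T t ≤ 1ℚ) (0<|T| : 0ℚ < ∑ T) where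
    open Spectrum T 0≤T T≤1 0<|T| hiding (SumK)

    conv : (G → ℚ) → G → ℚ
    conv f x = ∑ (λ t → T t * f (x ⊟ᵥ t))

    fibre-conv : ∀ f ξ y → fibre (conv f) ξ y ≡ SumK (λ c → law ξ c * fibre f ξ (y ⊞ ⊟ c))
    fibre-conv f ξ y = begin
      ∑ (λ x → ind (y ≟F dot ξ x) * ∑ (λ t → T t * f (x ⊟ᵥ t)))
        ≡⟨ trans (∑-cong (λ x → sym (∑-*ˡ _ _))) (∑-swap _) ⟩
      ∑ (λ t → ∑ (λ x → ind (y ≟F dot ξ x) * (T t * f (x ⊟ᵥ t))))
        ≡⟨ ∑-cong (λ t → trans (sym (∑-shiftʳ t _)) (trans (∑-cong (λ x → trans
             (cong₂ (λ i z → i * (T t * f z)) (shifted t x) (⊞ᵥ-⊟ᵥ x t))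
             (solve 3 (λ i t f → i :* (t :* f) := t :* (i :* f)) refl (ind ((y ⊞ ⊟ dot ξ t) ≟F dot ξ x)) (T t) (f x)))) (∑-*ˡ (T t) _))) ⟩
      ∑ (λ t → T t * fibre f ξ (y ⊞ ⊟ dot ξ t))
        ≡⟨ sym (Sum-law ξ (λ c → fibre f ξ (y ⊞ ⊟ c))) ⟩
      SumK (λ c → law ξ c * fibre f ξ (y ⊞ ⊟ c)) ∎
      where
      open ≡-Reasoning
      shifted : ∀ t x → ind (y ≟F dot ξ (x ⊞ᵥ t)) ≡ ind ((y ⊞ ⊟ dot ξ t) ≟F dot ξ x)
      shifted t x = ind-cong (y ≟F dot ξ (x ⊞ᵥ t)) ((y ⊞ ⊟ dot ξ t) ≟F dot ξ x)
        (λ p → proj₁ (⊟-cancel-iff _ _ _) (trans p (dot-⊞ ξ x t)))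
        (λ p → trans (proj₂ (⊟-cancel-iff _ _ _) p) (sym (dot-⊞ ξ x t)))

    -- The fibre of f has sum 0, so convolving it with q times the law equals convolving it with
    -- `deviation`. Young's inequality for L¹ and L², obtained from Cauchy-Schwarz, gives the factor
    -- `variation`, which is at most q |T| / 2.
    fibre-contraction : ∀ f → ∑ f ≡ 0ℚ → ∀ ξ → ¬ Biased ξ →
      4ℚ * SumK (λ y → fibre (conv f) ξ y * fibre (conv f) ξ y) ≤ |T| * |T| * SumK (λ y → fibre f ξ y * fibre f ξ y)
    fibre-contraction f ∑f≡0 ξ unbiased = *-cancelʳ (q̂ * q̂) (0<* 0<q̂ 0<q̂) (begin
      4ℚ * SumK (λ y → A y * A y) * (q̂ * q̂)
        ≡⟨ trans (*-assoc 4ℚ _ _) (cong (4ℚ *_) (trans (sym (Sum-*ʳ elements _ _)) (Sum-cong elements (λ y → solve 2 (λ a q → a :* a :* (q :* q) := (q :* a) :* (q :* a)) refl (A y) q̂)))) ⟩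
      4ℚ * SumK (λ y → q̂ * A y * (q̂ * A y))
        ≤⟨ *-monoˡ 4ℚ (<⇒≤ 0<4) (Sum-mono elements bound) ⟩
      4ℚ * SumK (λ y → variation ξ * SumK (λ c → dev c * (H y c * H y c)))
        ≡⟨ cong (4ℚ *_) (trans (Sum-*ˡ elements _ _) (cong (variation ξ *_) (trans (Sum-swap elements elements _) (trans (Sum-cong elements (λ c →
             trans (Sum-*ˡ elements (dev c) _) (cong (dev c *_) (SumK-unshift c (λ y → fibre f ξ y * fibre f ξ y))))) (Sum-*ʳ elements B dev))))) ⟩
      4ℚ * (variation ξ * (variation ξ * B))
        ≡⟨ solve 2 (λ v b → con 4ℚ :* (v :* (v :* b)) := (con 2ℚ :* v) :* (con 2ℚ :* v) :* b) refl (variation ξ) B ⟩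
      2ℚ * variation ξ * (2ℚ * variation ξ) * B
        ≤⟨ *-monoʳ B (0≤Sum elements (λ y → 0≤sq _)) (*-mono (0≤* 0≤2 0≤variation) (0≤* (<⇒≤ 0<q̂) (<⇒≤ 0<|T|)) (≮⇒≥ unbiased) (≮⇒≥ unbiased)) ⟩
      q̂ * |T| * (q̂ * |T|) * B
        ≡⟨ solve 3 (λ q t b → q :* t :* (q :* t) :* b := t :* t :* b :* (q :* q)) refl q̂ |T| B ⟩
      |T| * |T| * B * (q̂ * q̂) ∎)
      where
      open ℚₚ.≤-Reasoning
      A = fibre (conv f) ξ
      B = SumK (λ y → fibre f ξ y * fibre f ξ y)
      dev : K → ℚ
      dev c = ∥ deviation ξ c ∥
      H : K → K → ℚ
      H y c = fibre f ξ (y ⊞ ⊟ c)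
      0≤variation : 0ℚ ≤ variation ξ
      0≤variation = 0≤Sum elements (λ c → 0≤∣∣ _)
      qA : ∀ y → q̂ * A y ≡ SumK (λ c → deviation ξ c * H y c)
      qA y = trans (cong (q̂ *_) (fibre-conv f ξ y)) (sym (trans
        (Sum-cong elements (λ c → solve 4 (λ q l t h → (q :* l :- t) :* h := q :* (l :* h) :- t :* h) refl q̂ (law ξ c) |T| (H y c)))
        (trans (Sum-- elements _ _) (trans (cong₂ _-_ (Sum-*ˡ elements q̂ _)
          (trans (Sum-*ˡ elements |T| _) (cong (|T| *_) (trans (SumK-reflect y (fibre f ξ)) (trans (Sum-fibre f ξ) ∑f≡0)))))
          (solve 2 (λ a t → a :- t :* con 0ℚ := a) refl _ |T|)))))
      bound : ∀ y → q̂ * A y * (q̂ * A y) ≤ variation ξ * SumK (λ c → dev c * (H y c * H y c))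
      bound y = ≤-trans (≤-respˡ (trans (∣∣² _) (sym (cong (λ z → z * z) (qA y)))) (*-mono (0≤∣∣ S) (0≤Sum elements (λ c → 0≤* (0≤∣∣ _) (0≤∣∣ _))) ∣S∣≤ ∣S∣≤))
        (≤-respʳ (cong (variation ξ *_) (Sum-cong elements (λ c → cong (dev c *_) (∣∣² (H y c)))))
          (cauchy-schwarz₁ elements dev (λ c → ∥ H y c ∥) (λ c → 0≤∣∣ _)))
        where
        S = SumK (λ c → deviation ξ c * H y c)
        ∣S∣≤ : ∥ S ∥ ≤ SumK (λ c → dev c * ∥ H y c ∥)
        ∣S∣≤ = ≤-respʳ (Sum-cong elements (λ c → ∣*∣ _ _)) (∣Sum∣≤ elements _)

    module Quotient (V : Subspace) (complete : Complete V) where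
      |V| : ℚ
      |V| = ∑ (1V V)

      0<|V| : 0ℚ < |V|
      0<|V| = 0<∑1V V

      average : (G → ℚ) → G → ℚ
      average f x = inv |V| * ∑ (λ v → 1V V v * f (x ⊟ᵥ v))

      Null : (G → ℚ) → Set
      Null f = ∀ x → ∑ (λ v → 1V V v * f (x ⊟ᵥ v)) ≡ 0ℚ

      Null⇒∑≡0 : ∀ f → Null f → ∑ f ≡ 0ℚ
      Null⇒∑≡0 f null = *-≡0 0<|V| (trans (sym (∑-*ʳ (∑ f) _)) (trans (∑-cong (λ v → trans (cong (1V V v *_) (sym (∑-unshift v f))) (sym (∑-*ˡ (1V V v) _))))
        (trans (∑-swap _) (trans (∑-cong null) (Sum-0 elemsG)))))

      -- If ξ vanishes on V, its fibres are unions of cosets of V, and f sums to 0 over each coset.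
      Null⇒fibre≡0 : ∀ f → Null f → ∀ ξ → (∀ v → mem V v ≡ true → dot ξ v ≡ 0#) → ∀ y → fibre f ξ y ≡ 0ℚ
      Null⇒fibre≡0 f null ξ ⊥V y = *-≡0 0<|V| (begin
        |V| * fibre f ξ y
          ≡⟨ sym (∑-*ʳ (fibre f ξ y) _) ⟩
        ∑ (λ v → 1V V v * fibre f ξ y)
          ≡⟨ ∑-cong (λ v → trans (cong (1V V v *_) (sym (∑-unshift v _))) (1V-cong V v (λ v∈V → ∑-cong (λ x → cong (λ z → ind (y ≟F z) * f (x ⊟ᵥ v)) (invariant x v v∈V))))) ⟩
        ∑ (λ v → 1V V v * ∑ (λ x → ind (y ≟F dot ξ x) * f (x ⊟ᵥ v)))
          ≡⟨ trans (∑-cong (λ v → sym (∑-*ˡ (1V V v) _))) (∑-swap _) ⟩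
        ∑ (λ x → ∑ (λ v → 1V V v * (ind (y ≟F dot ξ x) * f (x ⊟ᵥ v))))
          ≡⟨ ∑-cong (λ x → trans (∑-cong (λ v → solve 3 (λ a b c → a :* (b :* c) := b :* (a :* c)) refl (1V V v) (ind (y ≟F dot ξ x)) (f (x ⊟ᵥ v))))
               (trans (∑-*ˡ _ _) (trans (cong (ind (y ≟F dot ξ x) *_) (null x)) (zeroʳ _)))) ⟩
        ∑ (λ x → 0ℚ)
          ≡⟨ Sum-0 elemsG ⟩
        0ℚ ∎)
        where
        open ≡-Reasoning
        invariant : ∀ x v → mem V v ≡ true → dot ξ (x ⊟ᵥ v) ≡ dot ξ x
        invariant x v v∈V = sym (trans (cong (dot ξ) (sym (⊟ᵥ-⊞ᵥ x v))) (trans (dot-⊞ ξ (x ⊟ᵥ v) v) (trans (cong (dot ξ (x ⊟ᵥ v) ⊞_) (⊥V v v∈V)) (⊞-identityʳ _))))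

      ∑-conv : ∀ f → ∑ (conv f) ≡ |T| * ∑ f
      ∑-conv f = trans (∑-swap _) (trans (∑-cong (λ t → trans (∑-*ˡ (T t) _) (cong (T t *_) (∑-unshift t f)))) (∑-*ʳ (∑ f) T))

      -- By `parseval` the comparison is made separately for each ξ: unbiased ones contract, and the
      -- others vanish on V, so that their fibres are 0.
      contraction : ∀ f → Null f → 4ℚ * ∑ (λ x → conv f x * conv f x) ≤ |T| * |T| * ∑ (λ x → f x * f x)
      contraction f null = *-cancelʳ ((q̂ - 1ℚ) * N) (0<* (0<b-a 1<q̂) 0<N) (begin
        4ℚ * ∑ (λ x → conv f x * conv f x) * c
          ≡⟨ trans (solve 3 (λ a b c → a :* b :* c := a :* (c :* b)) refl 4ℚ (∑ (λ x → conv f x * conv f x)) c) (cong (4ℚ *_) (sym (parseval (conv f) (trans (∑-conv f) (trans (cong (|T| *_) ∑f≡0) (zeroʳ |T|)))))) ⟩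
        4ℚ * (q̂ * ∑ (λ ξ → SumK (λ y → fibre (conv f) ξ y * fibre (conv f) ξ y)))
          ≡⟨ trans (solve 3 (λ a b c → a :* (b :* c) := b :* (a :* c)) refl 4ℚ q̂ _) (cong (q̂ *_) (sym (∑-*ˡ 4ℚ _))) ⟩
        q̂ * ∑ (λ ξ → 4ℚ * SumK (λ y → fibre (conv f) ξ y * fibre (conv f) ξ y))
          ≤⟨ *-monoˡ q̂ (<⇒≤ 0<q̂) (∑-mono (λ ξ → each ξ (complete ξ))) ⟩
        q̂ * ∑ (λ ξ → |T| * |T| * SumK (λ y → fibre f ξ y * fibre f ξ y))
          ≡⟨ trans (cong (q̂ *_) (∑-*ˡ (|T| * |T|) _)) (solve 3 (λ a b c → a :* (b :* c) := b :* (a :* c)) refl q̂ (|T| * |T|) _) ⟩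
        |T| * |T| * (q̂ * ∑ (λ ξ → SumK (λ y → fibre f ξ y * fibre f ξ y)))
          ≡⟨ trans (cong (|T| * |T| *_) (parseval f ∑f≡0)) (solve 3 (λ a b c → a :* (c :* b) := a :* b :* c) refl (|T| * |T|) (∑ (λ x → f x * f x)) c) ⟩
        |T| * |T| * ∑ (λ x → f x * f x) * c ∎)
        where
        open ℚₚ.≤-Reasoning
        c = (q̂ - 1ℚ) * N
        ∑f≡0 = Null⇒∑≡0 f null
        each : ∀ ξ → (¬ Biased ξ) ⊎ (∀ v → mem V v ≡ true → dot ξ v ≡ 0#) →
          4ℚ * SumK (λ y → fibre (conv f) ξ y * fibre (conv f) ξ y) ≤ |T| * |T| * SumK (λ y → fibre f ξ y * fibre f ξ y)
        each ξ (inj₁ unbiased) = fibre-contraction f ∑f≡0 ξ unbiased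
        each ξ (inj₂ ⊥V) = ≤-respˡ (sym (trans (cong (4ℚ *_) (trans (Sum-cong elements (λ y → trans (cong (λ z → z * z) (vanish y)) (zeroˡ 0ℚ))) (Sum-0 elements))) (zeroʳ 4ℚ)))
          (0≤* (0≤sq |T|) (0≤Sum elements (λ y → 0≤sq _)))
          where
          vanish : ∀ y → fibre (conv f) ξ y ≡ 0ℚ
          vanish y = trans (fibre-conv f ξ y) (trans (Sum-cong elements (λ c → trans (cong (law ξ c *_) (Null⇒fibre≡0 f null ξ ⊥V _)) (zeroʳ _))) (Sum-0 elements))

      step : (G → ℚ) → G → ℚ
      step f x = inv |T| * conv f x

      0≤inv|T| : 0ℚ ≤ inv |T|
      0≤inv|T| = 0≤inv 0<|T|

      0≤step : ∀ {f} → (∀ x → 0ℚ ≤ f x) → ∀ x → 0ℚ ≤ step f x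
      0≤step h x = 0≤* 0≤inv|T| (0≤∑ (λ t → 0≤* (0≤T t) (h _)))

      step≤1 : ∀ {f} → (∀ x → f x ≤ 1ℚ) → ∀ x → step f x ≤ 1ℚ
      step≤1 h x = ≤-respʳ (trans (*-comm _ _) (inv-* 0<|T|)) (*-monoˡ (inv |T|) 0≤inv|T|
        (∑-mono (λ t → ≤-respʳ (*-identityʳ (T t)) (*-monoˡ (T t) (0≤T t) (h _)))))

      ∑-step : ∀ f → ∑ (step f) ≡ ∑ f
      ∑-step f = trans (∑-*ˡ (inv |T|) _) (trans (cong (inv |T| *_) (∑-conv f)) (trans (sym (*-assoc _ _ _)) (trans (cong (_* ∑ f) (trans (*-comm _ _) (inv-* 0<|T|))) (*-identityˡ _))))

      0≤average : ∀ {f} → (∀ x → 0ℚ ≤ f x) → ∀ x → 0ℚ ≤ average f x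
      0≤average h x = 0≤* (0≤inv 0<|V|) (0≤∑ (λ v → 0≤* (0≤1V V v) (h _)))

      average≤1 : ∀ {f} → (∀ x → f x ≤ 1ℚ) → ∀ x → average f x ≤ 1ℚ
      average≤1 h x = ≤-respʳ (trans (*-comm _ _) (inv-* 0<|V|)) (*-monoˡ (inv |V|) (0≤inv 0<|V|)
        (∑-mono (λ v → ≤-respʳ (*-identityʳ (1V V v)) (*-monoˡ (1V V v) (0≤1V V v) (h _)))))

      ∑-average : ∀ f → ∑ (average f) ≡ ∑ f
      ∑-average f = trans (∑-*ˡ (inv |V|) _) (trans (cong (inv |V| *_) (trans (∑-swap _)
          (trans (∑-cong (λ v → trans (∑-*ˡ (1V V v) _) (cong (1V V v *_) (∑-unshift v f)))) (∑-*ʳ (∑ f) _))))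
        (trans (sym (*-assoc _ _ _)) (trans (cong (_* ∑ f) (trans (*-comm _ _) (inv-* 0<|V|))) (*-identityˡ _))))

      average-invariant : ∀ f x v → mem V v ≡ true → average f (x ⊟ᵥ v) ≡ average f x
      average-invariant f x v v∈V = cong (inv |V| *_) (trans (∑-cong (λ u → cong₂ _*_
          (cong (λ b → if b then 1ℚ else 0ℚ) (sym (trans (cong (mem V) (⊞ᵥ-comm v u)) (mem-shift V u v v∈V)))) (cong f (⊟ᵥ-⊟ᵥ x v u))))
        (∑-shiftˡ v (λ u → 1V V u * f (x ⊟ᵥ u))))

      fluctuation : (G → ℚ) → G → ℚ
      fluctuation f x = f x - average f x

      fluctuation-null : ∀ f → Null (fluctuation f)
      fluctuation-null f x = begin
        ∑ (λ v → 1V V v * (f (x ⊟ᵥ v) - average f (x ⊟ᵥ v)))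
          ≡⟨ ∑-cong (λ v → trans (1V-cong V v (λ v∈V → cong (λ z → f (x ⊟ᵥ v) - z) (average-invariant f x v v∈V)))
               (solve 3 (λ a b c → a :* (b :- c) := a :* b :- a :* c) refl (1V V v) (f (x ⊟ᵥ v)) (average f x))) ⟩
        ∑ (λ v → 1V V v * f (x ⊟ᵥ v) - 1V V v * average f x)
          ≡⟨ trans (∑-- _ _) (cong (λ z → S - z) (∑-*ʳ (average f x) _)) ⟩
        S - |V| * (inv |V| * S)
          ≡⟨ trans (cong (λ z → S - z) (trans (sym (*-assoc |V| _ _)) (trans (cong (_* S) (inv-* 0<|V|)) (*-identityˡ S)))) (+-inverseʳ S) ⟩
        0ℚ ∎
        where
        open ≡-Reasoning
        S = ∑ (λ v → 1V V v * f (x ⊟ᵥ v))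

      average-step : ∀ f x → average (step f) x ≡ step (average f) x
      average-step f x = trans (cong (inv |V| *_) (trans (∑-cong (λ v → trans (solve 3 (λ a b c → a :* (b :* c) := b :* (a :* c)) refl (1V V v) (inv |T|) _)
            (cong (inv |T| *_) (sym (∑-*ˡ (1V V v) _))))) (trans (∑-*ˡ (inv |T|) _) (cong (inv |T| *_) (∑-swap _)))))
        (trans (solve 3 (λ a b c → a :* (b :* c) := b :* (a :* c)) refl (inv |V|) (inv |T|) _) (cong (inv |T| *_) (trans (sym (∑-*ˡ (inv |V|) _)) (∑-cong (λ t →
          trans (cong (inv |V| *_) (trans (∑-cong (λ v → trans (cong (λ z → 1V V v * (T t * f z)) (exchange x v t))
              (solve 3 (λ a b c → a :* (b :* c) := b :* (a :* c)) refl (1V V v) (T t) _))) (∑-*ˡ (T t) _)))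
            (solve 3 (λ a b c → a :* (b :* c) := b :* (a :* c)) refl (inv |V|) (T t) _))))))
        where
        exchange : ∀ (x v t : G) → x ⊟ᵥ v ⊟ᵥ t ≡ x ⊟ᵥ t ⊟ᵥ v
        exchange x v t = trans (⊟ᵥ-⊟ᵥ x v t) (trans (cong (x ⊟ᵥ_) (⊞ᵥ-comm v t)) (sym (⊟ᵥ-⊟ᵥ x t v)))

      fluctuation-step : ∀ f x → fluctuation (step f) x ≡ step (fluctuation f) x
      fluctuation-step f x = trans (cong (λ z → step f x - z) (average-step f x)) (sym (trans
        (cong (inv |T| *_) (trans (∑-cong (λ t → solve 3 (λ a b c → a :* (b :- c) := a :* b :- a :* c) refl (T t) _ _)) (∑-- _ _)))
        (solve 3 (λ a b c → a :* (b :- c) := a :* b :- a :* c) refl (inv |T|) (conv f x) (conv (average f) x))))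

      iterate : ℕ → (G → ℚ) → G → ℚ
      iterate zero f = f
      iterate (suc k) f = step (iterate k f)

      energy₂ : (G → ℚ) → ℚ
      energy₂ f = ∑ (λ x → f x * f x)

      step-contraction : ∀ f → Null f → 4ℚ * energy₂ (step f) ≤ energy₂ f
      step-contraction f null = *-cancelʳ (|T| * |T|) (0<* 0<|T| 0<|T|) (subst₂ _≤_ eq (*-comm _ _) (contraction f null))
        where
        eq : 4ℚ * ∑ (λ x → conv f x * conv f x) ≡ 4ℚ * energy₂ (step f) * (|T| * |T|)
        eq = trans (cong (4ℚ *_) (trans (∑-cong (λ x → sym (trans
            (solve 3 (λ i c t → i :* c :* (i :* c) :* (t :* t) := t :* i :* (t :* i) :* (c :* c)) refl (inv |T|) (conv f x) |T|)
            (trans (cong (λ z → z * z * (conv f x * conv f x)) (inv-* 0<|T|)) (trans (cong (_* (conv f x * conv f x)) (*-identityˡ 1ℚ)) (*-identityˡ _))))))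
          (∑-*ʳ (|T| * |T|) _))) (sym (*-assoc 4ℚ _ _))

      -- Averaging over V commutes with `step`, so the fluctuation evolves by `step` alone and
      -- remains null at every stage.
      fluctuation-decay : ∀ k f → 4ℚ ^ k * energy₂ (fluctuation (iterate k f)) ≤ energy₂ (fluctuation f)
      fluctuation-decay zero f = ≤-reflexive (*-identityˡ _)
      fluctuation-decay (suc k) f = ≤-trans (≤-respˡ (trans (cong (λ z → 4ℚ ^ k * (4ℚ * z)) (∑-cong (λ x → cong (λ z → z * z) (sym (fluctuation-step (iterate k f) x)))))
          (solve 3 (λ a b c → a :* (b :* c) := b :* a :* c) refl (4ℚ ^ k) 4ℚ _))
        (*-monoˡ (4ℚ ^ k) (0≤^ k (<⇒≤ 0<4)) (step-contraction (fluctuation (iterate k f)) (fluctuation-null (iterate k f))))) (fluctuation-decay k f)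

      0≤iterate : ∀ k {f} → (∀ x → 0ℚ ≤ f x) → ∀ x → 0ℚ ≤ iterate k f x
      0≤iterate zero h = h
      0≤iterate (suc k) h = 0≤step (0≤iterate k h)

      iterate≤1 : ∀ k {f} → (∀ x → f x ≤ 1ℚ) → ∀ x → iterate k f x ≤ 1ℚ
      iterate≤1 zero h = h
      iterate≤1 (suc k) h = step≤1 (iterate≤1 k h)

      ∑-iterate : ∀ k f → ∑ (iterate k f) ≡ ∑ f
      ∑-iterate zero f = refl
      ∑-iterate (suc k) f = trans (∑-step (iterate k f)) (∑-iterate k f)

      energy₂-fluctuation : ∀ f → (∀ x → 0ℚ ≤ f x) → (∀ x → f x ≤ 1ℚ) → energy₂ (fluctuation f) ≤ 2ℚ * ∑ f
      energy₂-fluctuation f 0≤f f≤1 = ≤-respʳ (trans (∑-+ f (average f)) (trans (cong (∑ f +_) (∑-average f)) (solve 1 (λ s → s :+ s := con 2ℚ :* s) refl (∑ f))))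
        (∑-mono (λ x → ≤-by (f x * (1ℚ - f x) + average f x * (1ℚ - average f x) + 2ℚ * (f x * average f x))
          (0≤+ (0≤+ (0≤* (0≤f x) (0≤b-a (f≤1 x))) (0≤* (0≤average 0≤f x) (0≤b-a (average≤1 f≤1 x)))) (0≤* 0≤2 (0≤* (0≤f x) (0≤average 0≤f x))))
          (solve 2 (λ a b → (a :- b) :* (a :- b) :+ (a :* (con 1ℚ :- a) :+ b :* (con 1ℚ :- b) :+ con 2ℚ :* (a :* b)) := a :+ b) refl (f x) (average f x))))

      ∑-step-g : ∀ (f g : G → ℚ) → ∑ (λ x → step f x * g x) ≡ inv |T| * ∑ (λ t → T t * ∑ (λ x → f x * g (x ⊞ᵥ t)))
      ∑-step-g f g = trans (∑-cong (λ x → trans (*-assoc _ _ _) (cong (inv |T| *_) (sym (∑-*ʳ (g x) _))))) (trans (∑-*ˡ (inv |T|) _)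
        (cong (inv |T| *_) (trans (∑-swap _) (∑-cong (λ t → trans (sym (∑-shiftʳ t _)) (trans
          (∑-cong (λ x → trans (cong (λ z → T t * f z * g (x ⊞ᵥ t)) (⊞ᵥ-⊟ᵥ x t)) (*-assoc _ _ _))) (∑-*ˡ (T t) _)))))))

      -- There are two losses. Each of the k convolutions with T lowers the pairing with g by at
      -- most Δ. Averaging the result over V then discards a fluctuation of energy at most 4^(-k) 2
      -- ∑ w, whose pairing with g is at most η ∑ w by Cauchy-Schwarz and the hypothesis on k.
      smoothing : ∀ (w g : G → ℚ) → (∀ x → 0ℚ ≤ w x) → (∀ x → w x ≤ 1ℚ) → 0ℚ < ∑ w →
        (∀ x → 0ℚ ≤ g x) → (∀ x → g x ≤ 1ℚ) → ∀ Δ →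
        (∀ (v : G → ℚ) → (∀ x → 0ℚ ≤ v x) → (∀ x → v x ≤ 1ℚ) → ∑ v ≡ ∑ w → ∀ t → T t * (∑ (λ x → v x * g x) - ∑ (λ x → v x * g (x ⊞ᵥ t))) ≤ T t * Δ) →
        ∀ η → 0ℚ ≤ η → ∀ k → 2ℚ * N ≤ 4ℚ ^ k * (η * η) * ∑ w →
        ∑ (λ x → w x * g x) ≤ ∑ (λ x → average (iterate k w) x * g x) + ι k * Δ + η * ∑ w
      smoothing w g 0≤w w≤1 0<b 0≤g g≤1 Δ invariance η 0≤η k large = ≤-trans (drift k) (≤-by (η * b - F) (0≤b-a F≤)
          (trans (cong (λ z → z + ι k * Δ + (η * b - F)) split) (solve 4 (λ f a k e → f :+ a :+ k :+ (e :- f) := a :+ k :+ e) refl F _ (ι k * Δ) (η * b))))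
        where
        b = ∑ w
        D : ℕ → ℚ
        D j = ∑ (λ x → iterate j w x * g x)
        F = ∑ (λ x → fluctuation (iterate k w) x * g x)
        split : D k ≡ F + ∑ (λ x → average (iterate k w) x * g x)
        split = trans (∑-cong (λ x → solve 3 (λ f a g → f :* g := (f :- a) :* g :+ a :* g) refl (iterate k w x) (average (iterate k w) x) (g x))) (∑-+ _ _)
        one-step : ∀ j → D j ≤ D (suc j) + Δ
        one-step j = *-cancelʳ |T| 0<|T| (≤-by (|T| * Δ - (D j * |T| - X)) (0≤b-a bound)
            (trans (solve 4 (λ d t c x → d :* t :+ (t :* c :- (d :* t :- x)) := x :+ c :* t) refl (D j) |T| Δ X)
              (trans (cong (_+ Δ * |T|) (sym (trans (cong (_* |T|) (∑-step-g (iterate j w) g)) (trans (solve 3 (λ i x t → i :* x :* t := t :* i :* x) refl (inv |T|) X |T|) (trans (cong (_* X) (inv-* 0<|T|)) (*-identityˡ X))))))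
                (sym (distribʳ |T| (D (suc j)) Δ)))))
          where
          X = ∑ (λ t → T t * ∑ (λ x → iterate j w x * g (x ⊞ᵥ t)))
          bound : D j * |T| - X ≤ |T| * Δ
          bound = subst₂ _≤_ (trans (∑-cong (λ t → solve 3 (λ t d x → t :* (d :- x) := d :* t :- t :* x) refl (T t) (D j) _)) (trans (∑-- _ _) (cong (_- X) (∑-*ˡ (D j) T))))
            (∑-*ʳ Δ T) (∑-mono (invariance (iterate j w) (0≤iterate j 0≤w) (iterate≤1 j w≤1) (∑-iterate j w)))
        drift : ∀ j → D 0 ≤ D j + ι j * Δ
        drift zero = ≤-reflexive (sym (trans (cong (λ z → D 0 + z * Δ) ι0) (trans (cong (D 0 +_) (zeroˡ Δ)) (+-identityʳ _))))
        drift (suc j) = ≤-trans (drift j) (≤-respʳ (trans (solve 3 (λ d c j → d :+ c :+ j :* c := d :+ (con 1ℚ :+ j) :* c) refl (D (suc j)) Δ (ι j)) (cong (λ z → D (suc j) + z * Δ) (sym (ι-suc j))))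
          (+-monoˡ-≤ (ι j * Δ) (one-step j)))
        energy-g : energy₂ g ≤ N
        energy-g = ≤-respʳ ∑-1 (∑-mono (λ x → ≤-respʳ (*-identityˡ 1ℚ) (*-mono (0≤g x) 0≤1 (g≤1 x) (g≤1 x))))
        F≤ : F ≤ η * b
        F≤ = sq-cancel (0≤* 0≤η (<⇒≤ 0<b)) (*-cancelʳ (4ℚ ^ k) (0<^ k 0<4) (begin
          F * F * 4ℚ ^ k
            ≤⟨ *-monoʳ (4ℚ ^ k) (0≤^ k (<⇒≤ 0<4)) (cauchy-schwarz₂ elemsG (fluctuation (iterate k w)) g) ⟩
          energy₂ (fluctuation (iterate k w)) * energy₂ g * 4ℚ ^ k
            ≡⟨ solve 3 (λ a b c → a :* b :* c := c :* a :* b) refl (energy₂ (fluctuation (iterate k w))) (energy₂ g) (4ℚ ^ k) ⟩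
          4ℚ ^ k * energy₂ (fluctuation (iterate k w)) * energy₂ g
            ≤⟨ *-mono (0≤* (0≤^ k (<⇒≤ 0<4)) (0≤∑ (λ x → 0≤sq _))) 0≤N (≤-trans (fluctuation-decay k w) (energy₂-fluctuation w 0≤w w≤1)) energy-g ⟩
          2ℚ * b * N
            ≡⟨ solve 2 (λ b n → con 2ℚ :* b :* n := con 2ℚ :* n :* b) refl b N ⟩
          2ℚ * N * b
            ≤⟨ *-monoʳ b (<⇒≤ 0<b) large ⟩
          4ℚ ^ k * (η * η) * b * b
            ≡⟨ solve 3 (λ p h b → p :* (h :* h) :* b :* b := h :* b :* (h :* b) :* p) refl (4ℚ ^ k) η b ⟩
          η * b * (η * b) * 4ℚ ^ k ∎))
          where open ℚₚ.≤-Reasoning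

      -- Substituting s + v for s moves the averaging over V from f to ψ.
      ∑∑-average : ∀ (f w ψ : G → ℚ) → ∑ (λ s → ∑ (λ t → average f s * w t * ψ (t ⊟ᵥ s))) ≡ ∑ (λ s → ∑ (λ t → f s * w t * average ψ (t ⊟ᵥ s)))
      ∑∑-average f w ψ = begin
        ∑ (λ s → ∑ (λ t → average f s * w t * ψ (t ⊟ᵥ s)))
          ≡⟨ ∑-cong (λ s → trans (∑-cong (λ t → *-assoc _ _ _)) (trans (∑-*ˡ (average f s) _)
               (trans (*-assoc (inv |V|) _ _) (cong (inv |V| *_) (sym (∑-*ʳ (P s) _)))))) ⟩
        ∑ (λ s → inv |V| * ∑ (λ v → 1V V v * f (s ⊟ᵥ v) * P s))
          ≡⟨ trans (∑-*ˡ (inv |V|) _) (cong (inv |V| *_) (∑-swap _)) ⟩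
        inv |V| * ∑ (λ v → ∑ (λ s → 1V V v * f (s ⊟ᵥ v) * P s))
          ≡⟨ cong (inv |V| *_) (∑-cong (λ v → trans (sym (∑-shiftʳ v _)) (∑-cong (λ s → cong (λ z → 1V V v * f z * P (s ⊞ᵥ v)) (⊞ᵥ-⊟ᵥ s v))))) ⟩
        inv |V| * ∑ (λ v → ∑ (λ s → 1V V v * f s * P (s ⊞ᵥ v)))
          ≡⟨ trans (cong (inv |V| *_) (∑-swap _)) (sym (∑-*ˡ (inv |V|) _)) ⟩
        ∑ (λ s → inv |V| * ∑ (λ v → 1V V v * f s * P (s ⊞ᵥ v)))
          ≡⟨ ∑-cong (λ s → trans (cong (inv |V| *_) (trans (∑-cong (λ v → sym (∑-*ˡ (1V V v * f s) _))) (∑-swap _)))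
               (trans (sym (∑-*ˡ (inv |V|) _)) (∑-cong (λ t → trans (cong (inv |V| *_) (trans (∑-cong (λ v →
                 trans (cong (λ z → 1V V v * f s * (w t * ψ z)) (sym (⊟ᵥ-⊟ᵥ t s v)))
                   (solve 4 (λ a b c d → a :* b :* (c :* d) := b :* c :* (a :* d)) refl (1V V v) (f s) (w t) _))) (∑-*ˡ (f s * w t) _)))
                 (solve 3 (λ a b c → a :* (b :* c) := b :* (a :* c)) refl (inv |V|) (f s * w t) _))))) ⟩
        ∑ (λ s → ∑ (λ t → f s * w t * average ψ (t ⊟ᵥ s))) ∎
        where
        open ≡-Reasoning
        P : G → ℚ
        P s = ∑ (λ t → w t * ψ (t ⊟ᵥ s))

-- Parameters and the density increment

1/400 1/32 : ℚ
1/400 = ℤ.+ 1 ℚ./ 400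
1/32 = ℤ.+ 1 ℚ./ 32

256ℚ : ℚ
256ℚ = ℤ.+ 256 ℚ./ 1

-- For d a power of two the parameters below are D = d², L = D l, k = D k₁, M = k² M₂ and
-- R = D (k₁ + l + n₃), so the codimension bound 257 (L M R + 3) is at most C₁ d⁸.
record Constants (ε : ℚ) : Set where
  η : ℚ
  η = ε * 1/400
  field
    m z n₁ M₂ n₃ : ℕ
    8≤mε : 8ℚ ≤ ι m * ε
    mε≤9 : ι m * ε ≤ 9ℚ
    2≤η2^z : 2ℚ ≤ η * 2ℚ ^ z
    2≤2^n₁η² : 2ℚ ≤ 2ℚ ^ suc n₁ * (η * η)
    256≤M₂η² : 256ℚ ≤ ι M₂ * (η * η)
    8≤η2^n₃ : 8ℚ ≤ η * 2ℚ ^ n₃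
  l k₁ C₁ : ℕ
  l = 2 ℕ.^ suc z ℕ.* m
  k₁ = l ℕ.+ suc n₁
  C₁ = 257 ℕ.* (l ℕ.* (k₁ ℕ.* k₁ ℕ.* M₂) ℕ.* (k₁ ℕ.+ l ℕ.+ n₃) ℕ.+ 3)

module Core (𝔽 : FiniteField) (n : ℕ) where
  open Space 𝔽 n
  open Gram 𝔽 n
  open Sifting 𝔽 n
  open Sampling 𝔽 n
  open Chang 𝔽 n
  open Smoothing 𝔽 n

  module Increment (ε : ℚ) (0<ε : 0ℚ < ε) (ε<1 : ε < 1ℚ) (constants : Constants ε)
    (a : G → G → ℚ) (0≤a : ∀ g x → 0ℚ ≤ a g x) (a≤1 : ∀ g x → a g x ≤ 1ℚ)
    (s : ℕ) (0<total : 0ℚ < ∑ (λ g → ∑ (a g))) (dense : N * N ≤ 2ℚ ^ (2 ℕ.^ s) * ∑ (λ g → ∑ (a g))) where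

    d : ℕ
    d = 2 ℕ.^ s

    open Constants constants
    open Density a 0≤a a≤1 d 0<total dense
    open Centred a using (mass)

    0≤η : 0ℚ ≤ η
    0≤η = 0≤* (<⇒≤ 0<ε) (nonNegative⁻¹ 1/400)

    0<η : 0ℚ < η
    0<η = 0<* 0<ε (positive⁻¹ 1/400)

    -- The sifted weight has density at least 2^(-L); k counts the convolutions with T; T arises
    -- from R groups of M samples and has density at least 2^(-Λ), where the final 2 pays for the
    -- factor 4 in the pigeonhole.
    D p r L k M R Λ : ℕ
    D = d ℕ.* d
    p = 2 ℕ.^ suc (s ℕ.+ z)
    r = p ℕ.* m
    L = d ℕ.* r
    k = D ℕ.* k₁
    M = k ℕ.* k ℕ.* M₂
    R = D ℕ.* (k₁ ℕ.+ l ℕ.+ n₃)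
    Λ = L ℕ.* M ℕ.* R ℕ.+ 2

    1≤D : 1 ℕ.≤ D
    1≤D = ℕₚ.*-mono-≤ (ℕₚ.m^n>0 2 s) (ℕₚ.m^n>0 2 s)

    L≡Dl : L ≡ D ℕ.* l
    L≡Dl = trans (cong (λ y → d ℕ.* (2 ℕ.* y ℕ.* m)) (ℕₚ.^-distribˡ-+-* 2 s z)) (lemma d (2 ℕ.^ z) m)
      where
      lemma : ∀ d y m → d ℕ.* (2 ℕ.* (d ℕ.* y) ℕ.* m) ≡ d ℕ.* d ℕ.* (2 ℕ.* y ℕ.* m)
      lemma = solve-∀

    n≤Dn : ∀ i → i ℕ.≤ D ℕ.* i
    n≤Dn i = ℕₚ.≤-trans (ℕₚ.≤-reflexive (sym (ℕₚ.*-identityˡ i))) (ℕₚ.*-monoˡ-≤ i 1≤D)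

    d≤p : d ℕ.≤ p
    d≤p = ℕₚ.^-monoʳ-≤ 2 (ℕₚ.m≤n⇒m≤1+n (ℕₚ.m≤m+n s z))

    z≤p : z ℕ.≤ p
    z≤p = ℕₚ.≤-trans (ℕₚ.<⇒≤ (ℕₚ.m<m+n z (ℕ.s≤s ℕ.z≤n))) (ℕₚ.≤-trans (ι-cancel-≤ (≤-respʳ (sym (trans (ι-^ 2 (z ℕ.+ 1)) (cong (_^ (z ℕ.+ 1)) (sym (ι-def 2))))) (ι≤2^ (z ℕ.+ 1))))
      (ℕₚ.^-monoʳ-≤ 2 (ℕₚ.≤-trans (ℕₚ.≤-reflexive (ℕₚ.+-comm z 1)) (ℕ.s≤s (ℕₚ.m≤n+m z s)))))

    2≤η2^p : 2ℚ ≤ η * 2ℚ ^ p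
    2≤η2^p = ≤-trans 2≤η2^z (*-monoˡ η 0≤η (^-monoʳ 1≤2 z≤p))

    0<k : 0 ℕ.< k
    0<k = ℕₚ.*-mono-≤ 1≤D (ℕₚ.≤-trans (ℕ.s≤s ℕ.z≤n) (ℕₚ.m≤n+m (suc n₁) l))

    0<ιk : 0ℚ < ι k
    0<ιk = subst (_< ι k) ι0 (ι-mono-< 0<k)

    0<4k : 0ℚ < 4ℚ * ι k
    0<4k = 0<* 0<4 0<ιk

    0<2^L : 0ℚ < 2ℚ ^ L
    0<2^L = 0<^ L 0<2

    -- Chosen to make the total drift kΔ = 2kζ b + 2kδ N at most η b: the first term equals η b / 2,
    -- and so does the bound that N ≤ 2^L b gives for the second.
    ζ δ : ℚ
    ζ = η * inv (4ℚ * ι k)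
    δ = ζ * inv (2ℚ ^ L)

    0<ζ : 0ℚ < ζ
    0<ζ = 0<* 0<η (0<inv 0<4k)

    0<δ : 0ℚ < δ
    0<δ = 0<* 0<ζ (0<inv 0<2^L)

    ζ4k : ζ * (4ℚ * ι k) ≡ η
    ζ4k = inv-cancelʳ η 0<4k

    δ2^L : δ * 2ℚ ^ L ≡ ζ
    δ2^L = inv-cancelʳ ζ 0<2^L

    -- The k² in M cancels the k² in the denominator of ζ², leaving M₂ η² / 16; hence the
    -- requirement 256 on M₂ η².
    16≤Mζ² : 16ℚ ≤ ι M * (ζ * ζ)
    16≤Mζ² = *-cancelʳ 16ℚ 0<16 (subst₂ _≤_ (solve 0 (con 256ℚ := con 16ℚ :* con 16ℚ) refl)
      (trans (cong (λ e → ι M₂ * (e * e)) (sym ζ4k)) (trans (solve 3 (λ m z k → m :* (z :* (con 4ℚ :* k) :* (z :* (con 4ℚ :* k))) := k :* k :* m :* (z :* z) :* con 16ℚ) refl (ι M₂) ζ (ι k))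
        (cong (λ i → i * (ζ * ζ) * 16ℚ) (sym (trans (ι-* (k ℕ.* k) M₂) (cong (_* ι M₂) (ι-* k k)))))))
      256≤M₂η²)

    -- Since δ = η / (4k 2^L) and k ≤ 2^k, it suffices that R is at least k + L + n₃.
    2≤δ2^R : 2ℚ ≤ δ * 2ℚ ^ R
    2≤δ2^R = *-cancelʳ (4ℚ * ι k * 2ℚ ^ L) (0<* 0<4k 0<2^L) (begin
      2ℚ * (4ℚ * ι k * 2ℚ ^ L) ≡⟨ solve 2 (λ k t → con 2ℚ :* (con 4ℚ :* k :* t) := con 8ℚ :* (k :* t)) refl (ι k) (2ℚ ^ L) ⟩
      8ℚ * (ι k * 2ℚ ^ L) ≤⟨ *-mono 0≤8 (0≤* (0≤^ k 0≤2) (<⇒≤ 0<2^L)) 8≤η2^n₃ (*-monoʳ (2ℚ ^ L) (<⇒≤ 0<2^L) (ι≤2^ k)) ⟩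
      η * 2ℚ ^ n₃ * (2ℚ ^ k * 2ℚ ^ L) ≡⟨ trans (solve 4 (λ e a b c → e :* a :* (b :* c) := e :* (b :* c :* a)) refl η (2ℚ ^ n₃) (2ℚ ^ k) (2ℚ ^ L))
                                        (cong (η *_) (trans (cong (_* 2ℚ ^ n₃) (sym (^-+ 2ℚ k L))) (sym (^-+ 2ℚ (k ℕ.+ L) n₃)))) ⟩
      η * 2ℚ ^ (k ℕ.+ L ℕ.+ n₃) ≤⟨ *-monoˡ η 0≤η (^-monoʳ 1≤2 exponent≤) ⟩
      η * 2ℚ ^ R ≡⟨ trans (cong (_* 2ℚ ^ R) (sym (trans (cong (_* (4ℚ * ι k)) δ2^L) ζ4k))) (solve 4 (λ d l k r → d :* l :* k :* r := d :* r :* (k :* l)) refl δ (2ℚ ^ L) (4ℚ * ι k) (2ℚ ^ R)) ⟩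
      δ * 2ℚ ^ R * (4ℚ * ι k * 2ℚ ^ L) ∎)
      where
      open ℚₚ.≤-Reasoning
      exponent≤ : k ℕ.+ L ℕ.+ n₃ ℕ.≤ R
      exponent≤ = ℕₚ.≤-trans (ℕₚ.+-mono-≤ (ℕₚ.≤-reflexive (cong (k ℕ.+_) L≡Dl)) (n≤Dn n₃)) (ℕₚ.≤-reflexive (distrib D k₁ l n₃))
        where
        distrib : ∀ D a b c → D ℕ.* a ℕ.+ D ℕ.* b ℕ.+ D ℕ.* c ≡ D ℕ.* (a ℕ.+ b ℕ.+ c)
        distrib = solve-∀

    -- The fluctuation energy decays like 4^(-k) and has to fall below the density 2^(-L) of the
    -- sifted weight. This fixes k to be of order L.
    2^L2≤4^kη² : 2ℚ ^ L * 2ℚ ≤ 4ℚ ^ k * (η * η)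
    2^L2≤4^kη² = begin
      2ℚ ^ L * 2ℚ ≤⟨ *-monoˡ (2ℚ ^ L) (<⇒≤ 0<2^L) 2≤2^n₁η² ⟩
      2ℚ ^ L * (2ℚ ^ suc n₁ * (η * η)) ≡⟨ trans (sym (*-assoc _ _ _)) (cong (_* (η * η)) (sym (^-+ 2ℚ L (suc n₁)))) ⟩
      2ℚ ^ (L ℕ.+ suc n₁) * (η * η) ≤⟨ *-monoʳ (η * η) (0≤sq η) (≤-trans (^-monoʳ 1≤2 L+n₁≤k) (^-mono k 0≤2 (≤-by 2ℚ 0≤2 (solve 0 (con 2ℚ :+ con 2ℚ := con 4ℚ) refl)))) ⟩
      4ℚ ^ k * (η * η) ∎
      where
      open ℚₚ.≤-Reasoning
      L+n₁≤k : L ℕ.+ suc n₁ ℕ.≤ k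
      L+n₁≤k = ℕₚ.≤-trans (ℕₚ.+-mono-≤ (ℕₚ.≤-reflexive L≡Dl) (n≤Dn (suc n₁))) (ℕₚ.≤-reflexive (sym (ℕₚ.*-distribˡ-+ D l (suc n₁))))

    codim-bound : 257 ℕ.* suc Λ ℕ.≤ C₁ ℕ.* d ℕ.^ 8
    codim-bound = ℕₚ.≤-trans (ℕₚ.*-monoʳ-≤ 257 (ℕₚ.≤-trans (ℕₚ.≤-reflexive (trans (cong (λ L → suc (L ℕ.* M ℕ.* R ℕ.+ 2)) L≡Dl) (expand D l k₁ M₂ (k₁ ℕ.+ l ℕ.+ n₃))))
        (ℕₚ.≤-trans (ℕₚ.+-monoʳ-≤ (Q ℕ.* E) (ℕₚ.≤-trans (ℕₚ.≤-reflexive (sym (ℕₚ.*-identityʳ 3))) (ℕₚ.*-monoʳ-≤ 3 1≤E))) (ℕₚ.≤-reflexive (sym (ℕₚ.*-distribʳ-+ E Q 3))))))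
      (ℕₚ.≤-reflexive (trans (sym (ℕₚ.*-assoc 257 (Q ℕ.+ 3) E)) (cong (C₁ ℕ.*_) (eighth d))))
      where
      Q = l ℕ.* (k₁ ℕ.* k₁ ℕ.* M₂) ℕ.* (k₁ ℕ.+ l ℕ.+ n₃)
      E = D ℕ.* D ℕ.* (D ℕ.* D)
      1≤E : 1 ℕ.≤ E
      1≤E = ℕₚ.*-mono-≤ (ℕₚ.*-mono-≤ 1≤D 1≤D) (ℕₚ.*-mono-≤ 1≤D 1≤D)
      expand : ∀ D l k₁ M₂ w → suc (D ℕ.* l ℕ.* (D ℕ.* k₁ ℕ.* (D ℕ.* k₁) ℕ.* M₂) ℕ.* (D ℕ.* w) ℕ.+ 2) ≡ l ℕ.* (k₁ ℕ.* k₁ ℕ.* M₂) ℕ.* w ℕ.* (D ℕ.* D ℕ.* (D ℕ.* D)) ℕ.+ 3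
      expand = solve-∀
      eighth : ∀ d → d ℕ.* d ℕ.* (d ℕ.* d) ℕ.* (d ℕ.* d ℕ.* (d ℕ.* d)) ≡ d ℕ.* (d ℕ.* (d ℕ.* (d ℕ.* (d ℕ.* (d ℕ.* (d ℕ.* (d ℕ.* 1)))))))
      eighth = solve-∀

    -- Quantifying over all upper bounds B of μ_F′ ∗ μ_V avoids choosing a point where it is
    -- largest; the sup norm is substituted for B at the end.
    increment : ε < ∥ ∑ (λ x → mass x * inv σ * ũ x) ∥ →
      ∃[ V ] ∃[ c ] (HasCodim V c × c ℕ.≤ C₁ ℕ.* d ℕ.^ 8 ×
        (∀ B → (∀ x → inv (∑ (1V V)) * ∑ (λ v → 1V V v * ψ (x ⊟ᵥ v)) ≤ B) → 1ℚ + ε * 1/32 ≤ B))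
    increment ε<X = V , c , codim , ℕₚ.≤-trans c≤ codim-bound , final
      where
      open Threshold ε 0<ε m 8≤mε mε≤9 η 0<η (s ℕ.+ z) d≤p 2≤η2^p ε<X using (sifted; χ; θ; 0≤θ)
      w : G → ℚ
      w = proj₁ sifted
      0≤w : ∀ x → 0ℚ ≤ w x
      0≤w = proj₁ (proj₂ sifted)
      w≤1 : ∀ x → w x ≤ 1ℚ
      w≤1 = proj₁ (proj₂ (proj₂ sifted))
      b : ℚ
      b = ∑ w
      N≤2^Lb : N ≤ 2ℚ ^ L * b
      N≤2^Lb = proj₁ (proj₂ (proj₂ (proj₂ sifted)))
      correlated : (1ℚ - η) * (b * b) ≤ ∑ (λ s → ∑ (λ t → w s * w t * χ (t ⊟ᵥ s)))
      correlated = proj₂ (proj₂ (proj₂ (proj₂ sifted)))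
      0<b : 0ℚ < b
      0<b = ≰⇒> (λ b≤0 → <-irrefl refl (<-≤-trans 0<N (≤-trans N≤2^Lb (≤-respʳ (zeroʳ _) (*-monoˡ (2ℚ ^ L) (<⇒≤ 0<2^L) b≤0)))))
      0≤χ : ∀ x → 0ℚ ≤ χ x
      0≤χ x = 0≤ind (θ ≤? ψ x)
      χ≤1 : ∀ x → χ x ≤ 1ℚ
      χ≤1 x = ind≤1 (θ ≤? ψ x)
      χθ≤ψ : ∀ x → χ x * θ ≤ ψ x
      χθ≤ψ x = go (θ ≤? ψ x)
        where
        go : (e : Dec (θ ≤ ψ x)) → ind e * θ ≤ ψ x
        go (yes q) = ≤-respˡ (sym (*-identityˡ θ)) q
        go (no _) = ≤-respˡ (sym (zeroˡ θ)) (0≤ψ x)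
      open Estimates w χ 0≤w w≤1 0≤χ χ≤1 0<b ζ 0<ζ M 16≤Mζ² using (g; 0≤g; g≤1; b*g; module Groups)
      open Groups R using (almost-periods; bK; NK; 0<bK)
      periods = almost-periods δ 0<δ 2≤δ2^R
      T : G → ℚ
      T = proj₁ periods
      0≤T : ∀ t → 0ℚ ≤ T t
      0≤T = proj₁ (proj₂ periods)
      T≤1 : ∀ t → T t ≤ 1ℚ
      T≤1 = proj₁ (proj₂ (proj₂ periods))
      many : N * bK < ∑ T * (4ℚ * NK)
      many = proj₁ (proj₂ (proj₂ (proj₂ periods)))
      0<4NK : 0ℚ < 4ℚ * NK
      0<4NK = 0<* 0<4 (0<^ R (0<^ M 0<N))
      0<|T| : 0ℚ < ∑ T
      0<|T| = ≰⇒> (λ q → <-irrefl refl (<-trans (0<* 0<N 0<bK) (<-≤-trans many (≤-respʳ (zeroˡ _) (*-monoʳ (4ℚ * NK) (<⇒≤ 0<4NK) q)))))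
      NK≤ : NK ≤ 2ℚ ^ (L ℕ.* M ℕ.* R) * bK
      NK≤ = ≤-respʳ (trans (cong (_^ R) (^-distrib (2ℚ ^ L) b M)) (trans (^-distrib ((2ℚ ^ L) ^ M) (b ^ M) R)
          (cong (_* bK) (trans (cong (_^ R) (sym (^-* 2ℚ L M))) (sym (^-* 2ℚ (L ℕ.* M) R))))))
        (^-mono R (0≤^ M 0≤N) (^-mono M 0≤N N≤2^Lb))
      T-dense : N ≤ 2ℚ ^ Λ * ∑ T
      T-dense = *-cancelʳ bK 0<bK (begin
        N * bK ≤⟨ <⇒≤ many ⟩
        ∑ T * (4ℚ * NK) ≤⟨ *-monoˡ (∑ T) (<⇒≤ 0<|T|) (*-monoˡ 4ℚ (<⇒≤ 0<4) NK≤) ⟩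
        ∑ T * (4ℚ * (2ℚ ^ (L ℕ.* M ℕ.* R) * bK)) ≡⟨ trans (solve 3 (λ t p b → t :* (con 4ℚ :* (p :* b)) := p :* (con 2ℚ :* (con 2ℚ :* con 1ℚ)) :* t :* b) refl (∑ T) (2ℚ ^ (L ℕ.* M ℕ.* R)) bK)
                                                        (cong (λ y → y * ∑ T * bK) (sym (^-+ 2ℚ (L ℕ.* M ℕ.* R) 2))) ⟩
        2ℚ ^ Λ * ∑ T * bK ∎)
        where open ℚₚ.≤-Reasoning
      open Spectrum T 0≤T T≤1 0<|T| using (chang; Complete)
      structure = chang Λ T-dense
      V : Subspace
      V = proj₁ structure
      c : ℕ
      c = proj₁ (proj₂ structure)
      codim : HasCodim V c
      codim = proj₁ (proj₂ (proj₂ structure))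
      c≤ : c ℕ.≤ 257 ℕ.* suc Λ
      c≤ = proj₁ (proj₂ (proj₂ (proj₂ structure)))
      V-complete : Complete V
      V-complete = proj₂ (proj₂ (proj₂ (proj₂ structure)))
      open Convolution T 0≤T T≤1 0<|T| using (module Quotient)
      open Quotient V V-complete using (average; iterate; smoothing; ∑∑-average; 0≤iterate; 0≤average; ∑-iterate)
      Δ : ℚ
      Δ = 2ℚ * ζ * b + 2ℚ * (δ * N)
      f : G → ℚ
      f = iterate k w
      smooth : ∑ (λ x → w x * g x) ≤ ∑ (λ x → average f x * g x) + ι k * Δ + η * b
      smooth = smoothing w g 0≤w w≤1 0<b 0≤g g≤1 Δ
        (λ v 0≤v v≤1 ∑v≡b t → subst (λ y → T t * (∑ (λ x → v x * g x) - ∑ (λ x → v x * g (x ⊞ᵥ t))) ≤ T t * (2ℚ * ζ * y + 2ℚ * (δ * N))) ∑v≡b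
          (proj₂ (proj₂ (proj₂ (proj₂ periods))) v 0≤v v≤1 t))
        η 0≤η k (begin
          2ℚ * N ≤⟨ *-monoˡ 2ℚ 0≤2 N≤2^Lb ⟩
          2ℚ * (2ℚ ^ L * b) ≡⟨ solve 2 (λ l b → con 2ℚ :* (l :* b) := l :* con 2ℚ :* b) refl (2ℚ ^ L) b ⟩
          2ℚ ^ L * 2ℚ * b ≤⟨ *-monoʳ b (<⇒≤ 0<b) 2^L2≤4^kη² ⟩
          4ℚ ^ k * (η * η) * b ∎)
        where open ℚₚ.≤-Reasoning
      kΔ≤ηb : ι k * Δ ≤ η * b
      kΔ≤ηb = *-cancelʳ 2ℚ 0<2 (begin
        ι k * Δ * 2ℚ ≡⟨ solve 5 (λ k z b d n → k :* (con 2ℚ :* z :* b :+ con 2ℚ :* (d :* n)) :* con 2ℚ := z :* (con 4ℚ :* k) :* b :+ d :* (con 4ℚ :* k) :* n) refl (ι k) ζ b δ N ⟩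
        ζ * (4ℚ * ι k) * b + δ * (4ℚ * ι k) * N ≤⟨ +-monoʳ-≤ (ζ * (4ℚ * ι k) * b) (*-monoˡ (δ * (4ℚ * ι k)) (0≤* (<⇒≤ 0<δ) (<⇒≤ 0<4k)) N≤2^Lb) ⟩
        ζ * (4ℚ * ι k) * b + δ * (4ℚ * ι k) * (2ℚ ^ L * b) ≡⟨ trans (solve 5 (λ z k d l b → z :* k :* b :+ d :* k :* (l :* b) := z :* k :* b :+ d :* l :* k :* b) refl ζ (4ℚ * ι k) δ (2ℚ ^ L) b)
                                                  (cong (λ y → ζ * (4ℚ * ι k) * b + y * (4ℚ * ι k) * b) δ2^L) ⟩
        ζ * (4ℚ * ι k) * b + ζ * (4ℚ * ι k) * b ≡⟨ trans (cong (λ y → y * b + y * b) ζ4k) (solve 2 (λ h b → h :* b :+ h :* b := h :* b :* con 2ℚ) refl η b) ⟩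
        η * b * 2ℚ ∎)
        where open ℚₚ.≤-Reasoning
      ∑∑-g : ∀ (h : G → ℚ) → ∑ (λ s → ∑ (λ t → h s * w t * χ (t ⊟ᵥ s))) ≡ b * ∑ (λ x → h x * g x)
      ∑∑-g h = trans (∑-cong (λ s → trans (trans (∑-cong (λ t → *-assoc _ _ _)) (∑-*ˡ (h s) _))
          (trans (cong (h s *_) (sym (b*g s))) (solve 3 (λ h b g → h :* (b :* g) := b :* (h :* g)) refl (h s) b (g s))))) (∑-*ˡ b _)
      A = ∑ (λ x → average f x * g x)
      -- The three losses of η come from the low differences left by sifting, from the drift kΔ, and
      -- from the discarded fluctuation.
      A-large : (1ℚ - (η + η + η)) * b ≤ A
      A-large = ≤-by ((∑ (λ x → w x * g x) - (1ℚ - η) * b) + (A + ι k * Δ + η * b - ∑ (λ x → w x * g x)) + (η * b - ι k * Δ))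
        (0≤+ (0≤+ (0≤b-a start-large) (0≤b-a smooth)) (0≤b-a kΔ≤ηb))
        (solve 5 (λ h b w a k → (con 1ℚ :- (h :+ h :+ h)) :* b :+ (w :- (con 1ℚ :- h) :* b :+ (a :+ k :+ h :* b :- w) :+ (h :* b :- k)) := a) refl η b (∑ (λ x → w x * g x)) A (ι k * Δ))
        where
        start-large : (1ℚ - η) * b ≤ ∑ (λ x → w x * g x)
        start-large = *-cancelʳ b 0<b (subst₂ _≤_ (sym (*-assoc _ b b)) (trans (∑∑-g w) (*-comm b _)) correlated)
      final : ∀ B → (∀ x → average ψ x ≤ B) → 1ℚ + ε * 1/32 ≤ B
      final B bounded = ≤-trans numeric (*-cancelʳ (b * b) (0<* 0<b 0<b) (begin
        θ * (1ℚ - (η + η + η)) * (b * b)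
          ≡⟨ solve 3 (λ t y b → t :* y :* (b :* b) := t :* (b :* (y :* b))) refl θ (1ℚ - (η + η + η)) b ⟩
        θ * (b * ((1ℚ - (η + η + η)) * b))
          ≤⟨ *-monoˡ θ 0≤θ (*-monoˡ b (<⇒≤ 0<b) A-large) ⟩
        θ * (b * A)
          ≡⟨ trans (cong (θ *_) (sym (∑∑-g (average f)))) (trans (sym (∑-*ˡ θ _)) (∑-cong (λ s → trans (sym (∑-*ˡ θ _)) (∑-cong (λ t →
               solve 3 (λ t y c → t :* (y :* c) := y :* (c :* t)) refl θ (average f s * w t) (χ (t ⊟ᵥ s))))))) ⟩
        ∑ (λ s → ∑ (λ t → average f s * w t * (χ (t ⊟ᵥ s) * θ)))
          ≤⟨ ∑-mono (λ s → ∑-mono (λ t → *-monoˡ _ (0≤* (0≤average (0≤iterate k 0≤w) s) (0≤w t)) (χθ≤ψ _))) ⟩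
        ∑ (λ s → ∑ (λ t → average f s * w t * ψ (t ⊟ᵥ s)))
          ≡⟨ ∑∑-average f w ψ ⟩
        ∑ (λ s → ∑ (λ t → f s * w t * average ψ (t ⊟ᵥ s)))
          ≤⟨ ∑-mono (λ s → ∑-mono (λ t → *-monoˡ _ (0≤* (0≤iterate k 0≤w s) (0≤w t)) (bounded _))) ⟩
        ∑ (λ s → ∑ (λ t → f s * w t * B))
          ≡⟨ trans (∑-cong (λ s → ∑-*ʳ B _)) (trans (∑-*ʳ B _) (trans (cong (_* B) (trans (sym (Sum-*-Sum elemsG elemsG f w)) (cong (_* b) (∑-iterate k w)))) (*-comm _ B))) ⟩
        B * (b * b) ∎))
        where
        open ℚₚ.≤-Reasoning
        -- The gap ε/24 - ε/32 = ε/96 has to cover the loss 3η = 3ε/400 and the cross term ε²/3200,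
        -- which explains the 400 in η.
        numeric : 1ℚ + ε * 1/32 ≤ θ * (1ℚ - (η + η + η))
        numeric = ≤-by (ε * (ℤ.+ 1 ℚ./ 384) + ε * (1ℚ - ε) * (ℤ.+ 1 ℚ./ 3200))
          (0≤+ (0≤* 0≤ε (nonNegative⁻¹ _)) (0≤* (0≤* 0≤ε (0≤b-a (<⇒≤ ε<1))) (nonNegative⁻¹ _)))
          (solve 1 (λ e → con 1ℚ :+ e :* con 1/32 :+ (e :* con (ℤ.+ 1 ℚ./ 384) :+ e :* (con 1ℚ :- e) :* con (ℤ.+ 1 ℚ./ 3200)) :=
            (con 1ℚ :+ e :* con 1/24) :* (con 1ℚ :- (e :* con 1/400 :+ e :* con 1/400 :+ e :* con 1/400))) refl ε)
          where
          0≤ε : 0ℚ ≤ ε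
          0≤ε = <⇒≤ 0<ε

-- Existence of the constants and rounding of the density exponent

∣∣≤ : ∀ {x c} → x ≤ c → - x ≤ c → ∥ x ∥ ≤ c
∣∣≤ {x} {c} p q with ≤-total 0ℚ x
... | inj₁ 0≤x = ≤-respˡ (sym (0≤⇒∣∣ 0≤x)) p
... | inj₂ x≤0 = ≤-respˡ (trans (sym (0≤⇒∣∣ (0≤neg x≤0))) (∣-∣ x)) q

inv-unique : ∀ {x y} → 0ℚ < x → x * y ≡ 1ℚ → inv x ≡ y
inv-unique {x} {y} 0<x xy≡1 = trans (sym (*-identityʳ _)) (trans (cong (inv x *_) (sym xy≡1))
  (trans (sym (*-assoc _ x y)) (trans (cong (_* y) (trans (*-comm _ x) (inv-* 0<x))) (*-identityˡ y))))

^-cancel-≤ : ∀ {x y} n → 0ℚ ≤ y → x ^ suc n ≤ y ^ suc n → x ≤ y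
^-cancel-≤ n 0≤y p = ≮⇒≥ (λ y<x → <-irrefl refl (<-≤-trans (^-mono-< n 0≤y y<x) p))

∃multiple≥ : ∀ x {c} → 0ℚ < c → ∃[ n ] x ≤ ι n * c
∃multiple≥ x {c} 0<c = let n , p = archimedean (x * inv c) in
  n , ≤-respˡ (inv-cancelʳ x 0<c) (*-monoʳ c (<⇒≤ 0<c) p)

∃c2^≥ : ∀ x {c} → 0ℚ < c → ∃[ n ] x ≤ c * 2ℚ ^ n
∃c2^≥ x {c} 0<c = let n , p = ∃2^≥ (x * inv c) in
  n , subst₂ _≤_ (inv-cancelʳ x 0<c) (*-comm _ c) (*-monoʳ c (<⇒≤ 0<c) p)

constants : ∀ ε → 0ℚ < ε → ε < 1ℚ → Constants ε
constants ε 0<ε ε<1 = record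
  { m = proj₁ rounded ; z = proj₁ z ; n₁ = proj₁ n₁ ; M₂ = proj₁ M₂ ; n₃ = proj₁ n₃
  ; 8≤mε = proj₁ (proj₂ (proj₂ rounded))
  ; mε≤9 = ≤-trans (proj₂ (proj₂ (proj₂ rounded))) (≤-by (1ℚ - ε) (0≤b-a (<⇒≤ ε<1)) (solve 1 (λ e → con 8ℚ :+ e :+ (con 1ℚ :- e) := con 9ℚ) refl ε))
  ; 2≤η2^z = proj₂ z
  ; 2≤2^n₁η² = ≤-trans (proj₂ n₁) (≤-respˡ (*-comm _ _) (*-monoʳ (η * η) (<⇒≤ 0<η²) (^-monoʳ 1≤2 (ℕₚ.n≤1+n (proj₁ n₁)))))
  ; 256≤M₂η² = proj₂ M₂
  ; 8≤η2^n₃ = proj₂ n₃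
  }
  where
  η = ε * 1/400
  0<η : 0ℚ < η
  0<η = 0<* 0<ε (positive⁻¹ 1/400)
  0<η² : 0ℚ < η * η
  0<η² = 0<* 0<η 0<η
  rounded = round-up (proj₁ (∃multiple≥ 8ℚ 0<ε)) 8ℚ ε 0≤8 (<⇒≤ 0<ε) (proj₂ (∃multiple≥ 8ℚ 0<ε))
  z = ∃c2^≥ 2ℚ 0<η
  n₁ = ∃c2^≥ 2ℚ 0<η²
  M₂ = ∃multiple≥ 256ℚ 0<η²
  n₃ = ∃c2^≥ 8ℚ 0<η

-- Rounds a/b up to a power of two that is at least 1. The summand b in the upper bound covers a/b <
-- 1 and is absorbed later by b ≤ a S.
dyadic-multiple : ∀ a b → 1 ℕ.≤ b → ∃[ s ] (a ℕ.≤ 2 ℕ.^ s ℕ.* b × 2 ℕ.^ s ℕ.* b ℕ.≤ 2 ℕ.* a ℕ.+ b)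
dyadic-multiple a b 1≤b = go a (ℕₚ.≤-trans (ι-cancel-≤ (≤-respʳ (sym (trans (ι-^ 2 a) (cong (_^ a) (sym (ι-def 2))))) (ι≤2^ a))) (ℕₚ.≤-trans (ℕₚ.≤-reflexive (sym (ℕₚ.*-identityʳ _))) (ℕₚ.*-monoʳ-≤ (2 ℕ.^ a) 1≤b)))
  where
  go : ∀ t → a ℕ.≤ 2 ℕ.^ t ℕ.* b → ∃[ s ] (a ℕ.≤ 2 ℕ.^ s ℕ.* b × 2 ℕ.^ s ℕ.* b ℕ.≤ 2 ℕ.* a ℕ.+ b)
  go zero p = 0 , p , ℕₚ.≤-trans (ℕₚ.≤-reflexive (ℕₚ.*-identityˡ b)) (ℕₚ.m≤n+m b (2 ℕ.* a))
  go (suc t) p with a ℕ.≤? 2 ℕ.^ t ℕ.* b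
  ... | yes q = go t q
  ... | no q = suc t , p , ℕₚ.≤-trans (ℕₚ.≤-trans (ℕₚ.≤-reflexive (ℕₚ.*-assoc 2 (2 ℕ.^ t) b)) (ℕₚ.*-monoʳ-≤ 2 (ℕₚ.<⇒≤ (ℕₚ.≰⇒> q)))) (ℕₚ.m≤m+n (2 ℕ.* a) b)

-- The last hypothesis says y ≥ 2^{-a/(b+1)} x, and J ≥ 1/κ with a/(b+1) ≤ 1/J makes 2^{-a/(b+1)} ≥ 1 - κ.
nearly-full : ∀ κ J a b x y → 0ℚ ≤ κ → κ ≤ 1ℚ → 1ℚ ≤ ι J * κ → a ℕ.* J ℕ.≤ suc b → 0ℚ < x → 0ℚ ≤ y →
  x ^ suc b ≤ 2ℚ ^ a * y ^ suc b → (1ℚ - κ) * x ≤ y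
nearly-full κ J a b x y 0≤κ κ≤1 1≤Jκ aJ≤b 0<x 0≤y p = ≮⇒≥ (λ y< → <-irrefl refl (<-≤-trans (too-small y<) (begin
    2ℚ ^ a * ((1ℚ - κ) * x) ^ suc b ≡⟨ trans (cong (2ℚ ^ a *_) (^-distrib (1ℚ - κ) x (suc b))) (sym (*-assoc _ _ _)) ⟩
    2ℚ ^ a * (1ℚ - κ) ^ suc b * x ^ suc b ≤⟨ *-monoʳ (x ^ suc b) (0≤^ (suc b) (<⇒≤ 0<x)) small ⟩
    1ℚ * x ^ suc b ≡⟨ *-identityˡ _ ⟩
    x ^ suc b ∎)))
  where
  open ℚₚ.≤-Reasoning
  0≤1-κ : 0ℚ ≤ 1ℚ - κ
  0≤1-κ = 0≤b-a κ≤1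
  1-κ≤1 : 1ℚ - κ ≤ 1ℚ
  1-κ≤1 = ≤-by κ 0≤κ (solve 1 (λ k → con 1ℚ :- k :+ k := con 1ℚ) refl κ)
  too-small : y < (1ℚ - κ) * x → x ^ suc b < 2ℚ ^ a * ((1ℚ - κ) * x) ^ suc b
  too-small y< = ≤-<-trans p (subst₂ _<_ (*-comm _ _) (*-comm _ _) (*-mono-<ʳ (2ℚ ^ a) (0<^ a 0<2) (^-mono-< b 0≤y y<)))
  half : 2ℚ * (1ℚ - κ) ^ J ≤ 1ℚ
  half = begin
    2ℚ * (1ℚ - κ) ^ J ≤⟨ *-monoʳ _ (0≤^ J 0≤1-κ) (≤-trans (≤-by (ι J * κ - 1ℚ) (0≤b-a 1≤Jκ) (solve 1 (λ z → con 2ℚ :+ (z :- con 1ℚ) := con 1ℚ :+ z) refl (ι J * κ))) (1+na≤ κ 0≤κ J)) ⟩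
    (1ℚ + κ) ^ J * (1ℚ - κ) ^ J ≡⟨ sym (^-distrib (1ℚ + κ) (1ℚ - κ) J) ⟩
    ((1ℚ + κ) * (1ℚ - κ)) ^ J ≤⟨ ^-mono J (0≤* (0≤+ 0≤1 0≤κ) 0≤1-κ) (≤-by (κ * κ) (0≤sq κ) (solve 1 (λ k → (con 1ℚ :+ k) :* (con 1ℚ :- k) :+ k :* k := con 1ℚ) refl κ)) ⟩
    1ℚ ^ J ≡⟨ 1^ J ⟩
    1ℚ ∎
  small : 2ℚ ^ a * (1ℚ - κ) ^ suc b ≤ 1ℚ
  small = begin
    2ℚ ^ a * (1ℚ - κ) ^ suc b ≡⟨ cong (λ z → 2ℚ ^ a * (1ℚ - κ) ^ z) (sym (ℕₚ.m+[n∸m]≡n aJ≤b)) ⟩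
    2ℚ ^ a * (1ℚ - κ) ^ (a ℕ.* J ℕ.+ rest) ≡⟨ cong (2ℚ ^ a *_) (^-+ (1ℚ - κ) (a ℕ.* J) rest) ⟩
    2ℚ ^ a * ((1ℚ - κ) ^ (a ℕ.* J) * (1ℚ - κ) ^ rest) ≤⟨ *-monoˡ (2ℚ ^ a) (0≤^ a 0≤2) (*-monoˡ _ (0≤^ (a ℕ.* J) 0≤1-κ) (≤-respʳ (1^ rest) (^-mono rest 0≤1-κ 1-κ≤1))) ⟩
    2ℚ ^ a * ((1ℚ - κ) ^ (a ℕ.* J) * 1ℚ) ≡⟨ cong (2ℚ ^ a *_) (trans (*-identityʳ _) (trans (cong ((1ℚ - κ) ^_) (ℕₚ.*-comm a J)) (^-* (1ℚ - κ) J a))) ⟩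
    2ℚ ^ a * ((1ℚ - κ) ^ J) ^ a ≡⟨ sym (^-distrib 2ℚ ((1ℚ - κ) ^ J) a) ⟩
    (2ℚ * (1ℚ - κ) ^ J) ^ a ≤⟨ ^-mono a (0≤* 0≤2 (0≤^ J 0≤1-κ)) half ⟩
    1ℚ ^ a ≡⟨ 1^ a ⟩
    1ℚ ∎
    where rest = suc b ℕ.∸ a ℕ.* J

-- Nearly full families

¼ ½ ¾ : ℚ
¼ = ℤ.+ 1 ℚ./ 4
½ = ℤ.+ 1 ℚ./ 2
¾ = ℤ.+ 3 ℚ./ 4

module NearlyFull (𝔽 : FiniteField) (n : ℕ) (a : Space.G 𝔽 n → Space.G 𝔽 n → ℚ) (0≤a : ∀ g x → 0ℚ ≤ a g x) (a≤1 : ∀ g x → a g x ≤ 1ℚ)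
  (ε : ℚ) (0<ε : 0ℚ < ε) (ε<1 : ε < 1ℚ)
  (0<total : 0ℚ < Space.∑ 𝔽 n (λ g → Space.∑ 𝔽 n (a g)))
  (full : (1ℚ - ε * ¼) * (Space.N 𝔽 n * Space.N 𝔽 n) ≤ Space.∑ 𝔽 n (λ g → Space.∑ 𝔽 n (a g))) where
  open Space 𝔽 n
  open Gram 𝔽 n
  open Sifting 𝔽 n

  0≤ε : 0ℚ ≤ ε
  0≤ε = <⇒≤ 0<ε

  0≤NN : 0ℚ ≤ N * N
  0≤NN = 0≤* 0≤N 0≤N

  dense : N * N ≤ 2ℚ ^ 1 * ∑ (λ g → ∑ (a g))
  dense = ≤-trans (≤-by ((1ℚ - ε) * ½ * (N * N) + ½ * (N * N)) (0≤+ (0≤* (0≤* (0≤b-a (<⇒≤ ε<1)) (nonNegative⁻¹ ½)) 0≤NN) (0≤* (nonNegative⁻¹ ½) 0≤NN))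
      (solve 2 (λ e n → n :+ ((con 1ℚ :- e) :* con ½ :* n :+ con ½ :* n) := (con 2ℚ :* con 1ℚ) :* ((con 1ℚ :- e :* con ¼) :* n)) refl ε (N * N)))
    (*-monoˡ (2ℚ ^ 1) (0≤^ 1 0≤2) full)

  open Density a 0≤a a≤1 1 0<total dense
  open Centred a using (mass; twisted; energy; ∑-twisted)

  -- `y` is the reciprocal of the density of the family and `X` is ⟨μ_F, μ_D⟩ - 1. It is bounded
  -- above by y - 1 and below by -(y - 1)², both small when y is close to 1.
  i y Y X : ℚ
  i = inv σ
  y = N * N * i
  Y = ∑ (λ x → mass x * twisted x)
  X = ∑ (λ x → mass x * i * ũ x)

  0≤i : 0ℚ ≤ i
  0≤i = 0≤inv 0<total

  σi : σ * i ≡ 1ℚ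
  σi = inv-* 0<total

  X≡ : X ≡ Y * i * κ - 1ℚ
  X≡ = trans (∑-cong (λ x → solve 4 (λ m i t k → m :* i :* (t :* k :- con 1ℚ) := m :* t :* (i :* k) :- m :* i) refl (mass x) i (twisted x) κ))
    (trans (∑-- _ _) (cong₂ _-_ (trans (∑-*ʳ (i * κ) _) (sym (*-assoc Y i κ))) (trans (∑-*ʳ i mass) σi)))

  0≤twisted : ∀ x → 0ℚ ≤ twisted x
  0≤twisted x = 0≤∑ (λ g → 0≤∑ (λ z → 0≤* (0≤a g z) (0≤a g _)))

  twisted≤σ : ∀ x → twisted x ≤ σ
  twisted≤σ x = ∑-mono (λ g → ∑-mono (λ z → ≤-respʳ (*-identityʳ _) (*-monoˡ (a g z) (0≤a g z) (a≤1 g _))))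

  σ≤NN : σ ≤ N * N
  σ≤NN = ≤-respʳ (∑-const N) (∑-mono mass≤N)

  Y≤ : Y ≤ N * (e * N)
  Y≤ = ≤-respʳ (trans (∑-*ˡ N twisted) (cong (N *_) (trans ∑-twisted (sym e*N)))) (∑-mono (λ x → *-monoʳ (twisted x) (0≤twisted x) (mass≤N x)))

  -- Replacing `mass x` by N overcounts by at most `twisted x`, hence by at most σ, per unit of
  -- missing mass, and N² - σ is missing in total.
  Y≥ : N * (e * N) - σ * (N * N - σ) ≤ Y
  Y≥ = ≤-by (σ * (N * N - σ) - (N * (e * N) - Y)) (0≤b-a deficit) (solve 3 (λ a b y → a :- b :+ (b :- (a :- y)) := y) refl (N * (e * N)) (σ * (N * N - σ)) Y)
    where
    deficit : N * (e * N) - Y ≤ σ * (N * N - σ)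
    deficit = subst₂ _≤_
      (trans (∑-cong (λ x → solve 3 (λ t n m → t :* (n :- m) := n :* t :- m :* t) refl (twisted x) N (mass x)))
        (trans (∑-- _ _) (cong (_- Y) (trans (∑-*ˡ N twisted) (cong (N *_) (trans ∑-twisted (sym e*N)))))))
      (trans (∑-*ˡ σ _) (cong (σ *_) (trans (∑-- _ _) (cong (_- σ) (∑-const N)))))
      (∑-mono (λ x → *-monoʳ (N - mass x) (0≤b-a (mass≤N x)) (twisted≤σ x)))

  X≤ : X ≤ y - 1ℚ
  X≤ = ≤-respˡ (sym X≡) (+-monoˡ-≤ (- 1ℚ) (≤-respʳ
    (trans (solve 4 (λ n e i k → n :* (e :* n) :* i :* k := n :* n :* i :* (k :* e)) refl N e i κ) (trans (cong (y *_) κ*e) (*-identityʳ y)))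
    (*-monoʳ κ 0≤κ (*-monoʳ i 0≤i Y≤))))

  κ≤yi : κ ≤ y * i
  κ≤yi = *-cancelʳ (e * (σ * σ)) (0<* 0<e (0<* 0<total 0<total)) (subst₂ _≤_
    (trans (sym (*-identityˡ _)) (trans (cong (_* (σ * σ)) (sym κ*e)) (*-assoc κ e _)))
    (sym (trans (solve 4 (λ n i e s → n :* n :* i :* i :* (e :* (s :* s)) := s :* i :* (s :* i) :* (n :* (e :* n))) refl N i e σ)
      (trans (cong (λ z → z * z * (N * (e * N))) σi) (trans (cong (_* (N * (e * N))) (*-identityˡ 1ℚ)) (trans (*-identityˡ _) (cong (N *_) e*N))))))
    σ²≤N*energy)

  -- From `Y≥`, -X ≤ 1 - y + (N² - σ) κ. By `κ≤yi` the last term is at most y (y - 1), and the total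
  -- becomes (y - 1)².
  -X≤ : - X ≤ (y - 1ℚ) * (y - 1ℚ)
  -X≤ = ≤-by ((Y * i * κ - (y - (N * N - σ) * κ)) + (N * N - σ) * (y * i - κ)) (0≤+ (0≤b-a lower) (0≤* (0≤b-a σ≤NN) (0≤b-a κ≤yi)))
    (trans (cong (λ z → - z + ((Y * i * κ - (y - (N * N - σ) * κ)) + (N * N - σ) * (y * i - κ))) X≡)
      (trans (solve 6 (λ Y y n s k i → :- (Y :- con 1ℚ) :+ ((Y :- (y :- (n :- s) :* k)) :+ (n :- s) :* (y :* i :- k)) := con 1ℚ :- y :+ y :* (n :* i) :- y :* (s :* i)) refl (Y * i * κ) y (N * N) σ κ i)
        (trans (cong (λ z → 1ℚ - y + y * y - y * z) σi) (solve 1 (λ y → con 1ℚ :- y :+ y :* y :- y :* con 1ℚ := (y :- con 1ℚ) :* (y :- con 1ℚ)) refl y))))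
    where
    lower : y - (N * N - σ) * κ ≤ Y * i * κ
    lower = ≤-respˡ (trans (solve 5 (λ n e s i k → (n :* (e :* n) :- s :* (n :* n :- s)) :* i :* k := n :* n :* i :* (k :* e) :- s :* i :* ((n :* n :- s) :* k)) refl N e σ i κ)
      (cong₂ _-_ (trans (cong (y *_) κ*e) (*-identityʳ y)) (trans (cong (_* ((N * N - σ) * κ)) σi) (*-identityˡ _))))
      (*-monoʳ κ 0≤κ (*-monoʳ i 0≤i Y≥))

  0≤y : 0ℚ ≤ y
  0≤y = 0≤* 0≤NN 0≤i

  1≤y : 1ℚ ≤ y
  1≤y = ≤-respˡ σi (*-monoʳ i 0≤i σ≤NN)

  y-full : (1ℚ - ε * ¼) * y ≤ 1ℚ
  y-full = subst₂ _≤_ (*-assoc _ _ i) σi (*-monoʳ i 0≤i full)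

  y≤2 : y ≤ 2ℚ
  y≤2 = *-cancelʳ ½ (positive⁻¹ ½) (≤-by ((1ℚ - (1ℚ - ε * ¼) * y) + (1ℚ - ε) * (¼ * y) + ¼ * y)
    (0≤+ (0≤+ (0≤b-a y-full) (0≤* (0≤b-a (<⇒≤ ε<1)) (0≤* (nonNegative⁻¹ ¼) 0≤y))) (0≤* (nonNegative⁻¹ ¼) 0≤y))
    (solve 2 (λ e y → y :* con ½ :+ ((con 1ℚ :- (con 1ℚ :- e :* con ¼) :* y) :+ (con 1ℚ :- e) :* (con ¼ :* y) :+ con ¼ :* y) := con 2ℚ :* con ½) refl ε y))

  y-1≤ε : y - 1ℚ ≤ ε
  y-1≤ε = ≤-by ((1ℚ - (1ℚ - ε * ¼) * y) + ε * ¼ * (2ℚ - y) + ε * ½) (0≤+ (0≤+ (0≤b-a y-full) (0≤* (0≤* 0≤ε (nonNegative⁻¹ ¼)) (0≤b-a y≤2))) (0≤* 0≤ε (nonNegative⁻¹ ½)))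
    (solve 2 (λ e y → y :- con 1ℚ :+ ((con 1ℚ :- (con 1ℚ :- e :* con ¼) :* y) :+ e :* con ¼ :* (con 2ℚ :- y) :+ e :* con ½) := e) refl ε y)

  ∣X∣≤ε : ∥ X ∥ ≤ ε
  ∣X∣≤ε = ∣∣≤ (≤-trans X≤ y-1≤ε) (≤-trans -X≤ (≤-trans (≤-respʳ (*-identityʳ _) (*-monoˡ (y - 1ℚ) (0≤b-a 1≤y)
    (≤-by (2ℚ - y) (0≤b-a y≤2) (solve 1 (λ y → y :- con 1ℚ :+ (con 2ℚ :- y) := con 1ℚ) refl y)))) y-1≤ε))

-- Translation into the notions of the statement

Sum-ι : ∀ (xs : List 𝕏) (h : 𝕏 → ℕ) → ι (foldr (λ x s → h x ℕ.+ s) 0 xs) ≡ Sum xs (λ x → ι (h x))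
Sum-ι [] h = ι0
Sum-ι (x ∷ xs) h = trans (ι-+ (h x) _) (cong (ι (h x) +_) (Sum-ι xs h))

ℕ-^-distrib : ∀ m n k → (m ℕ.* n) ℕ.^ k ≡ m ℕ.^ k ℕ.* n ℕ.^ k
ℕ-^-distrib m n k = ι-injective (trans (ι-^ (m ℕ.* n) k) (trans (cong (_^ k) (ι-* m n)) (trans (^-distrib (ι m) (ι n) k)
  (trans (sym (cong₂ _*_ (ι-^ m k) (ι-^ n k))) (sym (ι-* (m ℕ.^ k) (n ℕ.^ k)))))))

opaque
  unfolding _+_

  sealed-foldr : ∀ (xs : List 𝕏) (f : 𝕏 → ℚ) → foldr (λ x s → f x ℚ.+ s) 0ℚ xs ≡ Sum xs f
  sealed-foldr xs f = refl

  sealed-∣-∣ : ∀ x y → ℚ.∣ x ℚ.- y ∣ ≡ ∥ x - y ∥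
  sealed-∣-∣ x y = refl

≤foldr-⊔ : ∀ (xs : List 𝕏) (f : 𝕏 → ℚ) {x} → x ∈ xs → f x ≤ foldr (λ y m → ℚ.∣ f y ∣ ℚ.⊔ m) 0ℚ xs
≤foldr-⊔ (y ∷ xs) f (here refl) = ≤-trans (below (f y)) (ℚₚ.p≤p⊔q _ _)
  where
  below : ∀ z → z ≤ ℚ.∣ z ∣
  below z with ≤-total 0ℚ z
  ... | inj₁ p = ≤-reflexive (sym (ℚₚ.0≤p⇒∣p∣≡p p))
  ... | inj₂ p = ≤-trans p (ℚₚ.0≤∣p∣ z)
≤foldr-⊔ (y ∷ xs) f (there x∈) = ≤-trans (≤foldr-⊔ xs f x∈) (ℚₚ.p≤q⊔p (ℚ.∣ f y ∣) _)

module Dictionary (𝔽 : FiniteField) (n : ℕ) (A : FF.G 𝔽 n → FF.Subset 𝔽 n) where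
  open Space 𝔽 n
  open Gram 𝔽 n
  open Chang 𝔽 n using (1V; 0<∑1V)
  module D = FF 𝔽 n

  ∈elemsG : ∀ x → x ∈ elemsG
  ∈elemsG x = go x
    where
    go : ∀ {m} (x : Vec K m) → x ∈ allVecs m
    go [] = here refl
    go {suc m} (y ∷ x) = ∈-concatMap⁺ (λ y → List.map (y ∷_) (allVecs m)) (lose (complete y) (∈-map⁺ (y ∷_) (go x)))

  indicator : G → G → ℚ
  indicator g = 1[ A g ]

  0≤indicator : ∀ g x → 0ℚ ≤ indicator g x
  0≤indicator g x with A g x
  ... | true = 0≤1
  ... | false = ≤-refl

  indicator≤1 : ∀ g x → indicator g x ≤ 1ℚ
  indicator≤1 g x with A g x
  ... | true = ≤-refl
  ... | false = 0≤1

  open Centred indicator using (twisted; straight; mass; energy; ∑-twisted; ∑-straight)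

  F F′ Dₐ : G → ℚ
  F  x = D.sumG (λ g → (1[ A g ] D.⊚ 1[ A g D.⊕ g ]) x)
  F′ x = D.sumG (λ g → (1[ A g ] D.⊚ 1[ A g ]) x)
  Dₐ x = ℤ.+ card (A x) ℚ./ 1

  𝔼≡ : ∀ f → D.𝔼 f ≡ ∑ f * inv N
  𝔼≡ f = trans (÷'-inv _ _) (cong₂ (λ a b → a * inv b) (sealed-foldr elemsG f) (ι-def (length elemsG)))

  F≡ : ∀ x → F x ≡ twisted x * inv N
  F≡ x = trans (sealed-foldr elemsG _) (trans (∑-cong (λ g → trans (𝔼≡ _) (cong (_* inv N) (∑-cong (λ y →
      trans (*-homo _ _) (cong (λ z → indicator g y * indicator g z) (trans (⊟ᵥ-comm x y g) refl)))))))
    (∑-*ʳ (inv N) _))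
    where
    ⊟ᵥ-comm : ∀ (x y g : G) → x ⊞ᵥ y ⊟ᵥ g ≡ y ⊞ᵥ (x ⊟ᵥ g)
    ⊟ᵥ-comm x y g = trans (cong (_⊟ᵥ g) (⊞ᵥ-comm x y)) (⊞ᵥ-⊟ᵥ-assoc y x g)

  F′≡ : ∀ x → F′ x ≡ straight x * inv N
  F′≡ x = trans (sealed-foldr elemsG _) (trans (∑-cong (λ g → trans (𝔼≡ _) (cong (_* inv N) (∑-cong (λ y →
      trans (*-homo _ _) (cong (λ z → indicator g y * indicator g z) (⊞ᵥ-comm x y)))))))
    (∑-*ʳ (inv N) _))

  Dₐ≡ : ∀ x → Dₐ x ≡ mass x
  Dₐ≡ x = trans (ι-def _) (ι-card (A x))

  sumGℕ-card : ι (D.sumGℕ (λ g → card (A g))) ≡ ∑ mass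
  sumGℕ-card = trans (Sum-ι elemsG _) (∑-cong (λ g → ι-card (A g)))

  N*invN : N * inv N ≡ 1ℚ
  N*invN = inv-* 0<N

  0<invN : 0ℚ < inv N
  0<invN = 0<inv 0<N

  -- Normalising by the mean cancels the factor 1/N of ⊚.
  μ-scaled : ∀ (f : G → ℚ) (h : G → ℚ) c → (∀ x → f x ≡ h x * inv N) → ∑ h ≡ c * N → 0ℚ < c → ∀ x → D.μ f x ≡ h x * inv c
  μ-scaled f h c f≡ ∑h≡ 0<c x = trans (÷'-inv _ _) (trans (cong₂ (λ a b → a * b) (f≡ x) (trans (cong inv mean) (inv-unique (0<* 0<c 0<invN)
      (trans (solve 4 (λ c i j n → c :* i :* (j :* n) := c :* j :* (n :* i)) refl c (inv N) (inv c) N) (trans (cong₂ _*_ (inv-* 0<c) N*invN) (*-identityˡ 1ℚ))))))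
    (trans (solve 4 (λ h i j n → h :* i :* (j :* n) := h :* j :* (n :* i)) refl (h x) (inv N) (inv c) N) (trans (cong (h x * inv c *_) N*invN) (*-identityʳ _))))
    where
    mean : D.𝔼 f ≡ c * inv N
    mean = trans (𝔼≡ f) (cong (_* inv N) (trans (∑-cong f≡) (trans (∑-*ʳ (inv N) h) (trans (cong (_* inv N) ∑h≡)
      (trans (*-assoc c N _) (trans (cong (c *_) N*invN) (*-identityʳ c)))))))

  module _ (e : ℚ) (0<e : 0ℚ < e) (e*N : e * N ≡ energy) (0<σ : 0ℚ < ∑ mass) where
    μF≡ : ∀ x → D.μ F x ≡ twisted x * inv e
    μF≡ = μ-scaled F twisted e F≡ (trans ∑-twisted (sym e*N)) 0<e

    μF′≡ : ∀ x → D.μ F′ x ≡ straight x * inv e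
    μF′≡ = μ-scaled F′ straight e F′≡ (trans ∑-straight (sym e*N)) 0<e

    μD≡ : ∀ x → D.μ Dₐ x ≡ mass x * N * inv (∑ mass)
    μD≡ = μ-scaled Dₐ (λ x → mass x * N) (∑ mass) (λ x → trans (Dₐ≡ x) (sym (trans (*-assoc _ N _) (trans (cong (mass x *_) N*invN) (*-identityʳ _)))))
      (∑-*ʳ N mass) 0<σ

    correlation : D.⟨ D.μ F , D.μ Dₐ ⟩ - 1ℚ ≡ ∑ (λ x → mass x * inv (∑ mass) * (twisted x * inv e - 1ℚ))
    correlation = sym (trans (∑-cong (λ x → solve 4 (λ m i t j → m :* i :* (t :* j :- con 1ℚ) := t :* j :* (m :* i) :- m :* i) refl (mass x) (inv (∑ mass)) (twisted x) (inv e)))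
      (trans (∑-- _ _) (cong₂ _-_ (sym pairing) (trans (∑-*ʳ _ mass) (inv-* 0<σ)))))
      where
      pairing : D.⟨ D.μ F , D.μ Dₐ ⟩ ≡ ∑ (λ x → twisted x * inv e * (mass x * inv (∑ mass)))
      pairing = trans (𝔼≡ _) (trans (sym (∑-*ʳ (inv N) _)) (∑-cong (λ x → trans
        (cong (_* inv N) (trans (*-homo _ _) (cong₂ _*_ (μF≡ x) (μD≡ x))))
        (trans (solve 6 (λ t j m n s i → t :* j :* (m :* n :* s) :* i := t :* j :* (m :* s) :* (n :* i)) refl (twisted x) (inv e) (mass x) N (inv (∑ mass)) (inv N))
          (trans (cong (twisted x * inv e * (mass x * inv (∑ mass)) *_) N*invN) (*-identityʳ _))))))

    smoothed : ∀ (V : Subspace) x → inv (∑ (1V V)) * ∑ (λ v → 1V V v * (straight (x ⊟ᵥ v) * inv e)) ≤ D.‖ D.μ F′ D.∗ D.μSet (Subspace.mem V) ‖∞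
    smoothed V x = ≤-respˡ conv≡ (≤foldr-⊔ elemsG (D.μ F′ D.∗ D.μSet (Subspace.mem V)) (∈elemsG x))
      where
      v̂ = inv (∑ (1V V))
      μV≡ : ∀ z → D.μSet (Subspace.mem V) z ≡ N * v̂ * 1V V z
      μV≡ z = trans (*-homo _ _) (cong (_* 1V V z) (trans (÷'-inv _ _) (cong₂ (λ a b → a * inv b) (ι-def (length elemsG)) (trans (ι-def _) (ι-card (Subspace.mem V))))))
      conv≡ : (D.μ F′ D.∗ D.μSet (Subspace.mem V)) x ≡ v̂ * ∑ (λ v → 1V V v * (straight (x ⊟ᵥ v) * inv e))
      conv≡ = begin
        D.𝔼 (λ y → D.μ F′ y ℚ.* D.μSet (Subspace.mem V) (x ⊟ᵥ y))
          ≡⟨ trans (𝔼≡ _) (sym (∑-*ʳ (inv N) _)) ⟩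
        ∑ (λ y → D.μ F′ y ℚ.* D.μSet (Subspace.mem V) (x ⊟ᵥ y) * inv N)
          ≡⟨ ∑-cong (λ y → trans (cong (_* inv N) (trans (*-homo _ _) (cong₂ _*_ (μF′≡ y) (μV≡ (x ⊟ᵥ y)))))
               (trans (solve 5 (λ p n v c i → p :* (n :* v :* c) :* i := v :* (c :* p) :* (n :* i)) refl (straight y * inv e) N v̂ (1V V (x ⊟ᵥ y)) (inv N))
                 (trans (cong (v̂ * (1V V (x ⊟ᵥ y) * (straight y * inv e)) *_) N*invN) (*-identityʳ _)))) ⟩
        ∑ (λ y → v̂ * (1V V (x ⊟ᵥ y) * (straight y * inv e)))
          ≡⟨ ∑-*ˡ v̂ _ ⟩
        v̂ * ∑ (λ y → 1V V (x ⊟ᵥ y) * (straight y * inv e))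
          ≡⟨ cong (v̂ *_) (trans (sym (∑-reflect x _)) (∑-cong (λ v → cong (λ z → 1V V z * (straight (x ⊟ᵥ v) * inv e)) (⊟ᵥ-involutive x v)))) ⟩
        v̂ * ∑ (λ v → 1V V v * (straight (x ⊟ᵥ v) * inv e)) ∎
        where open ≡-Reasoning

-- The theorem, divided by the size of the density exponent

open import Data.Integer using (+_)

theorem3p2 : (ε : ℚ) → 0ℚ ℚ.< ε → ε ℚ.< 1ℚ →
    ∃[ C ] ((𝔽 : FiniteField) (n : ℕ) (a b : ℕ) → 1 ℕ.≤ a → 1 ℕ.≤ b →
    (A : FF.G 𝔽 n → FF.Subset 𝔽 n) →
    let open FiniteField 𝔽 using (q) in
    let open FF 𝔽 n in
    let F  : G → ℚ
        F  x = sumG (λ g → (1[ A g ] ⊚ 1[ A g ⊕ g ]) x) in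
    let F′ : G → ℚ
        F′ x = sumG (λ g → (1[ A g ] ⊚ 1[ A g ]) x) in
    let D  : G → ℚ
        D  x = + card (A x) ℚ./ 1 in
    (q ℕ.^ n) ℕ.^ (2 ℕ.* b) ℕ.≤ (2 ℕ.^ a) ℕ.* (sumGℕ (λ g → card (A g)) ℕ.^ b) →
    (∣ ⟨ μ F , μ D ⟩ ℚ.- 1ℚ ∣ ℚ.≤ ε)
    ⊎ (Σ Subspace λ V → ∃[ c ] (HasCodim V c × c ℕ.* (b ℕ.^ 8) ℕ.≤ C ℕ.* (a ℕ.^ 8)
    × 1ℚ ℚ.+ ε ℚ.* (+ 1 ℚ./ 32) ℚ.≤ ‖ μ F′ ∗ μSet (Subspace.mem V) ‖∞)))
theorem3p2 ε 0<ε ε<1 = C , λ { 𝔽 n a zero _ () ; 𝔽 n a (suc b) _ _ A hypothesis → Main.conclusion 𝔽 n a b A hypothesis }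
  where
  ks = constants ε 0<ε ε<1
  0<ε/4 : 0ℚ < ε * ¼
  0<ε/4 = 0<* 0<ε (positive⁻¹ ¼)
  -- If a S ≤ b the density is so close to 1 that (1) holds outright; otherwise b = O_ε(a).
  S C : ℕ
  S = proj₁ (∃multiple≥ 1ℚ 0<ε/4)
  C = Constants.C₁ ks ℕ.* (2 ℕ.+ S) ℕ.^ 8

  module Main (𝔽 : FiniteField) (n a b : ℕ) (A : FF.G 𝔽 n → FF.Subset 𝔽 n)
    (hypothesis : (FiniteField.q 𝔽 ℕ.^ n) ℕ.^ (2 ℕ.* suc b) ℕ.≤ (2 ℕ.^ a) ℕ.* (FF.sumGℕ 𝔽 n (λ g → FF.card 𝔽 n (A g)) ℕ.^ suc b)) where
    open Space 𝔽 n
    open Sifting 𝔽 n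
    open Dictionary 𝔽 n A
    open Gram.Centred 𝔽 n indicator using (mass; straight)
    open Chang 𝔽 n using (1V)

    σ : ℚ
    σ = ∑ mass

    -- Here d is the rational a / suc b; the inequality N² ≤ 2^d σ has been raised to the power suc
    -- b so that no root of 2 is needed.
    hypothesisℚ : (N * N) ^ suc b ≤ 2ℚ ^ a * σ ^ suc b
    hypothesisℚ = subst₂ _≤_
      (trans (ι-^ _ (2 ℕ.* suc b)) (trans (cong (_^ (2 ℕ.* suc b)) (trans (ι-^ q n) (sym N≡q^n))) (trans (^-* N 2 (suc b)) (cong (λ z → (N * z) ^ suc b) (*-identityʳ N)))))
      (trans (ι-* (2 ℕ.^ a) _) (cong₂ _*_ (trans (ι-^ 2 a) (cong (_^ a) (sym (ι-def 2)))) (trans (ι-^ _ (suc b)) (cong (_^ suc b) sumGℕ-card))))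
      (ι-mono hypothesis)

    0<NN : 0ℚ < N * N
    0<NN = 0<* 0<N 0<N

    0≤σ : 0ℚ ≤ σ
    0≤σ = 0≤∑ (λ g → 0≤∑ (0≤indicator g))

    0<σ : 0ℚ < σ
    0<σ = ≰⇒> (λ σ≤0 → <-irrefl refl (<-≤-trans (0<^ (suc b) 0<NN) (≤-trans hypothesisℚ
      (≤-respʳ (zeroʳ (2ℚ ^ a)) (*-monoˡ (2ℚ ^ a) (0≤^ a 0≤2) (≤-respʳ (zeroˡ (σ ^ b)) (*-monoʳ (σ ^ b) (0≤^ b 0≤σ) σ≤0)))))))

    Goal : Set
    Goal = (ℚ.∣ D.⟨ D.μ F , D.μ Dₐ ⟩ ℚ.- 1ℚ ∣ ≤ ε)
      ⊎ (Σ Subspace λ V → ∃[ c ] (HasCodim V c × c ℕ.* (suc b ℕ.^ 8) ℕ.≤ C ℕ.* (a ℕ.^ 8)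
        × 1ℚ ℚ.+ ε ℚ.* (+ 1 ℚ./ 32) ≤ D.‖ D.μ F′ D.∗ D.μSet (Subspace.mem V) ‖∞))

    dense-case : a ℕ.* S ℕ.≤ suc b → Goal
    dense-case aJ≤b = inj₁ (≤-respˡ (sym (trans (sealed-∣-∣ _ 1ℚ) (cong ∥_∥ (correlation De.e De.0<e De.e*N 0<σ)))) ∣X∣≤ε)
      where
      full : (1ℚ - ε * ¼) * (N * N) ≤ σ
      full = nearly-full (ε * ¼) S a b (N * N) σ (<⇒≤ 0<ε/4)
        (≤-by ((1ℚ - ε) * ¼ + ¾) (0≤+ (0≤* (0≤b-a (<⇒≤ ε<1)) (nonNegative⁻¹ ¼)) (nonNegative⁻¹ ¾))
          (solve 1 (λ e → e :* con ¼ :+ ((con 1ℚ :- e) :* con ¼ :+ con ¾) := con 1ℚ) refl ε))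
        (proj₂ (∃multiple≥ 1ℚ 0<ε/4)) aJ≤b 0<NN 0≤σ hypothesisℚ
      open NearlyFull 𝔽 n indicator 0≤indicator indicator≤1 ε 0<ε ε<1 0<σ full using (dense; ∣X∣≤ε)
      module De = Density indicator 0≤indicator indicator≤1 1 0<σ dense

    sparse-case : suc b ℕ.≤ a ℕ.* S → Goal
    sparse-case b≤aJ = decide (∥ X ∥ ≤? ε)
      where
      dyadic = dyadic-multiple a (suc b) (ℕ.s≤s ℕ.z≤n)
      s d : ℕ
      s = proj₁ dyadic
      d = 2 ℕ.^ s
      dense : N * N ≤ 2ℚ ^ d * σ
      dense = ^-cancel-≤ b (0≤* (0≤^ d 0≤2) 0≤σ) (≤-trans hypothesisℚ (≤-respʳ
        (trans (cong (_* σ ^ suc b) (^-* 2ℚ d (suc b))) (sym (^-distrib (2ℚ ^ d) σ (suc b))))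
        (*-monoʳ (σ ^ suc b) (0≤^ (suc b) 0≤σ) (^-monoʳ 1≤2 (proj₁ (proj₂ dyadic))))))
      open Density indicator 0≤indicator indicator≤1 d 0<σ dense using (ũ; e; 0<e; e*N)
      X : ℚ
      X = ∑ (λ x → mass x * inv σ * ũ x)
      -- In the sparse case suc b ≤ a S, so the rounded exponent d is at most 2 + S times a / suc b.
      -- Its eighth power is the source of (2 + S)⁸ in C.
      db≤ : d ℕ.* suc b ℕ.≤ (2 ℕ.+ S) ℕ.* a
      db≤ = ℕₚ.≤-trans (proj₂ (proj₂ dyadic)) (ℕₚ.≤-trans (ℕₚ.+-monoʳ-≤ (2 ℕ.* a) (ℕₚ.≤-trans b≤aJ (ℕₚ.≤-reflexive (ℕₚ.*-comm a S)))) (ℕₚ.≤-reflexive (sym (ℕₚ.*-distribʳ-+ a 2 S))))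
      codim≤ : ∀ {c} → c ℕ.≤ Constants.C₁ ks ℕ.* d ℕ.^ 8 → c ℕ.* suc b ℕ.^ 8 ℕ.≤ C ℕ.* a ℕ.^ 8
      codim≤ {c} c≤ = begin
        c ℕ.* suc b ℕ.^ 8 ≤⟨ ℕₚ.*-monoˡ-≤ (suc b ℕ.^ 8) c≤ ⟩
        C₁ ℕ.* d ℕ.^ 8 ℕ.* suc b ℕ.^ 8 ≡⟨ ℕₚ.*-assoc C₁ (d ℕ.^ 8) (suc b ℕ.^ 8) ⟩
        C₁ ℕ.* (d ℕ.^ 8 ℕ.* suc b ℕ.^ 8) ≡⟨ cong (C₁ ℕ.*_) (sym (ℕ-^-distrib d (suc b) 8)) ⟩
        C₁ ℕ.* (d ℕ.* suc b) ℕ.^ 8 ≤⟨ ℕₚ.*-monoʳ-≤ C₁ (ℕₚ.^-monoˡ-≤ 8 db≤) ⟩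
        C₁ ℕ.* ((2 ℕ.+ S) ℕ.* a) ℕ.^ 8 ≡⟨ cong (C₁ ℕ.*_) (ℕ-^-distrib (2 ℕ.+ S) a 8) ⟩
        C₁ ℕ.* ((2 ℕ.+ S) ℕ.^ 8 ℕ.* a ℕ.^ 8) ≡⟨ sym (ℕₚ.*-assoc C₁ _ (a ℕ.^ 8)) ⟩
        C ℕ.* a ℕ.^ 8 ∎
        where
        open ℕₚ.≤-Reasoning
        C₁ = Constants.C₁ ks
      decide : Dec (∥ X ∥ ≤ ε) → Goal
      decide (yes p) = inj₁ (≤-respˡ (sym (trans (sealed-∣-∣ _ 1ℚ) (cong ∥_∥ (correlation e 0<e e*N 0<σ)))) p)
      decide (no ¬p) = inj₂ (V , c , codim , codim≤ c≤ , ≤-respˡ (sym (trans (+-homo _ _) (cong (λ z → 1ℚ + z) (*-homo ε _)))) (bound _ (smoothed e 0<e e*N 0<σ V)))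
        where
        result = Core.Increment.increment 𝔽 n ε 0<ε ε<1 ks indicator 0≤indicator indicator≤1 s 0<σ dense (≰⇒> ¬p)
        V = proj₁ result
        c = proj₁ (proj₂ result)
        codim = proj₁ (proj₂ (proj₂ result))
        c≤ = proj₁ (proj₂ (proj₂ (proj₂ result)))
        bound = proj₂ (proj₂ (proj₂ (proj₂ result)))

    conclusion : Goal
    conclusion = by-size (ℕₚ.≤-total (a ℕ.* S) (suc b))
      where
      by-size : (a ℕ.* S ℕ.≤ suc b) ⊎ (suc b ℕ.≤ a ℕ.* S) → Goal
      by-size (inj₁ p) = dense-case p
      by-size (inj₂ p) = sparse-case p
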